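{- Let $k\ge1$ and $n-k\ge2$. The poset $\hat P_{n,k}$ obtained from $P_{n,k}$ by adjoining a minimum element $\hat 0$ is Eulerian, i.e. it is graded and every interval $[x,y]$ of rank greater than one has equally many elements of even rank and of odd rank.
   Context: Matroids on $[n]$ are given by their bases. Positroids are matroids of points of totally nonnegative Grassmannians; $Q_{n,k}$ is the poset of rank $k$ positroids on $[n]$ under inclusion; $\mathrm{env}(\mathcal M)$ is the smallest positroid containing $\mathcal M$. For a rank $k$ matroid $\mathcal M$, $\mathcal M^*=\{[n]\setminus J:J\in\mathcal M\}$ and $\mathcal M^{\downarrow2}=\{I\in\binom{[n]}{2}: I\subset J\text{ for some }J\in\mathcal M^*\}$. $P_{n,k}$ is the subposet of $Q_{n,2}$ (ordered by inclusion) consisting of the positroids $\mathrm{env}(\mathcal M^{\downarrow2})$ with $\mathcal M\in Q_{n,k}$. (It is graded of height $2k$.)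
   Formalization: Positroids are defined here by rational, instead of real, full-rank matrices with nonnegative maximal minors; that this gives the same positroids is a known theorem not proved here. -}

module Defs where

open import Data.Nat using (ℕ; zero; suc; _+_; _≤_; _%_)
open import Data.Bool using (Bool; true; false)
open import Data.Fin using (Fin; zero; suc)
open import Data.Fin.Subset using (Subset; ∣_∣; ∁; _⊆_)
open import Data.Vec as V using (Vec)
open import Data.List using (List; []; _∷_; _++_; [_]; map; length)
open import Data.List.Relation.Unary.Unique.Propositional using (Unique)
open import Data.List.Membership.Propositional using (_∈_)
open import Data.Maybe using (Maybe; nothing; just)
open import Data.Product using (Σ; _×_; ∃; _,_)
open import Data.Unit using (⊤)
open import Data.Empty using (⊥)
open import Data.Rational using (ℚ; 0ℚ; 1ℚ; _*_; -_) renaming (_+_ to _+ℚ_; _≤_ to _≤ℚ_)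
open import Relation.Binary.PropositionalEquality using (_≡_; _≢_)
open import Relation.Nullary using (¬_)

-- Families of subsets of [n] = Fin n (e.g. sets of bases of a matroid).
-- A family is stored canonically as a binary trie indexed by the
-- characteristic vector of a subset, so Fam n is in bijection with
-- (Subset n → Bool), and _≡_ on Fam n is equality of families.

Fam : ℕ → Set
Fam zero    = Bool
Fam (suc n) = Fam n × Fam n

memb : ∀ {n} → Fam n → Subset n → Bool
memb {zero}  b       V.[]          = b
memb {suc n} (f , t) (false V.∷ v) = memb f v
memb {suc n} (f , t) (true  V.∷ v) = memb t v

_∈F_ : ∀ {n} → Subset n → Fam n → Set
J ∈F 𝓜 = memb 𝓜 J ≡ true

_⊆F_ : ∀ {n} → Fam n → Fam n → Set
𝓜 ⊆F 𝓝 = ∀ J → J ∈F 𝓜 → J ∈F 𝓝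

elems : ∀ {n} → Subset n → List (Fin n)
elems V.[]          = []
elems (true  V.∷ v) = zero ∷ map suc (elems v)
elems (false V.∷ v) = map suc (elems v)

-- determinant of the square submatrix of A on the given list of columns
-- (Laplace expansion along the first row); only used with k columns.
minor : ∀ {n} (k : ℕ) → (Fin k → Fin n → ℚ) → List (Fin n) → ℚ
minor zero    A []      = 1ℚ
minor zero    A (_ ∷ _) = 0ℚ
minor {n} (suc k) A cs  = expand 1ℚ [] cs
  where
  expand : ℚ → List (Fin n) → List (Fin n) → ℚ
  expand s pre []         = 0ℚ
  expand s pre (c ∷ post) =
    (s * (A zero c * minor k (λ i → A (suc i)) (pre ++ post)))
      +ℚ expand (- s) (pre ++ [ c ]) post

plücker : ∀ {n k} → (Fin k → Fin n → ℚ) → Subset n → ℚ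
plücker {k = k} A J = minor k A (elems J)

-- Positroids: 𝓜 is a rank k positroid on [n] iff it is the matroid of a
-- point of the totally nonnegative Grassmannian Gr(k,n)≥0, i.e. of a
-- (full rank) k × n matrix all of whose maximal minors are ≥ 0:
-- 𝓜 = { J : |J| = k, Δ_J(A) ≠ 0 } (and 𝓜 ≠ ∅, i.e. A has rank k).
-- (Matrices over ℚ.)

IsPositroid : ∀ {n} (k : ℕ) → Fam n → Set
IsPositroid {n} k 𝓜 =
  Σ (Fin k → Fin n → ℚ) λ A →
      (∀ J → ∣ J ∣ ≡ k → 0ℚ ≤ℚ plücker A J)
    × (∀ J → J ∈F 𝓜 → ∣ J ∣ ≡ k × plücker A J ≢ 0ℚ)
    × (∀ J → ∣ J ∣ ≡ k → plücker A J ≢ 0ℚ → J ∈F 𝓜)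
    × (∃ λ J → J ∈F 𝓜)

-- 𝓜^{↓2} = { I ∈ ([n] choose 2) : I ⊆ J for some J ∈ 𝓜^* },
-- where J ∈ 𝓜^* iff [n] ∖ J ∈ 𝓜.
Down2 : ∀ {n} → Fam n → Subset n → Set
Down2 𝓜 I = ∣ I ∣ ≡ 2 × ∃ λ J → ∁ J ∈F 𝓜 × I ⊆ J

-- IsEnv D 𝓝 : 𝓝 is env(D), the smallest (rank 2) positroid containing D
-- (rank 2 since D consists of 2-subsets).
IsEnv : ∀ {n} → (Subset n → Set) → Fam n → Set
IsEnv D 𝓝 =
    IsPositroid 2 𝓝
  × (∀ I → D I → I ∈F 𝓝)
  × (∀ 𝓝′ → IsPositroid 2 𝓝′ → (∀ I → D I → I ∈F 𝓝′) → 𝓝 ⊆F 𝓝′)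

InP : ∀ n (k : ℕ) → Fam n → Set
InP n k x = Σ (Fam n) λ 𝓜 → IsPositroid k 𝓜 × IsEnv (Down2 𝓜) x

InPh : ∀ n (k : ℕ) → Maybe (Fam n) → Set
InPh n k nothing  = ⊤
InPh n k (just x) = InP n k x

_≤h_ : ∀ {n} → Maybe (Fam n) → Maybe (Fam n) → Set
nothing ≤h y        = ⊤
just x  ≤h nothing  = ⊥
just x  ≤h just y   = x ⊆F y

_<h_ : ∀ {n} → Maybe (Fam n) → Maybe (Fam n) → Set
x <h y = x ≤h y × x ≢ y

Covers : ∀ n (k : ℕ) → Maybe (Fam n) → Maybe (Fam n) → Set
Covers n k x y =
  InPh n k x × InPh n k y × x <h y ×
  (∀ z → InPh n k z → ¬ (x <h z × z <h y))

Maximal : ∀ n (k : ℕ) → Maybe (Fam n) → Set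
Maximal n k x = InPh n k x × (∀ z → InPh n k z → x ≤h z → z ≡ x)

-- ρ is a rank function making P̂_{n,k} graded: ρ(0̂) = 0, ρ increases by
-- one along covers, and all maximal elements have the same rank (so all
-- maximal chains have the same length).
Graded : ∀ n (k : ℕ) → (Maybe (Fam n) → ℕ) → Set
Graded n k ρ =
    ρ nothing ≡ 0
  × (∀ x y → Covers n k x y → ρ y ≡ suc (ρ x))
  × (∀ x y → Maximal n k x → Maximal n k y → ρ x ≡ ρ y)

HasCard : ∀ {A : Set} → (A → Set) → ℕ → Set
HasCard {A} P m =
  Σ (List A) λ xs → Unique xs × length xs ≡ m
    × (∀ a → P a → a ∈ xs) × (∀ a → a ∈ xs → P a)

EulerCond : ∀ n (k : ℕ) → (Maybe (Fam n) → ℕ) → Set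
EulerCond n k ρ =
  ∀ x y → InPh n k x → InPh n k y → x ≤h y → 2 + ρ x ≤ ρ y →
  Σ ℕ λ m →
      HasCard (λ z → InPh n k z × x ≤h z × z ≤h y × ρ z % 2 ≡ 0) m
    × HasCard (λ z → InPh n k z × x ≤h z × z ≤h y × ρ z % 2 ≡ 1) m

EulerianPh : ℕ → ℕ → Set
EulerianPh n k = Σ (Maybe (Fam n) → ℕ) λ ρ → Graded n k ρ × EulerCond n k ρ

{-# OPTIONS --safe #-}
-- A rank 2 positroid is a set of loops together with a partition of the
-- non-loops into at least two cyclic intervals, so it is coded by a cyclic word
-- over ○ ● ◆. Inclusion becomes a condition on gaps: non-loops of x are non-loops
-- of z, and wherever x has a ◆, z must have one after the previous non-loop of x
-- or at the same place. A 2 × n matrix with nonnegative minors is a sequence of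
-- plane vectors turning counterclockwise, which gives the coding.
--
-- The elements of P_{n,k} are the words with at least r = n - k letters ◆: the
-- complement of a basis of 𝓜 has r elements in different classes. Conversely a
-- matrix for a given word is built from right to left by bordering, with signs
-- chosen so that each new maximal minor is a sum of old ones; no cancellation
-- occurs, so nonnegativity and the vanishing pattern are both controlled.
--
-- The rank of a word is 1 - 2r plus its weight, where ● weighs 1 and ◆ weighs 2.
-- After a rotation x ends with a non-loop, membership in [x, y] is decided by a
-- finite automaton reading the words once, and the signed count of the interval
-- is a product of transfer matrices, which vanishes as soon as x and y differ in
-- one letter. For the lower interval [0̂, y] the signed sum over the words
-- below y is 1, which 0̂ cancels.
module Submission where

open import Defs
open import Data.Nat using (ℕ; _≤_; _∸_)
open import Data.Bool using (Bool; true; false; not; _∧_; _∨_; if_then_else_; b≤b) renaming (_≤_ to _≤ᵇ_)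
open import Data.Bool.Properties using (not-involutive; T-≡) renaming (≤-trans to ≤ᵇ-trans; ≤-minimum to false≤; ≤-maximum to ≤true)
open import Data.Empty using (⊥-elim)
open import Data.Fin using (Fin; zero; suc; toℕ)
open import Data.Fin.Subset using (Subset; ∣_∣; ∁; _⊆_; ⊥)
open import Data.Fin.Subset.Properties using (∣⊥∣≡0; ∣∁p∣≡n∸∣p∣; s⊆s; out⊆; drop-∷-⊆)
open import Data.Maybe using (Maybe; nothing; just; is-just)
open import Data.Maybe.Properties using (just-injective)
open import Data.Nat using (zero; suc; pred; _⊓_; _%_; z≤n; s≤s; s≤s⁻¹) renaming (_+_ to _+ⁿ_)
open import Data.Nat.Properties as ℕₚ using ()
open import Data.Product using (Σ; ∃; ∃₂; _×_; _,_; proj₁; proj₂)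
open import Data.Sum using (_⊎_; inj₁; inj₂; [_,_]′)
open import Data.Unit using (⊤; tt)
open import Data.Vec using (Vec; []; _∷_; _∷ʳ_; initLast; lookup; tabulate; replicate; _[_]≔_; here; there)
open import Data.Vec.Properties using (map-∷ʳ; ∷ʳ-injective; tabulate∘lookup; ∷-injectiveʳ)
open import Function using (case_of_; Equivalence)
open import Relation.Nullary using (¬_; Dec; yes; no; does; ¬?)
open import Relation.Nullary.Decidable using (_×-dec_; dec-true; map′)
open import Relation.Binary using (tri<; tri≈; tri>)
open import Relation.Binary.PropositionalEquality hiding ([_])

-- The realisation runs on the dual side, because `Down2` only sees the dual matroid. Bordering a
-- matrix adds to the dual a vector that is a combination of chosen old ones, and an old column `m`
-- enters a new minor with a Laplace sign given by its position among the columns outside `K`. That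
-- position is the same for all relevant `K` only if `m` is the first non-loop (all columns before
-- it are outside `K`) or the last one (all columns after it are). Hence only these two columns are
-- ever used, and they suffice: the first continues a class, the last closes the cycle, and both
-- together give a new class once the dual rank has reached r.
--
-- The wrapping gap couples the initial and the final flag of the automaton. Most cyclic statements
-- are therefore rotated until a ◆ stands at an end, where the coupling disappears or reduces to a
-- single pair.
--
-- The constant 1 - 2r gives the minimal words rank one: as long as there is a ●, or a ◆ beyond the
-- r-th, a word of weight one less lies below, so a minimal word has exactly r letters ◆, no ●, and
-- weight 2r.

module Words where

  -- Words, the inclusion automaton and its behaviour under rotation.

  open import Data.Nat using (_+_; _≟_)
  open import Data.Vec using (map)

  -- ○ is a loop, ◆ opens a new parallel class, ● continues the class of the
  -- cyclically preceding non-loop.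
  data Letter : Set where
    ○ ● ◆ : Letter

  Word : ℕ → Set
  Word = Vec Letter

  -- The flag of the automaton records whether z has had a ◆ since the last
  -- non-loop of x.
  run : ∀ {n} → Bool → Word n → Word n → Maybe Bool
  run f []      []      = just f
  run f (○ ∷ x) (○ ∷ z) = run f x z
  run f (○ ∷ x) (● ∷ z) = run f x z
  run f (○ ∷ x) (◆ ∷ z) = run true x z
  run f (● ∷ x) (○ ∷ z) = nothing
  run f (● ∷ x) (● ∷ z) = run false x z
  run f (● ∷ x) (◆ ∷ z) = run false x z
  run f (◆ ∷ x) (○ ∷ z) = nothing
  run true  (◆ ∷ x) (● ∷ z) = run false x z
  run false (◆ ∷ x) (● ∷ z) = nothing
  run f (◆ ∷ x) (◆ ∷ z) = run false x z

  -- Inclusion of the coded positroids. The first flag describes the gap that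
  -- wraps around the end of the word, so it must be justified by the last one.
  Cyc : ∀ {n} → Word n → Word n → Set
  Cyc x z = ∃₂ λ f f′ → run f x z ≡ just f′ × f ≤ᵇ f′

  ∨-lub : ∀ {f g h} → f ≤ᵇ h → g ≤ᵇ h → (f ∨ g) ≤ᵇ h
  ∨-lub {false} p q = q
  ∨-lub {true}  p q = p

  ≤∨ˡ : ∀ f g → f ≤ᵇ (f ∨ g)
  ≤∨ˡ false g = false≤ g
  ≤∨ˡ true  g = b≤b

  ≤∨ʳ : ∀ f g → g ≤ᵇ (f ∨ g)
  ≤∨ʳ false g = b≤b
  ≤∨ʳ true  g = ≤true g

  -- The flag of `x` against `z` always dominates both given flags. A ◆ of `y` in a gap of `x` is
  -- answered by a ◆ of `z` after the preceding non-loop of `y`, hence in the same gap; and the last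
  -- non-loop of `y` is no earlier than that of `x`.
  run-trans : ∀ {n f f′ g g′ h} (x y z : Word n) →
    run f x y ≡ just f′ → run g y z ≡ just g′ → f ≤ᵇ h → g ≤ᵇ h →
    ∃ λ h′ → run h x z ≡ just h′ × f′ ≤ᵇ h′ × g′ ≤ᵇ h′
  run-trans [] [] [] refl refl fh gh = _ , refl , fh , gh
  run-trans (○ ∷ x) (○ ∷ y) (○ ∷ z) p q fh gh = run-trans x y z p q fh gh
  run-trans (○ ∷ x) (○ ∷ y) (● ∷ z) p q fh gh = run-trans x y z p q fh gh
  run-trans (○ ∷ x) (○ ∷ y) (◆ ∷ z) p q fh gh = run-trans x y z p q (≤true _) b≤b
  run-trans (○ ∷ x) (● ∷ y) (● ∷ z) p q fh gh = run-trans x y z p q fh (false≤ _)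
  run-trans (○ ∷ x) (● ∷ y) (◆ ∷ z) p q fh gh = run-trans x y z p q (≤true _) (false≤ _)
  run-trans {g = true} (○ ∷ x) (◆ ∷ y) (● ∷ z) p q fh b≤b = run-trans x y z p q b≤b (false≤ _)
  run-trans (○ ∷ x) (◆ ∷ y) (◆ ∷ z) p q fh gh = run-trans x y z p q b≤b (false≤ _)
  run-trans (● ∷ x) (● ∷ y) (● ∷ z) p q fh gh = run-trans x y z p q b≤b b≤b
  run-trans (● ∷ x) (● ∷ y) (◆ ∷ z) p q fh gh = run-trans x y z p q b≤b b≤b
  run-trans {g = true} (● ∷ x) (◆ ∷ y) (● ∷ z) p q fh gh = run-trans x y z p q b≤b b≤b
  run-trans (● ∷ x) (◆ ∷ y) (◆ ∷ z) p q fh gh = run-trans x y z p q b≤b b≤b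
  run-trans {f = true} (◆ ∷ x) (● ∷ y) (● ∷ z) p q b≤b gh = run-trans x y z p q b≤b b≤b
  run-trans {f = true} (◆ ∷ x) (● ∷ y) (◆ ∷ z) p q b≤b gh = run-trans x y z p q b≤b b≤b
  run-trans {g = true} (◆ ∷ x) (◆ ∷ y) (● ∷ z) p q fh b≤b = run-trans x y z p q b≤b b≤b
  run-trans (◆ ∷ x) (◆ ∷ y) (◆ ∷ z) p q fh gh = run-trans x y z p q b≤b b≤b

  Cyc-trans : ∀ {n} (x y z : Word n) → Cyc x y → Cyc y z → Cyc x z
  Cyc-trans x y z (f , f′ , p , ff) (g , g′ , q , gg)
    with run-trans x y z p q (≤∨ˡ f g) (≤∨ʳ f g)
  ... | h′ , r , fh , gh = f ∨ g , h′ , r , ∨-lub (≤ᵇ-trans ff fh) (≤ᵇ-trans gg gh)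

  run-mono : ∀ {n f g f′} (x z : Word n) → f ≤ᵇ g → run f x z ≡ just f′ →
    ∃ λ g′ → run g x z ≡ just g′ × f′ ≤ᵇ g′
  run-mono [] [] fg refl = _ , refl , fg
  run-mono (○ ∷ x) (○ ∷ z) fg p = run-mono x z fg p
  run-mono (○ ∷ x) (● ∷ z) fg p = run-mono x z fg p
  run-mono (○ ∷ x) (◆ ∷ z) fg p = _ , p , b≤b
  run-mono (● ∷ x) (● ∷ z) fg p = _ , p , b≤b
  run-mono (● ∷ x) (◆ ∷ z) fg p = _ , p , b≤b
  run-mono {f = true} (◆ ∷ x) (● ∷ z) b≤b p = _ , p , b≤b
  run-mono (◆ ∷ x) (◆ ∷ z) fg p = _ , p , b≤b

  Cyc? : ∀ {n} (x z : Word n) → Dec (Cyc x z)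
  Cyc? x z with run false x z in p | run true x z in q
  ... | just f′ | _          = yes (false , f′ , p , false≤ f′)
  ... | nothing | just true  = yes (true , true , q , b≤b)
  ... | nothing | nothing    = no λ where
    (false , _ , r , _) → case trans (sym p) r of λ ()
    (true  , _ , r , _) → case trans (sym q) r of λ ()
  ... | nothing | just false = no λ where
    (false , _ , r , _) → case trans (sym p) r of λ ()
    (true  , true , r , _) → case trans (sym q) r of λ ()

  run-∷ʳ : ∀ {n f f′} (x z : Word n) a c → run f x z ≡ just f′ →
    run f (x ∷ʳ a) (z ∷ʳ c) ≡ run f′ (a ∷ []) (c ∷ [])
  run-∷ʳ [] [] a c refl = refl
  run-∷ʳ (○ ∷ x) (○ ∷ z) a c p = run-∷ʳ x z a c p
  run-∷ʳ (○ ∷ x) (● ∷ z) a c p = run-∷ʳ x z a c p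
  run-∷ʳ (○ ∷ x) (◆ ∷ z) a c p = run-∷ʳ x z a c p
  run-∷ʳ (● ∷ x) (● ∷ z) a c p = run-∷ʳ x z a c p
  run-∷ʳ (● ∷ x) (◆ ∷ z) a c p = run-∷ʳ x z a c p
  run-∷ʳ {f = true} (◆ ∷ x) (● ∷ z) a c p = run-∷ʳ x z a c p
  run-∷ʳ (◆ ∷ x) (◆ ∷ z) a c p = run-∷ʳ x z a c p

  run-∷ʳ⁻ : ∀ {n f f″} (x z : Word n) a c → run f (x ∷ʳ a) (z ∷ʳ c) ≡ just f″ →
    ∃ λ f′ → run f x z ≡ just f′ × run f′ (a ∷ []) (c ∷ []) ≡ just f″
  run-∷ʳ⁻ [] [] a c p = _ , refl , p
  run-∷ʳ⁻ (○ ∷ x) (○ ∷ z) a c p = run-∷ʳ⁻ x z a c p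
  run-∷ʳ⁻ (○ ∷ x) (● ∷ z) a c p = run-∷ʳ⁻ x z a c p
  run-∷ʳ⁻ (○ ∷ x) (◆ ∷ z) a c p = run-∷ʳ⁻ x z a c p
  run-∷ʳ⁻ (● ∷ x) (● ∷ z) a c p = run-∷ʳ⁻ x z a c p
  run-∷ʳ⁻ (● ∷ x) (◆ ∷ z) a c p = run-∷ʳ⁻ x z a c p
  run-∷ʳ⁻ {f = true} (◆ ∷ x) (● ∷ z) a c p = run-∷ʳ⁻ x z a c p
  run-∷ʳ⁻ (◆ ∷ x) (◆ ∷ z) a c p = run-∷ʳ⁻ x z a c p

  run-∷ : ∀ {n f f′} (x z : Word n) a c → run f (a ∷ x) (c ∷ z) ≡ just f′ →
    ∃ λ g → run f (a ∷ []) (c ∷ []) ≡ just g × run g x z ≡ just f′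
  run-∷ x z ○ ○ p = _ , refl , p
  run-∷ x z ○ ● p = _ , refl , p
  run-∷ x z ○ ◆ p = _ , refl , p
  run-∷ x z ● ● p = _ , refl , p
  run-∷ x z ● ◆ p = _ , refl , p
  run-∷ {f = true} x z ◆ ● p = _ , refl , p
  run-∷ x z ◆ ◆ p = _ , refl , p

  run-∷⁻ : ∀ {n f g} (x z : Word n) a c → run f (a ∷ []) (c ∷ []) ≡ just g →
    run f (a ∷ x) (c ∷ z) ≡ run g x z
  run-∷⁻ x z ○ ○ refl = refl
  run-∷⁻ x z ○ ● refl = refl
  run-∷⁻ x z ○ ◆ refl = refl
  run-∷⁻ x z ● ● refl = refl
  run-∷⁻ x z ● ◆ refl = refl
  run-∷⁻ {f = true} x z ◆ ● refl = refl
  run-∷⁻ x z ◆ ◆ refl = refl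

  rot : ∀ {A : Set} {n} → Vec A n → Vec A n
  rot []      = []
  rot (a ∷ v) = v ∷ʳ a

  -- The flag `g` after the first letter is the new start. The remaining letters lead to `f′`, which
  -- is at least `f`, so by monotonicity reading the first letter again returns a flag at least `g`.
  Cyc-rot : ∀ {n} (x z : Word n) → Cyc x z → Cyc (rot x) (rot z)
  Cyc-rot [] [] c = c
  Cyc-rot (a ∷ x) (c ∷ z) (f , f′ , p , ff) with run-∷ x z a c p
  ... | g , p₁ , p₂ with run-mono (a ∷ []) (c ∷ []) ff p₁
  ... | g′ , p₃ , gg = g , g′ , trans (run-∷ʳ x z a c p₂) p₃ , gg

  Cyc-rot⁻ : ∀ {n} (x z : Word n) → Cyc (rot x) (rot z) → Cyc x z
  Cyc-rot⁻ [] [] c = c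
  Cyc-rot⁻ (a ∷ x) (c ∷ z) (g , g″ , p , gg) with run-∷ʳ⁻ x z a c p
  ... | f′ , p₁ , p₂ with run-mono x z gg p₁
  ... | h , p₃ , hh = f′ , h , trans (run-∷⁻ x z a c p₂) p₃ , hh

  bars : ∀ {n} → Word n → ℕ
  bars []      = 0
  bars (○ ∷ w) = bars w
  bars (● ∷ w) = bars w
  bars (◆ ∷ w) = suc (bars w)

  toℕᵇ : Bool → ℕ
  toℕᵇ false = 0
  toℕᵇ true  = 1

  -- The flag acts as a credit: a ◆ of `z` earns at most one unit, and a ◆ of `x` consumes one,
  -- either stored in the flag or earned on the spot.
  run-bars : ∀ {n f f′} (x z : Word n) → run f x z ≡ just f′ →
    bars x + toℕᵇ f′ ≤ toℕᵇ f + bars z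
  run-bars {f = f} [] [] refl rewrite ℕₚ.+-identityʳ (toℕᵇ f) = ℕₚ.≤-refl
  run-bars (○ ∷ x) (○ ∷ z) p = run-bars x z p
  run-bars (○ ∷ x) (● ∷ z) p = run-bars x z p
  run-bars {f = f} (○ ∷ x) (◆ ∷ z) p = ℕₚ.≤-trans (run-bars x z p) (ℕₚ.m≤n+m _ (toℕᵇ f))
  run-bars {f = f} (● ∷ x) (● ∷ z) p = ℕₚ.≤-trans (run-bars x z p) (ℕₚ.m≤n+m _ (toℕᵇ f))
  run-bars {f = f} (● ∷ x) (◆ ∷ z) p =
    ℕₚ.≤-trans (run-bars x z p) (ℕₚ.≤-trans (ℕₚ.n≤1+n _) (ℕₚ.m≤n+m _ (toℕᵇ f)))
  run-bars {f = true} (◆ ∷ x) (● ∷ z) p = s≤s (run-bars x z p)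
  run-bars {f = f} (◆ ∷ x) (◆ ∷ z) p = ℕₚ.≤-trans (s≤s (run-bars x z p)) (ℕₚ.m≤n+m _ (toℕᵇ f))

  -- Initial and final credit cancel around the cycle. Consequently the words with at least r
  -- letters ◆ form an up-set.
  Cyc-bars : ∀ {n} (x z : Word n) → Cyc x z → bars x ≤ bars z
  Cyc-bars x z (true , true , p , _) =
    s≤s⁻¹ (subst (_≤ suc (bars z)) (ℕₚ.+-comm (bars x) 1) (run-bars x z p))
  Cyc-bars x z (false , f′ , p , _) = ℕₚ.≤-trans (ℕₚ.m≤m+n _ (toℕᵇ f′)) (run-bars x z p)

  mark : Bool → Letter
  mark true  = ◆
  mark false = ○

  word : ∀ {n} → Subset n → Word n
  word = map mark

  bars-word : ∀ {n} (J : Subset n) → bars (word J) ≡ ∣ J ∣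
  bars-word []          = refl
  bars-word (true  ∷ J) = cong suc (bars-word J)
  bars-word (false ∷ J) = bars-word J

  tabulateF : ∀ {n} → (Subset n → Bool) → Fam n
  tabulateF {zero}  p = p []
  tabulateF {suc n} p = tabulateF (λ J → p (false ∷ J)) , tabulateF (λ J → p (true ∷ J))

  memb-tabulateF : ∀ {n} (p : Subset n → Bool) J → memb (tabulateF p) J ≡ p J
  memb-tabulateF {zero}  p []          = refl
  memb-tabulateF {suc n} p (false ∷ J) = memb-tabulateF (λ J → p (false ∷ J)) J
  memb-tabulateF {suc n} p (true  ∷ J) = memb-tabulateF (λ J → p (true ∷ J)) J

  ⊆F-antisym : ∀ {n} {x y : Fam n} → x ⊆F y → y ⊆F x → x ≡ y
  ⊆F-antisym {zero} {false} {false} p q = refl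
  ⊆F-antisym {zero} {true}  {true}  p q = refl
  ⊆F-antisym {zero} {false} {true}  p q = case q [] refl of λ ()
  ⊆F-antisym {zero} {true}  {false} p q = case p [] refl of λ ()
  ⊆F-antisym {suc n} {x₀ , x₁} {y₀ , y₁} p q = cong₂ _,_
    (⊆F-antisym (λ J → p (false ∷ J)) (λ J → q (false ∷ J)))
    (⊆F-antisym (λ J → p (true ∷ J)) (λ J → q (true ∷ J)))

  does-true : ∀ {P : Set} (d : Dec P) → does d ≡ true → P
  does-true (yes p) _ = p

  -- J is a basis iff the positroid {J} lies below the one coded by w.
  Basis : ∀ {n} → Word n → Subset n → Set
  Basis w J = ∣ J ∣ ≡ 2 × Cyc (word J) w

  Basis? : ∀ {n} (w : Word n) J → Dec (Basis w J)
  Basis? w J = (∣ J ∣ ≟ 2) ×-dec Cyc? (word J) w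

  fam : ∀ {n} → Word n → Fam n
  fam w = tabulateF (λ J → does (Basis? w J))

  fam⁺ : ∀ {n} (w : Word n) {J} → Basis w J → J ∈F fam w
  fam⁺ w {J} B = trans (memb-tabulateF _ J) (dec-true (Basis? w J) B)

  fam⁻ : ∀ {n} (w : Word n) {J} → J ∈F fam w → Basis w J
  fam⁻ w {J} m = does-true (Basis? w J) (trans (sym (memb-tabulateF _ J)) m)

  Cyc⇒⊆F : ∀ {n} (x z : Word n) → Cyc x z → fam x ⊆F fam z
  Cyc⇒⊆F x z c J m with fam⁻ x m
  ... | two , d = fam⁺ z (two , Cyc-trans (word J) x z d c)

  data FirstBar : ∀ {n} → ℕ → Word n → Set where
    here  : ∀ {n} {w : Word n} → FirstBar 0 (◆ ∷ w)
    there : ∀ {n k a} {w : Word n} → FirstBar k w → FirstBar (suc k) (a ∷ w)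

  firstBar : ∀ {n} (w : Word n) → 1 ≤ bars w → ∃ λ k → FirstBar k w
  firstBar (○ ∷ w) p with firstBar w p
  ... | k , q = suc k , there q
  firstBar (● ∷ w) p with firstBar w p
  ... | k , q = suc k , there q
  firstBar (◆ ∷ w) p = 0 , here

  FirstBar-∷ʳ : ∀ {n k a} {w : Word n} → FirstBar k w → FirstBar k (w ∷ʳ a)
  FirstBar-∷ʳ here      = here
  FirstBar-∷ʳ (there q) = there (FirstBar-∷ʳ q)

  -- Induction on the position of the first ◆, which every rotation moves one place to the front.
  rot-to-bar : ∀ {n} (P : Word (suc n) → Set) → (∀ w → P (rot w) → P w) →
    (∀ w → P (◆ ∷ w)) → ∀ w → 1 ≤ bars w → P w
  rot-to-bar {n} P step base w p = go (proj₂ (firstBar w p))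
    where
    go : ∀ {k w} → FirstBar k w → P w
    go here = base _
    go {w = a ∷ w} (there q) = step (a ∷ w) (go (FirstBar-∷ʳ q))

  rot-to-last-bar : ∀ {n} (P : Word (suc n) → Set) → (∀ w → P (rot w) → P w) →
    (∀ w → P (w ∷ʳ ◆)) → ∀ w → 1 ≤ bars w → P w
  rot-to-last-bar P step base = rot-to-bar P step (λ w → step (◆ ∷ w) (base w))

  ∣∷ʳ∣ : ∀ {n} (J : Subset n) a → ∣ J ∷ʳ a ∣ ≡ ∣ a ∷ J ∣
  ∣∷ʳ∣ [] a = refl
  ∣∷ʳ∣ (true  ∷ J) true  = cong suc (∣∷ʳ∣ J true)
  ∣∷ʳ∣ (true  ∷ J) false = cong suc (∣∷ʳ∣ J false)
  ∣∷ʳ∣ (false ∷ J) true  = ∣∷ʳ∣ J true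
  ∣∷ʳ∣ (false ∷ J) false = ∣∷ʳ∣ J false

  bars-∷ʳ : ∀ {n} (w : Word n) a → bars (w ∷ʳ a) ≡ bars (a ∷ w)
  bars-∷ʳ [] a = refl
  bars-∷ʳ (○ ∷ w) ○ = bars-∷ʳ w ○
  bars-∷ʳ (○ ∷ w) ● = bars-∷ʳ w ●
  bars-∷ʳ (○ ∷ w) ◆ = bars-∷ʳ w ◆
  bars-∷ʳ (● ∷ w) ○ = bars-∷ʳ w ○
  bars-∷ʳ (● ∷ w) ● = bars-∷ʳ w ●
  bars-∷ʳ (● ∷ w) ◆ = bars-∷ʳ w ◆
  bars-∷ʳ (◆ ∷ w) ○ = cong suc (bars-∷ʳ w ○)
  bars-∷ʳ (◆ ∷ w) ● = cong suc (bars-∷ʳ w ●)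
  bars-∷ʳ (◆ ∷ w) ◆ = cong suc (bars-∷ʳ w ◆)

  bars-rot : ∀ {n} (w : Word n) → bars (rot w) ≡ bars w
  bars-rot []      = refl
  bars-rot (a ∷ w) = bars-∷ʳ w a

  -- Inclusion of words is determined by the two-element bases.

  BasesIn : ∀ {n} → Word n → Word n → Set
  BasesIn x z = ∀ J → Basis x J → Cyc (word J) z

  BasesIn-rot : ∀ {n} (x z : Word n) → BasesIn x z → BasesIn (rot x) (rot z)
  BasesIn-rot [] [] H J B = H J B
  BasesIn-rot (a ∷ x) (c ∷ z) H J (two , d) with initLast J
  ... | J′ , j , refl = subst (λ w → Cyc w (z ∷ʳ c)) (sym eq) (Cyc-rot (word (j ∷ J′)) (c ∷ z)
      (H (j ∷ J′) (trans (sym (∣∷ʳ∣ J′ j)) two , Cyc-rot⁻ (word (j ∷ J′)) (a ∷ x) (subst (λ w → Cyc w (x ∷ʳ a)) eq d))))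
    where
    eq : word (J′ ∷ʳ j) ≡ word J′ ∷ʳ mark j
    eq = map-∷ʳ mark j J′

  Succ : ∀ {n} → Bool → Word n → Word n → Set
  Succ f x z = ∃ λ f′ → run f x z ≡ just f′

  Succ-⊥ : ∀ {n} f (z : Word n) → Succ f (word ⊥) z
  Succ-⊥ f []      = f , refl
  Succ-⊥ f (○ ∷ z) = Succ-⊥ f z
  Succ-⊥ f (● ∷ z) = Succ-⊥ f z
  Succ-⊥ f (◆ ∷ z) = Succ-⊥ true z

  -- Here e and f are the flags for x and z in the gap that precedes J.
  Matches : ∀ {n} → ℕ → Bool → Bool → Word n → Word n → Set
  Matches m e f x z = ∀ J → ∣ J ∣ ≡ m → Succ e (word J) x → Succ f (word J) z

  isBar : Letter → Bool
  isBar ◆ = true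
  isBar _ = false

  run-○ : ∀ {n} f (x z : Word n) c → run f (○ ∷ x) (c ∷ z) ≡ run (isBar c ∨ f) x z
  run-○ f x z ○ = refl
  run-○ f x z ● = refl
  run-○ f x z ◆ = refl

  Matches-∷ : ∀ {n m e f} (x z : Word n) a c → Matches m e f (a ∷ x) (c ∷ z) → Matches m (isBar a ∨ e) (isBar c ∨ f) x z
  Matches-∷ {e = e} {f} x z a c H J m (g , p) with H (false ∷ J) m (g , trans (run-○ e (word J) x a) p)
  ... | h , q = h , trans (sym (run-○ f (word J) z c)) q

  data NonLoop : Letter → Set where
    ●′ : NonLoop ●
    ◆′ : NonLoop ◆

  run-true : ∀ {n a c} (x z : Word n) → NonLoop a → NonLoop c → run true (a ∷ x) (c ∷ z) ≡ run false x z
  run-true x z ●′ ●′ = refl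
  run-true x z ●′ ◆′ = refl
  run-true x z ◆′ ●′ = refl
  run-true x z ◆′ ◆′ = refl

  Succ-nonloop : ∀ {n f a c} {x z : Word n} → NonLoop a → Succ f (a ∷ x) (c ∷ z) → NonLoop c
  Succ-nonloop {c = ●} n S = ●′
  Succ-nonloop {c = ◆} n S = ◆′
  Succ-nonloop {c = ○} ●′ ()
  Succ-nonloop {c = ○} ◆′ ()

  Matches-nonloop : ∀ {n m a c} (x z : Word n) → NonLoop a → NonLoop c →
    Matches (suc m) true true (a ∷ x) (c ∷ z) → Matches m false false x z
  Matches-nonloop x z na nc H J m (f , p) with H (true ∷ J) (cong suc m) (f , trans (run-true (word J) x ◆′ na) p)
  ... | g , q = g , trans (sym (run-true (word J) z ◆′ nc)) q

  first◆ : ∀ {n} → Word n → Subset n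
  first◆ []      = []
  first◆ (○ ∷ w) = false ∷ first◆ w
  first◆ (● ∷ w) = false ∷ first◆ w
  first◆ (◆ ∷ w) = true ∷ ⊥

  ∣first◆∣ : ∀ {n} (w : Word n) → 1 ≤ bars w → ∣ first◆ w ∣ ≡ 1
  ∣first◆∣ (○ ∷ w) p = ∣first◆∣ w p
  ∣first◆∣ (● ∷ w) p = ∣first◆∣ w p
  ∣first◆∣ {suc n} (◆ ∷ w) p = cong suc (∣⊥∣≡0 n)

  Succ-first◆ : ∀ {n} f (w : Word n) → 1 ≤ bars w → Succ f (word (first◆ w)) w
  Succ-first◆ f (○ ∷ w) p = Succ-first◆ f w p
  Succ-first◆ f (● ∷ w) p = Succ-first◆ f w p
  Succ-first◆ f (◆ ∷ w) p = Succ-⊥ false w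

  -- Three kinds of bases are tested: `H₁` pairs the last non-loop of `x` with a later element, `H₀`
  -- the initial element with a later one, `H₂` two later elements. A ◆ of `x` forms a basis with
  -- the last non-loop, which forces the ◆ in `z`. A ● of `x` forms a basis with the initial element
  -- if a ◆ has passed since (`e`), and otherwise with the next ◆ ahead; either way it is a non-loop
  -- of `z`.
  matches⇒Succ : ∀ {n} e f (x z : Word n) → Matches 1 false f x z → Matches 1 e true x z → Matches 2 true true x z →
    e ≡ true ⊎ 1 ≤ bars x → Succ f x z
  matches⇒Succ e f [] [] _ _ _ _ = f , refl
  matches⇒Succ e f (○ ∷ x) (○ ∷ z) H₁ H₀ H₂ p = matches⇒Succ e f x z (Matches-∷ x z ○ ○ H₁) (Matches-∷ x z ○ ○ H₀) (Matches-∷ x z ○ ○ H₂) p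
  matches⇒Succ e f (○ ∷ x) (● ∷ z) H₁ H₀ H₂ p = matches⇒Succ e f x z (Matches-∷ x z ○ ● H₁) (Matches-∷ x z ○ ● H₀) (Matches-∷ x z ○ ● H₂) p
  matches⇒Succ e f (○ ∷ x) (◆ ∷ z) H₁ H₀ H₂ p = matches⇒Succ e true x z (Matches-∷ x z ○ ◆ H₁) (Matches-∷ x z ○ ◆ H₀) (Matches-∷ x z ○ ◆ H₂) p
  matches⇒Succ {suc n} e f (● ∷ x) (○ ∷ z) H₁ H₀ H₂ (inj₁ refl) with Succ-⊥ false x
  ... | g , q with H₀ (true ∷ ⊥) (cong suc (∣⊥∣≡0 n)) (g , q)
  ... | _ , ()
  matches⇒Succ e f (● ∷ x) (○ ∷ z) H₁ H₀ H₂ (inj₂ p) with H₂ (true ∷ first◆ x) (cong suc (∣first◆∣ x p)) (Succ-first◆ false x p)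
  ... | _ , ()
  matches⇒Succ e f (● ∷ x) (● ∷ z) H₁ H₀ H₂ p =
    matches⇒Succ e false x z (Matches-nonloop x z ●′ ●′ H₂) (Matches-∷ x z ● ● H₀) (Matches-∷ x z ● ● H₂) p
  matches⇒Succ e f (● ∷ x) (◆ ∷ z) H₁ H₀ H₂ p =
    matches⇒Succ e false x z (Matches-nonloop x z ●′ ◆′ H₂) (Matches-∷ x z ● ◆ H₀) (Matches-∷ x z ● ◆ H₂) p
  matches⇒Succ {suc n} e f (◆ ∷ x) (c ∷ z) H₁ H₀ H₂ p
    with c | f | H₁ (true ∷ ⊥) (cong suc (∣⊥∣≡0 n)) (Succ-⊥ false x)
  ... | ○ | _     | _ , ()
  ... | ● | false | _ , ()
  ... | ● | true  | _ =
    matches⇒Succ true false x z (Matches-nonloop x z ◆′ ●′ H₂) (Matches-∷ x z ◆ ● H₀) (Matches-∷ x z ◆ ● H₂) (inj₁ refl)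
  ... | ◆ | _     | _ =
    matches⇒Succ true false x z (Matches-nonloop x z ◆′ ◆′ H₂) (Matches-∷ x z ◆ ◆ H₀) (Matches-∷ x z ◆ ◆ H₂) (inj₁ refl)

  hasNL : ∀ {n} → Word n → Bool
  hasNL []      = false
  hasNL (○ ∷ w) = hasNL w
  hasNL (● ∷ w) = true
  hasNL (◆ ∷ w) = true

  bars⇒hasNL : ∀ {n} (w : Word n) → 1 ≤ bars w → hasNL w ≡ true
  bars⇒hasNL (○ ∷ w) p = bars⇒hasNL w p
  bars⇒hasNL (● ∷ w) p = refl
  bars⇒hasNL (◆ ∷ w) p = refl

  noNL : ∀ {n} (w : Word n) → hasNL w ≡ false → w ≡ word ⊥
  noNL []      p = refl
  noNL (○ ∷ w) p = cong (○ ∷_) (noNL w p)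

  lastNL : ∀ {n} → Word n → Subset n
  lastNL []      = []
  lastNL (○ ∷ w) = false ∷ lastNL w
  lastNL (_ ∷ w) with hasNL w
  ... | true  = false ∷ lastNL w
  ... | false = true ∷ ⊥

  ∣lastNL∣ : ∀ {n} (w : Word n) → hasNL w ≡ true → ∣ lastNL w ∣ ≡ 1
  ∣lastNL∣ (○ ∷ w) p = ∣lastNL∣ w p
  ∣lastNL∣ {suc n} (● ∷ w) p with hasNL w in q
  ... | true  = ∣lastNL∣ w q
  ... | false = cong suc (∣⊥∣≡0 n)
  ∣lastNL∣ {suc n} (◆ ∷ w) p with hasNL w in q
  ... | true  = ∣lastNL∣ w q
  ... | false = cong suc (∣⊥∣≡0 n)

  Succ-lastNL : ∀ {n} f (w : Word n) → f ≡ true ⊎ 1 ≤ bars w → hasNL w ≡ true → Succ f (word (lastNL w)) w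
  Succ-lastNL f (○ ∷ w) p q = Succ-lastNL f w p q
  Succ-lastNL f (● ∷ w) p q with hasNL w in eq
  ... | true  = Succ-lastNL f w p eq
  Succ-lastNL f (● ∷ w) (inj₁ refl) q | false = Succ-⊥ false w
  Succ-lastNL f (● ∷ w) (inj₂ p) q | false = case trans (sym eq) (bars⇒hasNL w p) of λ ()
  Succ-lastNL f (◆ ∷ w) p q with hasNL w in eq
  ... | true  = Succ-lastNL true w (inj₁ refl) eq
  ... | false = Succ-⊥ false w

  run-nonloop : ∀ {f a c k} → NonLoop a → run f (a ∷ []) (c ∷ []) ≡ just k → k ≡ false
  run-nonloop {c = ●} ●′ refl = refl
  run-nonloop {c = ◆} ●′ refl = refl
  run-nonloop {f = true} {c = ●} ◆′ refl = refl
  run-nonloop {c = ◆} ◆′ refl = refl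

  -- The final flag depends only on what `z` does after the last non-loop of `x`, so this one
  -- element can stand for all of `x`.
  run-lastNL : ∀ {n f g f′ g′} (x z : Word n) → hasNL x ≡ true →
    run f x z ≡ just f′ → run g (word (lastNL x)) z ≡ just g′ → f′ ≡ g′
  run-lastNL (○ ∷ x) (○ ∷ z) h p q = run-lastNL x z h p q
  run-lastNL (○ ∷ x) (● ∷ z) h p q = run-lastNL x z h p q
  run-lastNL (○ ∷ x) (◆ ∷ z) h p q = run-lastNL x z h p q
  run-lastNL {g = g} (● ∷ x) (c ∷ z) h p q with hasNL x in eq | run-∷ x z ● c p
  ... | true  | k , _ , p′ = run-lastNL x z eq p′ (trans (sym (run-○ g (word (lastNL x)) z c)) q)
  ... | false | k , r , p′ with run-∷ (word ⊥) z ◆ c q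
  ... | k′ , r′ , q′ with k | k′ | run-nonloop {c = c} ●′ r | run-nonloop {c = c} ◆′ r′
  ... | _ | _ | refl | refl = just-injective (trans (sym p′) (subst (λ w → run false w z ≡ just _) (sym (noNL x eq)) q′))
  run-lastNL {g = g} (◆ ∷ x) (c ∷ z) h p q with hasNL x in eq | run-∷ x z ◆ c p
  ... | true  | k , _ , p′ = run-lastNL x z eq p′ (trans (sym (run-○ g (word (lastNL x)) z c)) q)
  ... | false | k , r , p′ with run-∷ (word ⊥) z ◆ c q
  ... | k′ , r′ , q′ with k | k′ | run-nonloop {c = c} ◆′ r | run-nonloop {c = c} ◆′ r′
  ... | _ | _ | refl | refl = just-injective (trans (sym p′) (subst (λ w → run false w z ≡ just _) (sym (noNL x eq)) q′))

  -- After rotation `x` starts with ◆, and this initial element is the partner used by `H₁` and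
  -- `H₀`. The linear part is `matches⇒Succ`; only the wrapping gap needs a further basis.
  BasesIn⇒Cyc : ∀ {n} (x z : Word n) → 2 ≤ bars x → BasesIn x z → Cyc x z
  BasesIn⇒Cyc {zero} [] z () H
  BasesIn⇒Cyc {suc n} x z p = rot-to-bar P rotate base x (ℕₚ.≤-trans (s≤s z≤n) p) z p
    where
    P : Word (suc n) → Set
    P x = ∀ z → 2 ≤ bars x → BasesIn x z → Cyc x z

    rotate : ∀ w → P (rot w) → P w
    rotate w h z p H = Cyc-rot⁻ w z (h (rot z) (subst (2 ≤_) (sym (bars-rot w)) p) (BasesIn-rot w z H))

    first : ∀ {x z : Word n} z₀ → BasesIn (◆ ∷ x) (z₀ ∷ z) → 1 ≤ bars x → NonLoop z₀
    first {x} z₀ H q with H (true ∷ first◆ x) (cong suc (∣first◆∣ x q) , false , _ , proj₂ (Succ-first◆ false x q) , false≤ _)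
    ... | f , f′ , r , _ = Succ-nonloop ◆′ (f′ , r)

    H₂ : ∀ {x z : Word n} z₀ → BasesIn (◆ ∷ x) (z₀ ∷ z) → Matches 2 true true x z
    H₂ {x} {z} z₀ H J m (g , r) with H (false ∷ J) (m , false , g , r , false≤ g)
    ... | f , f′ , r′ , _ with run-mono (word J) z (≤true _) (trans (sym (run-○ f (word J) z z₀)) r′)
    ... | k , r″ , _ = k , r″

    H₁ : ∀ {x z : Word n} z₀ → NonLoop z₀ → BasesIn (◆ ∷ x) (z₀ ∷ z) → Matches 1 false false x z
    H₁ {x} {z} z₀ nz H J m (g , r) with H (true ∷ J) (cong suc m , false , g , r , false≤ g)
    ... | f , f′ , r′ , _ with run-∷ (word J) z ◆ z₀ r′
    ... | k , e , r″ = f′ , subst (λ k → run k (word J) z ≡ just f′) (run-nonloop {c = z₀} ◆′ e) r″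

    H₀ : ∀ {x z : Word n} → Matches 1 false false x z → Matches 1 false true x z
    H₀ {x} {z} H J m S with H J m S
    ... | f , r with run-mono (word J) z (≤true _) r
    ... | k , r′ , _ = k , r′

    base : ∀ w → P (◆ ∷ w)
    base x (z₀ ∷ z) (s≤s p) H with first z₀ H p
    ... | nz with matches⇒Succ false false x z (H₁ z₀ nz H) (H₀ (H₁ z₀ nz H)) (H₂ z₀ H) (inj₂ p)
    base x (◆ ∷ z) (s≤s p) H | nz | f′ , r = false , f′ , r , false≤ f′
    -- Here the run has to start, and so to end, with `true`. The basis made of the initial element
    -- and the last non-loop of `x` shows that it does.
    base x (● ∷ z) (s≤s p) H | nz | f′ , r
      with Succ-lastNL false x (inj₂ p) (bars⇒hasNL x p)
    ... | g , e with H (true ∷ lastNL x) (cong suc (∣lastNL∣ x (bars⇒hasNL x p)) , false , g , e , false≤ g)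
    ... | true , true , e′ , _ = true , f′ , r , subst (true ≤ᵇ_) (sym (run-lastNL x z (bars⇒hasNL x p) r e′)) b≤b

  run-antisym : ∀ {n f′ g′} (x z : Word n) → run false x z ≡ just f′ → run false z x ≡ just g′ →
    x ≡ z × f′ ≡ false
  run-antisym [] [] refl q = refl , refl
  run-antisym (○ ∷ x) (○ ∷ z) p q with run-antisym x z p q
  ... | refl , e = refl , e
  run-antisym (● ∷ x) (● ∷ z) p q with run-antisym x z p q
  ... | refl , e = refl , e
  run-antisym (◆ ∷ x) (◆ ∷ z) p q with run-antisym x z p q
  ... | refl , e = refl , e

  rot-injective : ∀ {A : Set} {n} (v w : Vec A n) → rot v ≡ rot w → v ≡ w
  rot-injective [] [] e = refl
  rot-injective (a ∷ v) (c ∷ w) e with ∷ʳ-injective v w e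
  ... | refl , refl = refl

  -- With `x` starting with ◆, a ● at the start of `z` would require the final flag `true`, whereas
  -- runs in both directions from `false` end with `false`. So both start with ◆ and the tails agree
  -- letter by letter.
  Cyc-antisym : ∀ {n} (x z : Word n) → 1 ≤ bars x → Cyc x z → Cyc z x → x ≡ z
  Cyc-antisym {zero} [] z () c d
  Cyc-antisym {suc n} x z p = rot-to-bar P rotate base x p z
    where
    P : Word (suc n) → Set
    P x = ∀ z → Cyc x z → Cyc z x → x ≡ z

    rotate : ∀ w → P (rot w) → P w
    rotate w h z c d = rot-injective w z (h (rot z) (Cyc-rot w z c) (Cyc-rot z w d))

    base : ∀ w → P (◆ ∷ w)
    base x (◆ ∷ z) (f , f′ , p , _) (g , g′ , q , _) = cong (◆ ∷_) (proj₁ (run-antisym x z p q))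
    base x (● ∷ z) (true , true , p , _) (g , g′ , q , _) = case proj₂ (run-antisym x z p q) of λ ()

  ⊆F⇒Cyc : ∀ {n} (x z : Word n) → 2 ≤ bars x → fam x ⊆F fam z → Cyc x z
  ⊆F⇒Cyc x z p H = BasesIn⇒Cyc x z p λ J B → proj₂ (fam⁻ z (H J (fam⁺ x B)))

  fam-injective : ∀ {n} (x z : Word n) → 2 ≤ bars x → 2 ≤ bars z → fam x ≡ fam z → x ≡ z
  fam-injective x z p q e = Cyc-antisym x z (ℕₚ.≤-trans (s≤s z≤n) p)
    (⊆F⇒Cyc x z p λ J m → subst (J ∈F_) e m) (⊆F⇒Cyc z x q λ J m → subst (J ∈F_) (sym e) m)

open Words

-- Laplace expansion and bordered matrices.

module Minors where

  open import Data.List using (List; []; _∷_; _++_; [_]; map; length)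
  open import Data.List.Properties using (map-++; ++-assoc; length-map)
  open import Data.List.Membership.Propositional using (_∈_)
  open import Data.List.Membership.Propositional.Properties using (∈-++⁺ˡ; ∈-++⁺ʳ; ∈-++⁻)
  open import Data.List.Relation.Unary.Any using (here; there)
  open import Data.List.Relation.Unary.All using (All; []; _∷_)
  open import Data.Rational using (ℚ; 0ℚ; 1ℚ; _*_; -_; _+_)
  open import Data.Rational.Properties
  open import Data.Rational.Solver using (module +-*-Solver)

  open import Data.Rational.Solver using (module +-*-Solver)

  expand : ∀ {n} k → (Fin n → ℚ) → (Fin k → Fin n → ℚ) → ℚ → List (Fin n) → List (Fin n) → ℚ
  expand k ρ A s pre [] = 0ℚ
  expand k ρ A s pre (c ∷ post) =
    (s * (ρ c * minor k A (pre ++ post))) + expand k ρ A (- s) (pre ++ [ c ]) post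

  -- Serves to identify the local function inside `minor` with `expand`: both satisfy the same
  -- recursion.
  expand-unique : ∀ {n} k (ρ : Fin n → ℚ) A (f : ℚ → List (Fin n) → List (Fin n) → ℚ) →
    (∀ s pre → f s pre [] ≡ 0ℚ) →
    (∀ s pre c post → f s pre (c ∷ post) ≡ (s * (ρ c * minor k A (pre ++ post))) + f (- s) (pre ++ [ c ]) post) →
    ∀ s pre post → f s pre post ≡ expand k ρ A s pre post
  expand-unique k ρ A f f0 f1 s pre [] = f0 s pre
  expand-unique k ρ A f f0 f1 s pre (c ∷ post) =
    trans (f1 s pre c post) (cong (s * (ρ c * minor k A (pre ++ post)) +_)
      (expand-unique k ρ A f f0 f1 (- s) (pre ++ [ c ]) post))

  -- The local function in the definition of minor has no name outside Defs;
  -- unification with the abstracted goal below recovers it.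
  mutual
    expand₀ : ∀ {n} k → (Fin (suc k) → Fin n → ℚ) → List (Fin n) → ℚ → List (Fin n) → List (Fin n) → ℚ
    expand₀ = _

    expand₀-recovered : ∀ {n} k (A : Fin (suc k) → Fin n → ℚ) c cs → minor (suc k) A (c ∷ cs) ≡
      1ℚ * (A zero c * minor k (λ i → A (suc i)) cs) + expand₀ k A (c ∷ cs) (- 1ℚ) [ c ] cs
    expand₀-recovered k A c cs with c ∷ cs | - 1ℚ | [ c ]
    ... | t | s | pre = cong (1ℚ * (A zero c * minor k (λ i → A (suc i)) cs) +_) (refl {x = expand₀ k A t s pre cs})

  minor-expand : ∀ {n} k (A : Fin (suc k) → Fin n → ℚ) cs →
    minor (suc k) A cs ≡ expand k (A zero) (λ i → A (suc i)) 1ℚ [] cs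
  minor-expand k A cs =
    expand-unique k (A zero) (λ i → A (suc i)) (expand₀ k A cs) (λ _ _ → refl) (λ _ _ _ _ → refl) 1ℚ [] cs

  mutual
    minor-map : ∀ {m n} k (A : Fin k → Fin n → ℚ) (g : Fin m → Fin n) cs →
      minor k A (map g cs) ≡ minor k (λ i j → A i (g j)) cs
    minor-map zero A g []       = refl
    minor-map zero A g (c ∷ cs) = refl
    minor-map (suc k) A g cs = trans (minor-expand k A (map g cs))
      (trans (expand-map k (A zero) (λ i → A (suc i)) g 1ℚ [] cs) (sym (minor-expand k _ cs)))

    expand-map : ∀ {m n} k ρ (A : Fin k → Fin n → ℚ) (g : Fin m → Fin n) s pre post →
      expand k ρ A s (map g pre) (map g post) ≡ expand k (λ j → ρ (g j)) (λ i j → A i (g j)) s pre post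
    expand-map k ρ A g s pre [] = refl
    expand-map k ρ A g s pre (c ∷ post) = cong₂ (λ u v → s * (ρ (g c) * u) + v)
      (trans (cong (minor k A) (sym (map-++ g pre post))) (minor-map k A g (pre ++ post)))
      (trans (cong (λ l → expand k ρ A (- s) l (map g post)) (sym (map-++ g pre [ c ])))
        (expand-map k ρ A g (- s) (pre ++ [ c ]) post))

  term-zero : ∀ s p q → p ≡ 0ℚ ⊎ q ≡ 0ℚ → s * (p * q) ≡ 0ℚ
  term-zero s p q (inj₁ refl) = trans (cong (s *_) (*-zeroˡ q)) (*-zeroʳ s)
  term-zero s p q (inj₂ refl) = trans (cong (s *_) (*-zeroʳ p)) (*-zeroʳ s)

  expand-zero : ∀ {n} k ρ (A : Fin k → Fin n → ℚ) s pre post →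
    (∀ p c q → p ++ c ∷ q ≡ pre ++ post → ρ c ≡ 0ℚ ⊎ minor k A (p ++ q) ≡ 0ℚ) →
    expand k ρ A s pre post ≡ 0ℚ
  expand-zero k ρ A s pre [] h = refl
  expand-zero k ρ A s pre (c ∷ post) h = cong₂ _+_
    (term-zero s (ρ c) _ (h pre c post refl))
    (expand-zero k ρ A (- s) (pre ++ [ c ]) post
      (λ p d q e → h p d q (trans e (++-assoc pre [ c ] post))))

  minor-zero-column : ∀ {n} k (A : Fin k → Fin n → ℚ) c cs → (∀ i → A i c ≡ 0ℚ) → c ∈ cs → minor k A cs ≡ 0ℚ
  minor-zero-column zero    A c (_ ∷ _) h m = refl
  minor-zero-column (suc k) A c cs h m = trans (minor-expand k A cs)
    (expand-zero k _ _ 1ℚ [] cs λ p d q e → go p d q (subst (c ∈_) (sym e) m))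
    where
    go : ∀ p d q → c ∈ p ++ d ∷ q → A zero d ≡ 0ℚ ⊎ minor k (λ i → A (suc i)) (p ++ q) ≡ 0ℚ
    go p d q m with ∈-++⁻ p m
    ... | inj₁ m′           = inj₂ (minor-zero-column k _ c (p ++ q) (λ i → h (suc i)) (∈-++⁺ˡ m′))
    ... | inj₂ (here refl)  = inj₁ (h zero)
    ... | inj₂ (there m′)   = inj₂ (minor-zero-column k _ c (p ++ q) (λ i → h (suc i)) (∈-++⁺ʳ p m′))

  zeroColumn : ∀ {k n} → (Fin k → Fin n → ℚ) → Fin k → Fin (suc n) → ℚ
  zeroColumn A i zero    = 0ℚ
  zeroColumn A i (suc j) = A i j

  -- The new column is the first unit vector. Minors using it are those of `A`, minors avoiding it
  -- are expansions along `ρ`. Dually this is a one-element extension whose deletion is the old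
  -- dual.
  border : ∀ {k n} → (Fin n → ℚ) → (Fin k → Fin n → ℚ) → Fin (suc k) → Fin (suc n) → ℚ
  border ρ A zero    zero    = 1ℚ
  border ρ A zero    (suc j) = ρ j
  border ρ A (suc i) j       = zeroColumn A i j

  plücker-zeroColumn-true : ∀ {k n} (A : Fin k → Fin n → ℚ) J → plücker (zeroColumn A) (true ∷ J) ≡ 0ℚ
  plücker-zeroColumn-true {k} A J = minor-zero-column k (zeroColumn A) zero _ (λ _ → refl) (here refl)

  plücker-zeroColumn-false : ∀ {k n} (A : Fin k → Fin n → ℚ) J → plücker (zeroColumn A) (false ∷ J) ≡ plücker A J
  plücker-zeroColumn-false {k} A J = minor-map k (zeroColumn A) suc (elems J)

  plücker-border-true : ∀ {k n} ρ (A : Fin k → Fin n → ℚ) J → plücker (border ρ A) (true ∷ J) ≡ plücker A J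
  plücker-border-true {k} ρ A J = begin
    minor (suc k) (border ρ A) (zero ∷ es)
      ≡⟨ minor-expand k (border ρ A) (zero ∷ es) ⟩
    1ℚ * (1ℚ * minor k (zeroColumn A) es) + expand k (border ρ A zero) (zeroColumn A) (- 1ℚ) [ zero ] es
      ≡⟨ cong₂ _+_ (trans (*-identityˡ _) (trans (*-identityˡ _) (minor-map k (zeroColumn A) suc (elems J)))) (rest (- 1ℚ) [] es) ⟩
    plücker A J + 0ℚ
      ≡⟨ +-identityʳ _ ⟩
    plücker A J ∎
    where
    open ≡-Reasoning
    es = map suc (elems J)
    rest : ∀ s pre post → expand k (border ρ A zero) (zeroColumn A) s (zero ∷ pre) post ≡ 0ℚ
    rest s pre [] = refl
    rest s pre (d ∷ post) = cong₂ _+_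
      (term-zero s (border ρ A zero d) _ (inj₂ (minor-zero-column k (zeroColumn A) zero _ (λ _ → refl) (here refl))))
      (rest (- s) (pre ++ [ d ]) post)

  plücker-border-false : ∀ {k n} ρ (A : Fin k → Fin n → ℚ) J →
    plücker (border ρ A) (false ∷ J) ≡ expand k ρ A 1ℚ [] (elems J)
  plücker-border-false {k} ρ A J =
    trans (minor-map (suc k) (border ρ A) suc (elems J)) (minor-expand k _ (elems J))

  expand-+ : ∀ {n} k ρ σ (A : Fin k → Fin n → ℚ) s pre post →
    expand k (λ j → ρ j + σ j) A s pre post ≡ expand k ρ A s pre post + expand k σ A s pre post
  expand-+ k ρ σ A s pre [] = refl
  expand-+ k ρ σ A s pre (c ∷ post) = trans
    (cong (s * ((ρ c + σ c) * minor k A (pre ++ post)) +_) (expand-+ k ρ σ A (- s) (pre ++ [ c ]) post))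
    (solve 6 (λ s r t m u v → s :* ((r :+ t) :* m) :+ (u :+ v) := (s :* (r :* m) :+ u) :+ (s :* (t :* m) :+ v)) refl
      s (ρ c) (σ c) (minor k A (pre ++ post)) (expand k ρ A (- s) (pre ++ [ c ]) post) (expand k σ A (- s) (pre ++ [ c ]) post))
    where open +-*-Solver

  single : ∀ {n} → ℚ → Fin n → Fin n → ℚ
  single ε zero    zero    = ε
  single ε zero    (suc j) = 0ℚ
  single ε (suc m) zero    = 0ℚ
  single ε (suc m) (suc j) = single ε m j

  sgn : ℕ → ℚ
  sgn zero    = 1ℚ
  sgn (suc n) = - sgn n

  sgn² : ∀ n → sgn n * sgn n ≡ 1ℚ
  sgn² zero    = refl
  sgn² (suc n) = trans (solve 1 (λ x → (:- x) :* (:- x) := x :* x) refl (sgn n)) (sgn² n)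
    where open +-*-Solver

  -- For `m` outside `K` this is the position of `m` in `elems (∁ K)`, the exponent of its Laplace
  -- sign.
  absent : ∀ {n} → Subset n → Fin n → ℕ
  absent (i     ∷ K) zero    = 0
  absent (true  ∷ K) (suc m) = absent K m
  absent (false ∷ K) (suc m) = suc (absent K m)

  expand-vanish : ∀ {n} k ρ (A : Fin k → Fin n → ℚ) s pre {post} → All (λ c → ρ c ≡ 0ℚ) post →
    expand k ρ A s pre post ≡ 0ℚ
  expand-vanish k ρ A s pre [] = refl
  expand-vanish k ρ A s pre (_∷_ {c} z zs) = cong₂ _+_ (term-zero s (ρ c) _ (inj₁ z)) (expand-vanish k ρ A (- s) (pre ++ [ c ]) zs)

  expand-at : ∀ {n} k ρ (A : Fin k → Fin n → ℚ) s pre {p} m {q} →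
    All (λ c → ρ c ≡ 0ℚ) p → All (λ c → ρ c ≡ 0ℚ) q →
    expand k ρ A s pre (p ++ m ∷ q) ≡ sgn (length p) * s * (ρ m * minor k A (pre ++ p ++ q))
  expand-at k ρ A s pre m {q} [] zq = trans
    (cong₂ _+_ (cong (_* (ρ m * minor k A (pre ++ q))) (sym (*-identityˡ s))) (expand-vanish k ρ A (- s) (pre ++ [ m ]) zq))
    (+-identityʳ _)
  expand-at k ρ A s pre m {q} (_∷_ {c} {p} z zs) zq = begin
    s * (ρ c * minor k A (pre ++ p ++ m ∷ q)) + expand k ρ A (- s) (pre ++ [ c ]) (p ++ m ∷ q)
      ≡⟨ cong₂ _+_ (term-zero s (ρ c) _ (inj₁ z)) (expand-at k ρ A (- s) (pre ++ [ c ]) m zs zq) ⟩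
    0ℚ + sgn (length p) * (- s) * (ρ m * minor k A ((pre ++ [ c ]) ++ p ++ q))
      ≡⟨ cong (λ l → 0ℚ + sgn (length p) * (- s) * (ρ m * minor k A l)) (++-assoc pre [ c ] (p ++ q)) ⟩
    0ℚ + sgn (length p) * (- s) * (ρ m * minor k A (pre ++ c ∷ p ++ q))
      ≡⟨ solve 3 (λ x s t → con 0ℚ :+ x :* (:- s) :* t := (:- x) :* s :* t) refl (sgn (length p)) s _ ⟩
    (- sgn (length p)) * s * (ρ m * minor k A (pre ++ c ∷ p ++ q)) ∎
    where
    open ≡-Reasoning
    open +-*-Solver

  single-self : ∀ {n} ε (m : Fin n) → single ε m m ≡ ε
  single-self ε zero    = refl
  single-self ε (suc m) = single-self ε m

  All-suc : ∀ {n} {ε} {m : Fin n} {cs} → All (λ c → single ε m c ≡ 0ℚ) cs → All (λ c → single ε (suc m) c ≡ 0ℚ) (map suc cs)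
  All-suc []       = []
  All-suc (z ∷ zs) = z ∷ All-suc zs

  single-zero : ∀ {n} ε (cs : List (Fin n)) → All (λ c → single ε zero c ≡ 0ℚ) (map suc cs)
  single-zero ε []       = []
  single-zero ε (c ∷ cs) = refl ∷ single-zero ε cs

  single-present : ∀ {n} ε (K : Subset n) m → lookup K m ≡ true → All (λ c → single ε m c ≡ 0ℚ) (elems (∁ K))
  single-present ε (true  ∷ K) zero    e = single-zero ε (elems (∁ K))
  single-present ε (true  ∷ K) (suc m) e = All-suc (single-present ε K m e)
  single-present ε (false ∷ K) (suc m) e = refl ∷ All-suc (single-present ε K m e)

  split-elems : ∀ {n} ε (K : Subset n) m → lookup K m ≡ false → ∃₂ λ p q →
    elems (∁ K) ≡ p ++ m ∷ q × elems (∁ (K [ m ]≔ true)) ≡ p ++ q × length p ≡ absent K m ×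
    All (λ c → single ε m c ≡ 0ℚ) p × All (λ c → single ε m c ≡ 0ℚ) q
  split-elems ε (false ∷ K) zero e = [] , map suc (elems (∁ K)) , refl , refl , refl , [] , single-zero ε (elems (∁ K))
  split-elems ε (true ∷ K) (suc m) e with split-elems ε K m e
  ... | p , q , e₁ , e₂ , l , zp , zq =
    map suc p , map suc q , trans (cong (map suc) e₁) (map-++ suc p (m ∷ q)) , trans (cong (map suc) e₂) (map-++ suc p q) ,
    trans (length-map suc p) l , All-suc zp , All-suc zq
  split-elems ε (false ∷ K) (suc m) e with split-elems ε K m e
  ... | p , q , e₁ , e₂ , l , zp , zq =
    zero ∷ map suc p , map suc q , cong (zero ∷_) (trans (cong (map suc) e₁) (map-++ suc p (m ∷ q))) ,
    cong (zero ∷_) (trans (cong (map suc) e₂) (map-++ suc p q)) ,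
    cong suc (trans (length-map suc p) l) , refl ∷ All-suc zp , All-suc zq

  -- Indexed by complements, the nonzero coordinates are the bases of the dual matroid.
  coplücker : ∀ {k n} → (Fin k → Fin n → ℚ) → Subset n → ℚ
  coplücker A K = plücker A (∁ K)

  expand-single-present : ∀ {k n} ε (A : Fin k → Fin n → ℚ) K m → lookup K m ≡ true →
    expand k (single ε m) A 1ℚ [] (elems (∁ K)) ≡ 0ℚ
  expand-single-present {k} ε A K m e = expand-vanish k (single ε m) A 1ℚ [] (single-present ε K m e)

  expand-single-absent : ∀ {k n} ε (A : Fin k → Fin n → ℚ) K m → lookup K m ≡ false →
    expand k (single ε m) A 1ℚ [] (elems (∁ K)) ≡ sgn (absent K m) * (ε * coplücker A (K [ m ]≔ true))
  expand-single-absent {k} ε A K m e with split-elems ε K m e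
  ... | p , q , e₁ , e₂ , l , zp , zq = begin
    expand k (single ε m) A 1ℚ [] (elems (∁ K))
      ≡⟨ cong (expand k (single ε m) A 1ℚ []) e₁ ⟩
    expand k (single ε m) A 1ℚ [] (p ++ m ∷ q)
      ≡⟨ expand-at k (single ε m) A 1ℚ [] m zp zq ⟩
    sgn (length p) * 1ℚ * (single ε m m * minor k A (p ++ q))
      ≡⟨ cong₂ _*_ (trans (*-identityʳ _) (cong sgn l)) (cong₂ _*_ (single-self ε m) (cong (minor k A) (sym e₂))) ⟩
    sgn (absent K m) * (ε * coplücker A (K [ m ]≔ true)) ∎
    where open ≡-Reasoning

open Minors

-- A totally nonnegative matrix for every word with at least r letters ◆.

module Realisation where

  open import Data.List as List using (List; []; _∷_)
  open import Data.List.Membership.Propositional using (_∈_)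
  open import Data.List.Relation.Unary.Any using (here; there)
  open import Data.List.Relation.Unary.All as All using ()
  open import Data.Rational using (ℚ; 0ℚ; 1ℚ; _*_; _+_) renaming (_≤_ to _≤ℚ_)
  open import Data.Rational.Properties as ℚₚ using ()

  infix 4 _≼_
  data _≼_ : ∀ {n} → Subset n → Subset n → Set where
    []   : [] ≼ []
    keep : ∀ {n} {I K : Subset n} a → I ≼ K → (a ∷ I) ≼ (a ∷ K)
    skip : ∀ {n} {I K : Subset n} → I ≼ K → (false ∷ I) ≼ (true ∷ K)

  ≼-run : ∀ {n} f {I K : Subset n} → I ≼ K → Succ f (word I) (word K)
  ≼-run f []             = f , refl
  ≼-run f (keep true p)  = ≼-run false p
  ≼-run f (keep false p) = ≼-run f p
  ≼-run f (skip p)       = ≼-run true p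

  -- Independence for the word read linearly: the initial flag `true` exempts the first element of
  -- `K`, and the two ends of the word are not glued together.
  Lin : ∀ {n} → Word n → Subset n → Set
  Lin v K = Succ true (word K) v

  Lin-mono : ∀ {n} (v : Word n) {I K} → I ≼ K → Lin v K → Lin v I
  Lin-mono v {I} {K} p (f , r) with ≼-run true p
  ... | g , q with run-trans (word I) (word K) v q r b≤b b≤b
  ... | h , e , _ = h , e

  ≼-insert : ∀ {n} {I K : Subset n} m → lookup I m ≡ false → (I [ m ]≔ true) ≼ K → I ≼ (K [ m ]≔ false)
  ≼-insert {I = false ∷ I} zero e (keep true p) = keep false p
  ≼-insert {I = _ ∷ I} (suc m) e (keep a p) = keep a (≼-insert m e p)
  ≼-insert {I = _ ∷ I} (suc m) e (skip p)   = skip (≼-insert m e p)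

  ≼-lookup : ∀ {n} {I K : Subset n} m → (I [ m ]≔ true) ≼ K → lookup K m ≡ true
  ≼-lookup {I = _ ∷ _} zero (keep true p) = refl
  ≼-lookup {I = _ ∷ _} (suc m) (keep a p) = ≼-lookup m p
  ≼-lookup {I = _ ∷ _} (suc m) (skip p) = ≼-lookup m p

  reinsert : ∀ {n} (K : Subset n) m → lookup K m ≡ true → (K [ m ]≔ false) [ m ]≔ true ≡ K
  reinsert (true ∷ K) zero e = refl
  reinsert (a ∷ K) (suc m) e = cong (a ∷_) (reinsert K m e)

  lookup-removed : ∀ {n} (K : Subset n) m → lookup (K [ m ]≔ false) m ≡ false
  lookup-removed (a ∷ K) zero    = refl
  lookup-removed (a ∷ K) (suc m) = lookup-removed K m

  ≼-refl : ∀ {n} (K : Subset n) → K ≼ K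
  ≼-refl []      = []
  ≼-refl (a ∷ K) = keep a (≼-refl K)

  ≼-insertʳ : ∀ {n} (K : Subset n) m → K ≼ (K [ m ]≔ true)
  ≼-insertʳ (true  ∷ K) zero = keep true (≼-refl K)
  ≼-insertʳ (false ∷ K) zero = skip (≼-refl K)
  ≼-insertʳ (a ∷ K) (suc m) = keep a (≼-insertʳ K m)

  ∣∁-insert∣ : ∀ {n} (K : Subset n) m → lookup K m ≡ false → ∣ ∁ K ∣ ≡ suc ∣ ∁ (K [ m ]≔ true) ∣
  ∣∁-insert∣ (false ∷ K) zero e = refl
  ∣∁-insert∣ (true ∷ K) (suc m) e = ∣∁-insert∣ K m e
  ∣∁-insert∣ (false ∷ K) (suc m) e = cong suc (∣∁-insert∣ K m e)

  ∣insert∣ : ∀ {n} (K : Subset n) m → lookup K m ≡ false → ∣ K [ m ]≔ true ∣ ≡ suc ∣ K ∣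
  ∣insert∣ (false ∷ K) zero e = refl
  ∣insert∣ (false ∷ K) (suc m) e = ∣insert∣ K m e
  ∣insert∣ (true ∷ K) (suc m) e = cong suc (∣insert∣ K m e)

  -- All bases of the dual of the positroid of the matrix satisfy R, and every set
  -- of at most two elements satisfying R lies in such a basis: R describes the
  -- truncation of the dual to rank 2.
  record Dual {n} (k : ℕ) (R : Subset n → Set) : Set where
    field
      matrix : Fin k → Fin n → ℚ
      nonneg : ∀ K → ∣ ∁ K ∣ ≡ k → 0ℚ ≤ℚ coplücker matrix K
      sound  : ∀ K → ∣ ∁ K ∣ ≡ k → coplücker matrix K ≢ 0ℚ → R K
      cover  : ∀ I → ∣ I ∣ ≤ 2 → R I → ∃ λ K → ∣ ∁ K ∣ ≡ k × coplücker matrix K ≢ 0ℚ × I ≼ K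

  dual-empty : ∀ {R : Subset 0 → Set} → R [] → Dual 0 R
  dual-empty r = record
    { matrix = λ ()
    ; nonneg = λ { [] _ → ℚₚ.nonNegative⁻¹ 1ℚ }
    ; sound  = λ { [] _ _ → r }
    ; cover  = λ { [] _ _ → [] , refl , (λ ()) , [] }
    }

  -- A zero column is a loop of the matroid, hence a coloop of the dual: it lies in every dual basis
  -- and raises the dual rank.
  dual-coloop : ∀ {n k} {R : Subset n → Set} {R′ : Subset (suc n) → Set} →
    (∀ K → R K → R′ (true ∷ K)) → (∀ I b → R′ (b ∷ I) → R I) → Dual k R → Dual k R′
  dual-coloop {n} {k} {R} {R′} up down D = record { matrix = zeroColumn matrix ; nonneg = nn ; sound = so ; cover = co }
    where
    open Dual D
    nn : ∀ K → ∣ ∁ K ∣ ≡ k → 0ℚ ≤ℚ coplücker (zeroColumn matrix) K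
    nn (true ∷ K) e  = subst (0ℚ ≤ℚ_) (sym (plücker-zeroColumn-false matrix (∁ K))) (nonneg K e)
    nn (false ∷ K) e = subst (0ℚ ≤ℚ_) (sym (plücker-zeroColumn-true matrix (∁ K))) ℚₚ.≤-refl
    so : ∀ K → ∣ ∁ K ∣ ≡ k → coplücker (zeroColumn matrix) K ≢ 0ℚ → R′ K
    so (true ∷ K) e z  = up K (sound K e (λ z′ → z (trans (plücker-zeroColumn-false matrix (∁ K)) z′)))
    so (false ∷ K) e z = ⊥-elim (z (plücker-zeroColumn-true matrix (∁ K)))
    co : ∀ I → ∣ I ∣ ≤ 2 → R′ I → ∃ λ K → ∣ ∁ K ∣ ≡ k × coplücker (zeroColumn matrix) K ≢ 0ℚ × I ≼ K
    co (i ∷ I) le r with cover I (ℕₚ.≤-trans (tail≤ i) le) (down I i r)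
      where
      tail≤ : ∀ i → ∣ I ∣ ≤ ∣ i ∷ I ∣
      tail≤ true  = ℕₚ.n≤1+n _
      tail≤ false = ℕₚ.≤-refl
    ... | K , e , z , p = true ∷ K , e , (λ z′ → z (trans (sym (plücker-zeroColumn-false matrix (∁ K))) z′)) , under i p
      where
      under : ∀ i → I ≼ K → (i ∷ I) ≼ (true ∷ K)
      under true  p = keep true p
      under false p = skip p

  pull : ∀ {k n} → (Fin k → Fin n → ℚ) → Subset n → Fin n → ℚ
  pull A K m = if lookup K m then 0ℚ else coplücker A (K [ m ]≔ true)

  -- The entry ε makes the Laplace term of column m equal to pull A K m for every K.
  Signed : ∀ {k n} → (Fin k → Fin n → ℚ) → Fin n → Set
  Signed {k} A m = ∃ λ ε → ∀ K → ∣ ∁ K ∣ ≡ suc k → lookup K m ≡ false →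
    coplücker A (K [ m ]≔ true) ≡ 0ℚ ⊎ sgn (absent K m) * ε ≡ 1ℚ

  expand-signed : ∀ {k n} (A : Fin k → Fin n → ℚ) m ((ε , _) : Signed A m) K → ∣ ∁ K ∣ ≡ suc k →
    expand k (single ε m) A 1ℚ [] (elems (∁ K)) ≡ pull A K m
  expand-signed A m (ε , sg) K e with lookup K m in l
  ... | true = expand-single-present ε A K m l
  ... | false with sg K e l
  ...   | inj₁ z rewrite z = trans (expand-single-absent ε A K m l) (trans (cong (λ u → sgn (absent K m) * (ε * u)) z)
            (trans (cong (sgn (absent K m) *_) (ℚₚ.*-zeroʳ ε)) (ℚₚ.*-zeroʳ (sgn (absent K m)))))
  ...   | inj₂ u = trans (expand-single-absent ε A K m l) (trans (sym (ℚₚ.*-assoc (sgn (absent K m)) ε (coplücker A (K [ m ]≔ true))))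
            (trans (cong (_* coplücker A (K [ m ]≔ true)) u) (ℚₚ.*-identityˡ _)))

  newRow : ∀ {k n} (A : Fin k → Fin n → ℚ) → List (Σ (Fin n) (Signed A)) → Fin n → ℚ
  newRow A [] j = 0ℚ
  newRow A ((m , ε , _) ∷ ms) j = single ε m j + newRow A ms j

  pulls : ∀ {k n} (A : Fin k → Fin n → ℚ) → List (Σ (Fin n) (Signed A)) → Subset n → ℚ
  pulls A [] K = 0ℚ
  pulls A ((m , _) ∷ ms) K = pull A K m + pulls A ms K

  coplücker-border : ∀ {k n} (A : Fin k → Fin n → ℚ) ms K → ∣ ∁ K ∣ ≡ suc k →
    coplücker (border (newRow A ms) A) (true ∷ K) ≡ pulls A ms K
  coplücker-border {k} A ms K e = trans (plücker-border-false (newRow A ms) A (∁ K)) (go ms)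
    where
    go : ∀ ms → expand k (newRow A ms) A 1ℚ [] (elems (∁ K)) ≡ pulls A ms K
    go [] = expand-vanish k (λ _ → 0ℚ) A 1ℚ [] (All.universal (λ _ → refl) (elems (∁ K)))
    go ((m , sg) ∷ ms) = trans (expand-+ k (single (proj₁ sg) m) (newRow A ms) A 1ℚ [] (elems (∁ K)))
      (cong₂ _+_ (expand-signed A m sg K e) (go ms))

  nonneg-zero : ∀ {p q} → 0ℚ ≤ℚ p → 0ℚ ≤ℚ q → p + q ≡ 0ℚ → p ≡ 0ℚ × q ≡ 0ℚ
  nonneg-zero {p} {q} 0≤p 0≤q e =
      ℚₚ.≤-antisym (subst (p ≤ℚ_) e (subst (_≤ℚ p + q) (ℚₚ.+-identityʳ p) (ℚₚ.+-monoʳ-≤ p 0≤q))) 0≤p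
    , ℚₚ.≤-antisym (subst (q ≤ℚ_) e (subst (_≤ℚ p + q) (ℚₚ.+-identityˡ q) (ℚₚ.+-monoˡ-≤ q 0≤p))) 0≤q

  -- In the dual the new vector combines the vectors of `ms`: a set with the new element is a basis
  -- iff exchanging it for some `m` of `ms` gives a basis. As the new minors are sums of nonnegative
  -- old ones, a single nonzero summand suffices. The converse exchange `g₂` concerns only `I` with
  -- at most one element, because `cover` speaks of at most two.
  dual-border : ∀ {n k} {R : Subset n → Set} {R′ : Subset (suc n) → Set} (D : Dual k R)
    (ms : List (Σ (Fin n) (Signed (Dual.matrix D)))) →
    (∀ K → R K → R′ (false ∷ K)) → (∀ I → R′ (false ∷ I) → R I) →
    (∀ K {m} → m ∈ List.map proj₁ ms → lookup K m ≡ false → R (K [ m ]≔ true) → R′ (true ∷ K)) →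
    (∀ I → ∣ I ∣ ≤ 1 → R′ (true ∷ I) → ∃ λ m → m ∈ List.map proj₁ ms × lookup I m ≡ false × R (I [ m ]≔ true)) →
    Dual (suc k) R′
  dual-border {n} {k} {R} {R′} D ms f₁ f₂ g₁ g₂ = record { matrix = A′ ; nonneg = nn ; sound = so ; cover = co }
    where
    open Dual D renaming (matrix to A)
    A′ = border (newRow A ms) A

    pull≥0 : ∀ K m → ∣ ∁ K ∣ ≡ suc k → 0ℚ ≤ℚ pull A K m
    pull≥0 K m e with lookup K m in l
    ... | true  = ℚₚ.≤-refl
    ... | false = nonneg (K [ m ]≔ true) (ℕₚ.suc-injective (trans (sym (∣∁-insert∣ K m l)) e))

    pulls≥0 : ∀ ms K → ∣ ∁ K ∣ ≡ suc k → 0ℚ ≤ℚ pulls A ms K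
    pulls≥0 [] K e = ℚₚ.≤-refl
    pulls≥0 ((m , _) ∷ ms) K e = ℚₚ.+-mono-≤ (pull≥0 K m e) (pulls≥0 ms K e)

    nn : ∀ K → ∣ ∁ K ∣ ≡ suc k → 0ℚ ≤ℚ coplücker A′ K
    nn (true ∷ K) e  = subst (0ℚ ≤ℚ_) (sym (coplücker-border A ms K e)) (pulls≥0 ms K e)
    nn (false ∷ K) e = subst (0ℚ ≤ℚ_) (sym (plücker-border-true _ A (∁ K))) (nonneg K (ℕₚ.suc-injective e))

    pulls-nonzero : ∀ ms K → ∣ ∁ K ∣ ≡ suc k → pulls A ms K ≢ 0ℚ →
      ∃ λ m → m ∈ List.map proj₁ ms × lookup K m ≡ false × coplücker A (K [ m ]≔ true) ≢ 0ℚ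
    pulls-nonzero [] K e z = ⊥-elim (z refl)
    pulls-nonzero ((m , _) ∷ ms) K e z with lookup K m in l | pull A K m ℚₚ.≟ 0ℚ
    ... | false | no z′ = m , here refl , l , z′
    ... | true | _ with pulls-nonzero ms K e (λ z′ → z (cong (0ℚ +_) z′))
    ...   | m′ , i , l′ , z″ = m′ , there i , l′ , z″
    pulls-nonzero ((m , _) ∷ ms) K e z | false | yes z′
      with pulls-nonzero ms K e (λ q → z (cong₂ _+_ z′ q))
    ...   | m′ , i , l′ , z″ = m′ , there i , l′ , z″

    pulls-nonzero⁻ : ∀ ms K {m} → ∣ ∁ K ∣ ≡ suc k → m ∈ List.map proj₁ ms → lookup K m ≡ false →
      coplücker A (K [ m ]≔ true) ≢ 0ℚ → pulls A ms K ≢ 0ℚ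
    pulls-nonzero⁻ ((m , _) ∷ ms) K e (here refl) l z q = z (trans
      (sym (cong (λ b → if b then 0ℚ else coplücker A (K [ m ]≔ true)) l)) (proj₁ (nonneg-zero (pull≥0 K m e) (pulls≥0 ms K e) q)))
    pulls-nonzero⁻ ((m , _) ∷ ms) K e (there i) l z q =
      pulls-nonzero⁻ ms K e i l z (proj₂ (nonneg-zero (pull≥0 K m e) (pulls≥0 ms K e) q))

    so : ∀ K → ∣ ∁ K ∣ ≡ suc k → coplücker A′ K ≢ 0ℚ → R′ K
    so (true ∷ K) e z with pulls-nonzero ms K e (λ q → z (trans (coplücker-border A ms K e) q))
    ... | m , i , l , z′ = g₁ K i l (sound (K [ m ]≔ true) (ℕₚ.suc-injective (trans (sym (∣∁-insert∣ K m l)) e)) z′)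
    so (false ∷ K) e z = f₁ K (sound K (ℕₚ.suc-injective e) (λ q → z (trans (plücker-border-true _ A (∁ K)) q)))

    co : ∀ I → ∣ I ∣ ≤ 2 → R′ I → ∃ λ K → ∣ ∁ K ∣ ≡ suc k × coplücker A′ K ≢ 0ℚ × I ≼ K
    co (false ∷ I) le r with cover I le (f₂ I r)
    ... | K , e , z , p = false ∷ K , cong suc e , (λ q → z (trans (sym (plücker-border-true _ A (∁ K))) q)) , keep false p
    co (true ∷ I) (s≤s le) r with g₂ I le r
    ... | m , i , l , r′ with cover (I [ m ]≔ true) (subst (_≤ 2) (sym (∣insert∣ I m l)) (s≤s le)) r′
    -- The old basis `K` containing `m` is exchanged for `K₀` together with the new element; the
    -- summand of `m` in its minor is the coordinate of `K`.
    ... | K , e , z , p = true ∷ K₀ , e₀ ,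
        (λ q → pulls-nonzero⁻ ms K₀ e₀ i (lookup-removed K m) (subst (λ K → coplücker A K ≢ 0ℚ) (sym back) z)
          (trans (sym (coplücker-border A ms K₀ e₀)) q)) ,
        keep true (≼-insert m l p)
      where
      K₀ = K [ m ]≔ false
      back : K₀ [ m ]≔ true ≡ K
      back = reinsert K m (≼-lookup m p)
      e₀ : ∣ ∁ K₀ ∣ ≡ suc k
      e₀ = trans (∣∁-insert∣ K₀ m (lookup-removed K m)) (cong suc (trans (cong (λ K → ∣ ∁ K ∣) back) e))

  data First (a : Letter) : ∀ {n} → Fin n → Word n → Set where
    here  : ∀ {n} {v : Word n} → First a zero (a ∷ v)
    there : ∀ {n m} {v : Word n} → First a m v → First a (suc m) (○ ∷ v)

  data Last : ∀ {n} → Fin n → Word n → Set where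
    here  : ∀ {n a} {v : Word n} → NonLoop a → hasNL v ≡ false → Last zero (a ∷ v)
    there : ∀ {n m a} {v : Word n} → Last m v → Last (suc m) (a ∷ v)

  last-exists : ∀ {n} (v : Word n) → hasNL v ≡ true → ∃ λ m → Last m v
  last-exists (○ ∷ v) e with last-exists v e
  ... | m , l = suc m , there l
  last-exists (● ∷ v) e with hasNL v in q
  ... | false = zero , here ●′ q
  ... | true with last-exists v q
  ...   | m , l = suc m , there l
  last-exists (◆ ∷ v) e with hasNL v in q
  ... | false = zero , here ◆′ q
  ... | true with last-exists v q
  ...   | m , l = suc m , there l

  -- All positions before `m` are loops of `v`, so none of them belongs to `K`.
  absent-first : ∀ {n a m f} {v : Word n} K → First a m v → Succ f (word (K [ m ]≔ true)) v → absent K m ≡ toℕ m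
  absent-first (_ ∷ K) here S              = refl
  absent-first (false ∷ K) (there p) S     = cong suc (absent-first K p S)
  absent-first (true  ∷ K) (there p) (_ , ())

  after : ∀ {n} → Fin n → ℕ
  after {suc n} zero    = n
  after         (suc m) = after m

  Succ-tail : ∀ {n f} (x z : Word n) a c → Succ f (a ∷ x) (c ∷ z) → ∃ λ g → Succ g x z
  Succ-tail x z a c (f′ , r) with run-∷ x z a c r
  ... | g , _ , r′ = g , f′ , r′

  ∣∁∣-loops : ∀ {n f} (v : Word n) K → hasNL v ≡ false → Succ f (word K) v → ∣ ∁ K ∣ ≡ n
  ∣∁∣-loops [] [] e S = refl
  ∣∁∣-loops (○ ∷ v) (false ∷ K) e S = cong suc (∣∁∣-loops v K e S)
  ∣∁∣-loops (○ ∷ v) (true ∷ K) e (_ , ())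

  -- All positions after `m` are loops of `v`, so all of them are outside `K`; the position of `m`
  -- counted from the right is fixed.
  absent-last : ∀ {n m f} {v : Word n} K → Last m v → lookup K m ≡ false → Succ f (word (K [ m ]≔ true)) v →
    absent K m +ⁿ suc (after m) ≡ ∣ ∁ K ∣
  absent-last {v = a ∷ v} (false ∷ K) (here _ e) l S =
    cong suc (sym (∣∁∣-loops v K e (proj₂ (Succ-tail (word K) v ◆ a S))))
  absent-last {m = suc m} {v = a ∷ v} (true ∷ K) (there p) l S =
    absent-last K p l (proj₂ (Succ-tail (word (K [ m ]≔ true)) v ◆ a S))
  absent-last {m = suc m} {v = a ∷ v} (false ∷ K) (there p) l S =
    cong suc (absent-last K p l (proj₂ (Succ-tail (word (K [ m ]≔ true)) v ○ a S)))

  signed-first : ∀ {n k a m} {v : Word n} {R} (D : Dual k R) → (∀ K → R K → Lin v K) → First a m v → Signed (Dual.matrix D) m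
  signed-first {k = k} {m = m} D lin p = sgn (toℕ m) , sg
    where
    open Dual D
    sg : ∀ K → ∣ ∁ K ∣ ≡ suc k → lookup K m ≡ false → coplücker matrix (K [ m ]≔ true) ≡ 0ℚ ⊎ sgn (absent K m) * sgn (toℕ m) ≡ 1ℚ
    sg K e l with coplücker matrix (K [ m ]≔ true) ℚₚ.≟ 0ℚ
    ... | yes z = inj₁ z
    ... | no z = inj₂ (trans (cong (λ t → sgn t * sgn (toℕ m)) (absent-first K p
        (lin _ (sound (K [ m ]≔ true) (ℕₚ.suc-injective (trans (sym (∣∁-insert∣ K m l)) e)) z)))) (sgn² (toℕ m)))

  -- The complement of `K` has `k + 1` elements, of which `after m` follow `m`; this leaves
  -- `k ∸ after m` before it, whatever `K` is.
  signed-last : ∀ {n k m} {v : Word n} {R} (D : Dual k R) → (∀ K → R K → Lin v K) → Last m v → Signed (Dual.matrix D) m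
  signed-last {k = k} {m = m} D lin p = sgn (k ∸ after m) , sg
    where
    open Dual D
    sg : ∀ K → ∣ ∁ K ∣ ≡ suc k → lookup K m ≡ false → coplücker matrix (K [ m ]≔ true) ≡ 0ℚ ⊎ sgn (absent K m) * sgn (k ∸ after m) ≡ 1ℚ
    sg K e l with coplücker matrix (K [ m ]≔ true) ℚₚ.≟ 0ℚ
    ... | yes z = inj₁ z
    ... | no z = inj₂ (trans (cong (λ t → sgn (absent K m) * sgn t) eq) (sgn² (absent K m)))
      where
      total : absent K m +ⁿ after m ≡ k
      total = ℕₚ.suc-injective (trans (sym (ℕₚ.+-suc (absent K m) (after m)))
        (trans (absent-last K p l (lin _ (sound (K [ m ]≔ true) (ℕₚ.suc-injective (trans (sym (∣∁-insert∣ K m l)) e)) z))) e))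
      eq : k ∸ after m ≡ absent K m
      eq = trans (cong (_∸ after m) (sym total)) (ℕₚ.m+n∸n≡m (absent K m) (after m))

  Wrap : ∀ {n} → Word n → Subset n → Set
  Wrap v K = Cyc (word K) v

  Wrap⇒Lin : ∀ {n} (v : Word n) K → Wrap v K → Lin v K
  Wrap⇒Lin v K (f , f′ , r , _) with run-mono (word K) v (≤true f) r
  ... | g , r′ , _ = g , r′

  lin-out : ∀ {n} (x v : Word n) a → run true (○ ∷ x) (a ∷ v) ≡ run true x v
  lin-out x v ○ = refl
  lin-out x v ● = refl
  lin-out x v ◆ = refl

  dual-loop : ∀ {n k} (v : Word n) → Dual k (Lin v) → Dual (suc k) (Lin (○ ∷ v))
  dual-loop v D = dual-border D [] (λ K r → r) (λ I r → r) (λ K ()) (λ { I le (_ , ()) })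

  dual-loop-wrap : ∀ {n k} (v : Word n) → Dual k (Wrap v) → Dual (suc k) (Wrap (○ ∷ v))
  dual-loop-wrap v D = dual-border D [] (λ K r → r) (λ I r → r) (λ K ()) (λ { I le (_ , _ , () , _) })

  first-same : ∀ {n m} {v : Word n} K → First ● m v → lookup K m ≡ false →
    run true (word (K [ m ]≔ true)) v ≡ run false (word K) v
  first-same (false ∷ K) here e      = refl
  first-same (true  ∷ K) (there p) e = refl
  first-same (false ∷ K) (there p) e = first-same K p e

  first-same-absent : ∀ {n m} {v : Word n} K → First ● m v → Succ false (word K) v → lookup K m ≡ false
  first-same-absent (false ∷ K) here S      = refl
  first-same-absent (true  ∷ K) here (_ , ())
  first-same-absent (true  ∷ K) (there p) (_ , ())
  first-same-absent (false ∷ K) (there p) S = first-same-absent K p S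

  lin⁺ : ∀ {n} (v : Word n) a K → Lin v K → Lin (a ∷ v) (false ∷ K)
  lin⁺ v a K (f , r) = f , trans (lin-out (word K) v a) r

  lin⁻ : ∀ {n} (v : Word n) a K → Lin (a ∷ v) (false ∷ K) → Lin v K
  lin⁻ v a K (f , r) = f , trans (sym (lin-out (word K) v a)) r

  -- A ● as first non-loop continues the class of the new element, so the new vector is a parallel
  -- copy of column `m`. Both choosing the new element and inserting `m` leave the flag `false` for
  -- what follows.
  dual-same : ∀ {n k a m} {v : Word n} → NonLoop a → First ● m v → Dual k (Lin v) → Dual (suc k) (Lin (a ∷ v))
  dual-same {a = a} {m} {v} na p D = dual-border D ((m , signed-first D (λ _ r → r) p) ∷ []) (lin⁺ v a) (lin⁻ v a)
    (λ { K (here refl) l (f , r) → f , trans (run-true (word K) v ◆′ na) (trans (sym (first-same K p l)) r) })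
    λ { I le (f , r) →
        let r′ = trans (sym (run-true (word I) v ◆′ na)) r
            l  = first-same-absent I p (f , r′)
        in m , here refl , l , f , trans (first-same I p l) r′ }

  Opening : ∀ {n} → Word n → Set
  Opening v = hasNL v ≡ false ⊎ ∃ λ m → First ◆ m v

  -- The initial flag is consulted only at a ● met before any ◆, which `Opening` excludes. The
  -- letter put in front of `v` is therefore a class of its own.
  Succ-opening : ∀ {n f} g (x v : Word n) → Opening v → Succ f x v → Succ g x v
  Succ-opening g [] [] o S = g , refl
  Succ-opening g (○ ∷ x) (○ ∷ v) (inj₁ e) S = Succ-opening g x v (inj₁ e) S
  Succ-opening g (○ ∷ x) (○ ∷ v) (inj₂ (_ , there p)) S = Succ-opening g x v (inj₂ (_ , p)) S
  Succ-opening g (● ∷ x) (○ ∷ v) o (_ , ())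
  Succ-opening g (◆ ∷ x) (○ ∷ v) o (_ , ())
  Succ-opening g (○ ∷ x) (◆ ∷ v) o S = S
  Succ-opening g (● ∷ x) (◆ ∷ v) o S = S
  Succ-opening g (◆ ∷ x) (◆ ∷ v) o S = S
  Succ-opening g x (● ∷ v) (inj₂ (_ , ())) S

  lin-in : ∀ {n} {a} (v : Word n) K → NonLoop a → Opening v → Lin v K → Lin (a ∷ v) (true ∷ K)
  lin-in v K na o S with Succ-opening false (word K) v o S
  ... | f , r = f , trans (run-true (word K) v ◆′ na) r

  lin-in⁻ : ∀ {n} {a} (v : Word n) K → NonLoop a → Lin (a ∷ v) (true ∷ K) → Lin v K
  lin-in⁻ v K na (f , r) with run-mono (word K) v (≤true false) (trans (sym (run-true (word K) v ◆′ na)) r)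
  ... | g , r′ , _ = g , r′

  dual-open : ∀ {n k a} (v : Word n) → NonLoop a → Opening v → Dual k (Lin v) → Dual k (Lin (a ∷ v))
  dual-open {a = a} v na o = dual-coloop (λ K → lin-in v K na o)
    λ { I true S → lin-in⁻ v I na S ; I false S → lin⁻ v a I S }

  ∣empty∣ : ∀ {n} (I : Subset n) → ∣ I ∣ ≡ 0 → I ≡ ⊥
  ∣empty∣ [] e = refl
  ∣empty∣ (false ∷ I) e = cong (false ∷_) (∣empty∣ I e)

  lookup-⊥ : ∀ {n} (m : Fin n) → lookup ⊥ m ≡ false
  lookup-⊥ zero    = refl
  lookup-⊥ (suc m) = lookup-⊥ m

  Succ-last : ∀ {n m} f (v : Word n) → Last m v → f ≡ true ⊎ 1 ≤ bars v → Succ f (word (⊥ [ m ]≔ true)) v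
  Succ-last f (● ∷ v) (here na e) (inj₁ refl) = Succ-⊥ false v
  Succ-last f (● ∷ v) (here na e) (inj₂ p) = case trans (sym e) (bars⇒hasNL v p) of λ ()
  Succ-last f (◆ ∷ v) (here na e) p = Succ-⊥ false v
  Succ-last f (○ ∷ v) (there l) p = Succ-last f v l p
  Succ-last f (● ∷ v) (there l) p = Succ-last f v l p
  Succ-last f (◆ ∷ v) (there l) p = Succ-last true v l (inj₁ refl)

  last-bars : ∀ {n y a} {v : Word n} → Last y (a ∷ v) → 1 ≤ bars v → ∃ λ y′ → y ≡ suc y′ × Last y′ v
  last-bars {v = v} (here _ e) p = case trans (sym e) (bars⇒hasNL v p) of λ ()
  last-bars (there l) p = _ , refl , l

  Far : ∀ {n} → Word n → Subset n → Fin n → Set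
  Far v I y = lookup I y ≡ false × Lin v (I [ y ]≔ true)

  before-bar : ∀ {n y} (v : Word n) I → Last y v → 1 ≤ bars v → ∣ I ∣ ≤ 1 → Lin v I →
    Succ false (word I) v ⊎ Far v I y
  before-bar (◆ ∷ v) (true  ∷ I) l p le S = inj₁ S
  before-bar (◆ ∷ v) (false ∷ I) l p le S = inj₁ S
  before-bar (○ ∷ v) (true  ∷ I) l p le (_ , ())
  before-bar (○ ∷ v) (false ∷ I) (there l) p le S = before-bar v I l p le S
  before-bar (● ∷ v) (false ∷ I) l p le S with last-bars l p
  ... | y , refl , l′ = before-bar v I l′ p le S
  before-bar (● ∷ v) (true ∷ I) l p (s≤s le) S with last-bars l p | ∣empty∣ I (ℕₚ.n≤0⇒n≡0 le)
  ... | y , refl , l′ | refl = inj₂ (lookup-⊥ y , Succ-last false v l′ (inj₂ p))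

  -- If the element of `I` lies outside the first class, `m` can be added. Otherwise `y` can, since
  -- with two letters ◆ the first and the last class differ. This is the exchange that `dual-bridge`
  -- needs.
  first-or-last : ∀ {n m y} (v : Word n) I → First ◆ m v → Last y v → 2 ≤ bars v → ∣ I ∣ ≤ 1 → Lin v I →
    Far v I m ⊎ Far v I y
  first-or-last (○ ∷ v) (true ∷ I) (there p) l q le (_ , ())
  first-or-last (○ ∷ v) (false ∷ I) (there p) (there l) q le S = first-or-last v I p l q le S
  first-or-last (◆ ∷ v) (i ∷ I) here l (s≤s q) le S with last-bars l q
  first-or-last (◆ ∷ v) (true ∷ I) here l (s≤s q) (s≤s le) S | y , refl , l′ with ∣empty∣ I (ℕₚ.n≤0⇒n≡0 le)
  ... | refl = inj₂ (lookup-⊥ y , Succ-last false v l′ (inj₂ q))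
  first-or-last (◆ ∷ v) (false ∷ I) here l (s≤s q) le S | y , refl , l′ with before-bar v I l′ q le S
  ... | inj₁ S′ = inj₁ (refl , S′)
  ... | inj₂ F  = inj₂ F

  -- The new class is placed between the first and the last class of v in the
  -- plane they span; in the dual matroid it is a sum of one vector of each.
  dual-bridge : ∀ {n k a m y} (v : Word n) → NonLoop a → First ◆ m v → Last y v → 2 ≤ bars v →
    Dual k (Lin v) → Dual (suc k) (Lin (a ∷ v))
  dual-bridge {a = a} {m} {y} v na p l q D =
    dual-border D ((m , signed-first D (λ _ r → r) p) ∷ (y , signed-last D (λ _ r → r) l) ∷ []) (lin⁺ v a) (lin⁻ v a)
      (λ K {m′} _ _ S → lin-in v K na (inj₂ (m , p)) (Lin-mono v (≼-insertʳ K m′) S))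
      λ I le S → case first-or-last v I p l q le (lin-in⁻ v I na S) of λ where
        (inj₁ (e , S′)) → m , here refl , e , S′
        (inj₂ (e , S′)) → y , there (here refl) , e , S′

  run-loops : ∀ {n f′} f (x v : Word n) → hasNL v ≡ false → run f x v ≡ just f′ → f′ ≡ f
  run-loops f [] [] e refl = refl
  run-loops f (○ ∷ x) (○ ∷ v) e r = run-loops f x v e r

  run-loops-any : ∀ {n g f f′} (v : Word n) K → hasNL v ≡ false → run f (word K) v ≡ just f′ → run g (word K) v ≡ just g
  run-loops-any [] [] e r = refl
  run-loops-any (○ ∷ v) (false ∷ K) e r = run-loops-any v K e r

  -- No ◆ follows `y`, so the final flag of `K` tells whether `y` could still be added, and adding
  -- it uses this flag up.
  run-last : ∀ {n y f f′} (v : Word n) K → Last y v → lookup K y ≡ false →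
    run f (word (K [ y ]≔ true)) v ≡ just f′ → f′ ≡ false × run f (word K) v ≡ just true
  run-last {f = true} (● ∷ v) (false ∷ K) (here na e) l r with run-loops false (word K) v e r
  ... | refl = refl , run-loops-any v K e r
  run-last (◆ ∷ v) (false ∷ K) (here na e) l r with run-loops false (word K) v e r
  ... | refl = refl , run-loops-any v K e r
  run-last (○ ∷ v) (false ∷ K) (there p) l r = run-last v K p l r
  run-last (● ∷ v) (false ∷ K) (there p) l r = run-last v K p l r
  run-last (◆ ∷ v) (false ∷ K) (there p) l r = run-last v K p l r
  run-last {f = true} (● ∷ v) (true ∷ K) (there p) l r = run-last v K p l r
  run-last (◆ ∷ v) (true ∷ K) (there p) l r = run-last v K p l r

  run-last⁻ : ∀ {n y f} (v : Word n) K → Last y v → run f (word K) v ≡ just true →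
    lookup K y ≡ false × run f (word (K [ y ]≔ true)) v ≡ just false
  run-last⁻ {f = true} (● ∷ v) (true ∷ K) (here na e) r = case run-loops false (word K) v e r of λ ()
  run-last⁻ (◆ ∷ v) (true ∷ K) (here na e) r = case run-loops false (word K) v e r of λ ()
  run-last⁻ {f = true} (● ∷ v) (false ∷ K) (here na e) r = refl , run-loops-any v K e r
  run-last⁻ {f = false} (● ∷ v) (false ∷ K) (here na e) r = case run-loops false (word K) v e r of λ ()
  run-last⁻ (◆ ∷ v) (false ∷ K) (here na e) r = refl , run-loops-any v K e r
  run-last⁻ (○ ∷ v) (false ∷ K) (there p) r = run-last⁻ v K p r
  run-last⁻ (● ∷ v) (false ∷ K) (there p) r = run-last⁻ v K p r
  run-last⁻ (◆ ∷ v) (false ∷ K) (there p) r = run-last⁻ v K p r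
  run-last⁻ {f = true} (● ∷ v) (true ∷ K) (there p) r = run-last⁻ v K p r
  run-last⁻ (◆ ∷ v) (true ∷ K) (there p) r = run-last⁻ v K p r

  -- A leading ● continues the class of `y` across the end of the word, so its dual vector is a
  -- parallel copy of that of `y`. Choosing it requires the flag to return as `true`, which by
  -- `run-last` means that `y` could be added instead.
  dual-wrap : ∀ {n k y} (v : Word n) → Last y v → Dual k (Wrap v) → Dual (suc k) (Wrap (● ∷ v))
  dual-wrap {y = y} v p D = dual-border D ((y , signed-last D (Wrap⇒Lin v) p) ∷ []) (λ K r → r) (λ I r → r)
    (λ { K (here refl) l (f , f′ , r , le) → wrap⁺ K f f′ le (run-last v K p l r) })
    λ { I le (true , true , r , _) → case run-last⁻ v I p r of λ where
          (l , r′) → y , here refl , l , false , false , r′ , b≤b }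
    where
    wrap⁺ : ∀ K f f′ → f ≤ᵇ f′ → f′ ≡ false × run f (word K) v ≡ just true → Wrap (● ∷ v) (true ∷ K)
    wrap⁺ K false _ b≤b (refl , r) = true , true , r , b≤b

  dual-map : ∀ {n k} {R R′ : Subset n → Set} → (∀ K → R K → R′ K) → (∀ K → R′ K → R K) → Dual k R → Dual k R′
  dual-map f g D = record { matrix = matrix ; nonneg = nonneg ; sound = λ K e z → f K (sound K e z) ; cover = λ I le r → cover I le (g I r) }
    where open Dual D

  dual-close : ∀ {n k} (v : Word n) → Dual k (Lin (◆ ∷ v)) → Dual k (Wrap (◆ ∷ v))
  dual-close v = dual-map
    (λ { (true ∷ K) (f′ , r) → false , f′ , r , false≤ f′ ; (false ∷ K) (f′ , r) → false , f′ , r , false≤ f′ })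
    (Wrap⇒Lin (◆ ∷ v))

  data Shape {n} (v : Word n) : Set where
    empty  : hasNL v ≡ false → Shape v
    opens  : ∀ {m} → First ◆ m v → Shape v
    inside : ∀ {m} → First ● m v → Shape v

  shape : ∀ {n} (v : Word n) → Shape v
  shape [] = empty refl
  shape (● ∷ v) = inside here
  shape (◆ ∷ v) = opens here
  shape (○ ∷ v) with shape v
  ... | empty e  = empty e
  ... | opens p  = opens (there p)
  ... | inside p = inside (there p)

  -- The number of classes of the word read linearly: if the first non-loop is a ●, it opens a class
  -- without a ◆.
  blocks : ∀ {n} → Word n → ℕ
  blocks v with shape v
  ... | empty _  = 0
  ... | opens _  = bars v
  ... | inside _ = suc (bars v)

  hasNL⇐first : ∀ {n a m} {v : Word n} → NonLoop a → First a m v → hasNL v ≡ true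
  hasNL⇐first ●′ here = refl
  hasNL⇐first ◆′ here = refl
  hasNL⇐first na (there p) = hasNL⇐first na p

  bars-loops : ∀ {n} (v : Word n) → hasNL v ≡ false → bars v ≡ 0
  bars-loops [] e = refl
  bars-loops (○ ∷ v) e = bars-loops v e

  blocks-○ : ∀ {n} (v : Word n) → blocks (○ ∷ v) ≡ blocks v
  blocks-○ v with shape v
  ... | empty _  = refl
  ... | opens _  = refl
  ... | inside _ = refl

  -- The first r classes, counted from the right, are independent; the remaining
  -- ones are added by dual-bridge.
  build : ∀ {n} r → 2 ≤ r → (v : Word n) → ∃ λ k → k +ⁿ (blocks v ⊓ r) ≡ n × Dual k (Lin v)
  build-nonloop : ∀ {n} r → 2 ≤ r → ∀ {a} (v : Word n) → NonLoop a → ∃ λ k → k +ⁿ (suc (bars v) ⊓ r) ≡ suc n × Dual k (Lin (a ∷ v))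

  build r q [] = 0 , refl , dual-empty (true , refl)
  build r q (○ ∷ v) with build r q v
  ... | k , e , D = suc k , cong suc (trans (cong (λ t → k +ⁿ (t ⊓ r)) (blocks-○ v)) e) , dual-loop v D
  build r q (● ∷ v) = build-nonloop r q v ●′
  build r q (◆ ∷ v) = build-nonloop r q v ◆′

  build-nonloop r q v na with build r q v
  ... | k , e , D with shape v
  ...   | inside p = suc k , cong suc e , dual-same na p D
  build-nonloop (suc r) q v na | k , e , D | empty p =
    k , trans (cong (λ t → k +ⁿ (suc t ⊓ suc r)) (bars-loops v p)) (trans (ℕₚ.+-suc k 0) (cong suc e)) , dual-open v na (inj₁ p) D
  build-nonloop r q v na | k , e , D | opens p with suc (bars v) ℕₚ.≤? r
  ... | yes b<r = k , trans (cong (k +ⁿ_) (ℕₚ.m≤n⇒m⊓n≡m b<r)) (trans (ℕₚ.+-suc k (bars v))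
          (cong suc (trans (cong (k +ⁿ_) (sym (ℕₚ.m≤n⇒m⊓n≡m (ℕₚ.<⇒≤ b<r)))) e))) , dual-open v na (inj₂ (_ , p)) D
  -- The dual rank is already `r`, so a further class must not raise it; it is placed in the span of
  -- the old ones.
  ... | no b≮r = suc k , cong suc (trans (cong (k +ⁿ_) (trans (ℕₚ.m≥n⇒m⊓n≡n (ℕₚ.≤-trans r≤b (ℕₚ.n≤1+n _)))
          (sym (ℕₚ.m≥n⇒m⊓n≡n r≤b)))) e) ,
        dual-bridge v na p (proj₂ (last-exists v (hasNL⇐first ◆′ p))) (ℕₚ.≤-trans q r≤b) D
    where
    r≤b : r ≤ bars v
    r≤b = s≤s⁻¹ (ℕₚ.≰⇒> b≮r)

  -- From the first ◆ on, linear and cyclic reading agree, so the matrix comes from `build`. The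
  -- letters before this ◆ are then added as loops or as members of the last class.
  dual-exists : ∀ {n} r → 2 ≤ r → (w : Word n) → r ≤ bars w → ∃ λ k → k +ⁿ r ≡ n × Dual k (Wrap w)
  dual-exists r q [] p = ⊥-elim (ℕₚ.<⇒≱ (s≤s z≤n) (ℕₚ.≤-trans q p))
  dual-exists r q (○ ∷ w) p with dual-exists r q w p
  ... | k , e , D = suc k , cong suc e , dual-loop-wrap w D
  dual-exists r q (● ∷ w) p with dual-exists r q w p
  ... | k , e , D = suc k , cong suc e ,
    dual-wrap w (proj₂ (last-exists w (bars⇒hasNL w (ℕₚ.≤-trans (s≤s z≤n) (ℕₚ.≤-trans q p))))) D
  dual-exists r q (◆ ∷ w) p with build r q (◆ ∷ w)
  ... | k , e , D = k , trans (cong (k +ⁿ_) (sym (ℕₚ.m≥n⇒m⊓n≡n p))) e , dual-close w D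

open Realisation

-- Rank 2 positroids as sequences of plane vectors.

module RankTwo where

  import Data.List as List
  open import Data.Rational using (ℚ; 0ℚ; 1ℚ; _*_; -_; _+_; _-_; _<_; 1/_; ≢-nonZero; nonNegative) renaming (_≤_ to _≤ℚ_)
  open import Data.Rational.Properties as ℚₚ using ()
  open import Data.Rational.Solver using (module +-*-Solver)
  open import Data.Vec.Relation.Unary.All as All using (All; []; _∷_)

  open +-*-Solver

  *-cancel-0 : ∀ c {x} → c ≢ 0ℚ → c * x ≡ 0ℚ → x ≡ 0ℚ
  *-cancel-0 c {x} c≢0 e = begin
    x                  ≡⟨ sym (ℚₚ.*-identityˡ x) ⟩
    1ℚ * x             ≡⟨ cong (_* x) (sym (ℚₚ.*-inverseˡ c)) ⟩
    (1/ c) * c * x     ≡⟨ ℚₚ.*-assoc (1/ c) c x ⟩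
    (1/ c) * (c * x)   ≡⟨ cong ((1/ c) *_) e ⟩
    (1/ c) * 0ℚ        ≡⟨ ℚₚ.*-zeroʳ (1/ c) ⟩
    0ℚ ∎
    where
    open ≡-Reasoning
    instance _ = ≢-nonZero c≢0

  squeeze⁺ : ∀ c {x} → 0ℚ < c → 0ℚ ≤ℚ x → 0ℚ ≤ℚ (- c) * x → x ≡ 0ℚ
  squeeze⁺ c {x} 0<c 0≤x h = *-cancel-0 c (λ e → ℚₚ.<-irrefl (sym e) 0<c)
    (proj₁ (nonneg-zero 0≤cx h (trans (sym (ℚₚ.*-distribʳ-+ x c (- c))) (trans (cong (_* x) (ℚₚ.+-inverseʳ c)) (ℚₚ.*-zeroˡ x)))))
    where
    0≤cx : 0ℚ ≤ℚ c * x
    0≤cx = subst (_≤ℚ c * x) (ℚₚ.*-zeroˡ x) (ℚₚ.*-monoʳ-≤-nonNeg x {{nonNegative 0≤x}} (ℚₚ.<⇒≤ 0<c))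

  squeeze⁻ : ∀ c {x} → c < 0ℚ → 0ℚ ≤ℚ x → 0ℚ ≤ℚ c * x → x ≡ 0ℚ
  squeeze⁻ c {x} c<0 0≤x h = squeeze⁺ (- c) (ℚₚ.neg-antimono-< c<0) 0≤x (subst (λ d → 0ℚ ≤ℚ d * x) (solve 1 (λ c → c := :- (:- c)) refl c) h)

  Plane : Set
  Plane = ℚ × ℚ

  𝟎 : Plane
  𝟎 = 0ℚ , 0ℚ

  det : Plane → Plane → ℚ
  det (a , b) (c , d) = a * d - b * c

  _·_ : ℚ → Plane → Plane
  c · (a , b) = c * a , c * b

  det-sym : ∀ u v → det u v ≡ - det v u
  det-sym (a , b) (c , d) = solve 4 (λ a b c d → a :* d :- b :* c := :- (c :* b :- d :* a)) refl a b c d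

  det-self : ∀ u → det u u ≡ 0ℚ
  det-self (a , b) = solve 2 (λ a b → a :* b :- b :* a := con 0ℚ) refl a b

  det-𝟎 : ∀ u → det u 𝟎 ≡ 0ℚ
  det-𝟎 (a , b) = solve 2 (λ a b → a :* con 0ℚ :- b :* con 0ℚ := con 0ℚ) refl a b

  det-·ʳ : ∀ c u v → det u (c · v) ≡ c * det u v
  det-·ʳ c (a , b) (d , e) = solve 5 (λ c a b d e → a :* (c :* e) :- b :* (c :* d) := c :* (a :* e :- b :* d)) refl c a b d e

  det-·ˡ : ∀ c u v → det (c · u) v ≡ c * det u v
  det-·ˡ c (a , b) (d , e) = solve 5 (λ c a b d e → c :* a :* e :- c :* b :* d := c :* (a :* e :- b :* d)) refl c a b d e

  𝟎? : ∀ u → Dec (u ≡ 𝟎)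
  𝟎? (a , b) with a ℚₚ.≟ 0ℚ | b ℚₚ.≟ 0ℚ
  ... | yes refl | yes refl = yes refl
  ... | no a≢0   | _        = no λ { refl → a≢0 refl }
  ... | yes _    | no b≢0   = no λ { refl → b≢0 refl }

  coordinate : ∀ {a b} → (a , b) ≢ 𝟎 → a ≢ 0ℚ ⊎ b ≢ 0ℚ
  coordinate {a} {b} h with a ℚₚ.≟ 0ℚ | b ℚₚ.≟ 0ℚ
  ... | no p     | _        = inj₁ p
  ... | yes _    | no q     = inj₂ q
  ... | yes refl | yes refl = ⊥-elim (h refl)

  Par : Plane → Plane → Set
  Par u v = det u v ≡ 0ℚ

  Par-sym : ∀ u v → Par u v → Par v u
  Par-sym u v e = trans (det-sym v u) (cong -_ e)

  -- A coordinate of `v` times `det u w` is a combination of `det v w` and `det u v`; some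
  -- coordinate of `v` can be cancelled.
  Par-trans : ∀ u v w → v ≢ 𝟎 → Par u v → Par v w → Par u w
  Par-trans u@(a , b) v@(c , d) w@(e , f) h p q with coordinate h
  ... | inj₁ c≢0 = *-cancel-0 c c≢0 (trans
    (solve 6 (λ a b c d e f → c :* (a :* f :- b :* e) := a :* (c :* f :- d :* e) :+ e :* (a :* d :- b :* c)) refl a b c d e f)
    (trans (cong₂ (λ x y → a * x + e * y) q p) (solve 2 (λ a e → a :* con 0ℚ :+ e :* con 0ℚ := con 0ℚ) refl a e)))
  ... | inj₂ d≢0 = *-cancel-0 d d≢0 (trans
    (solve 6 (λ a b c d e f → d :* (a :* f :- b :* e) := b :* (c :* f :- d :* e) :+ f :* (a :* d :- b :* c)) refl a b c d e f)
    (trans (cong₂ (λ x y → b * x + f * y) q p) (solve 2 (λ a e → a :* con 0ℚ :+ e :* con 0ℚ := con 0ℚ) refl b f)))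

  proportional : ∀ u v → u ≢ 𝟎 → Par u v → ∃ λ c → v ≡ c · u
  proportional (a , b) (c , d) h p with coordinate h
  ... | inj₁ a≢0 = c * i , cong₂ _,_ (sym (trans (ℚₚ.*-assoc c i a) (trans (cong (c *_) (ℚₚ.*-inverseˡ a)) (ℚₚ.*-identityʳ c)))) (begin
      d                           ≡⟨ sym (ℚₚ.*-identityˡ d) ⟩
      1ℚ * d                      ≡⟨ cong (_* d) (sym (ℚₚ.*-inverseˡ a)) ⟩
      i * a * d                   ≡⟨ solve 5 (λ i a b c d → i :* a :* d := i :* (a :* d :- b :* c) :+ c :* i :* b) refl i a b c d ⟩
      i * (a * d - b * c) + c * i * b ≡⟨ cong (λ x → i * x + c * i * b) p ⟩
      i * 0ℚ + c * i * b          ≡⟨ solve 2 (λ i x → i :* con 0ℚ :+ x := x) refl i (c * i * b) ⟩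
      c * i * b ∎)
    where
    open ≡-Reasoning
    instance _ = ≢-nonZero a≢0
    i = 1/ a
  ... | inj₂ b≢0 = d * i , cong₂ _,_ (begin
      c                           ≡⟨ sym (ℚₚ.*-identityˡ c) ⟩
      1ℚ * c                      ≡⟨ cong (_* c) (sym (ℚₚ.*-inverseˡ b)) ⟩
      i * b * c                   ≡⟨ solve 5 (λ i a b c d → i :* b :* c := :- (i :* (a :* d :- b :* c)) :+ d :* i :* a) refl i a b c d ⟩
      - (i * (a * d - b * c)) + d * i * a ≡⟨ cong (λ x → - (i * x) + d * i * a) p ⟩
      - (i * 0ℚ) + d * i * a      ≡⟨ solve 2 (λ i x → :- (i :* con 0ℚ) :+ x := x) refl i (d * i * a) ⟩
      d * i * a ∎) (sym (trans (ℚₚ.*-assoc d i b) (trans (cong (d *_) (ℚₚ.*-inverseˡ b)) (ℚₚ.*-identityʳ d))))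
    where
    open ≡-Reasoning
    instance _ = ≢-nonZero b≢0
    i = 1/ b

  pick : ∀ {n} → Subset n → Vec Plane n → Plane
  pick []          []       = 𝟎
  pick (true  ∷ J) (v ∷ vs) = v
  pick (false ∷ J) (v ∷ vs) = pick J vs

  pairDet : ∀ {n} → Subset n → Vec Plane n → ℚ
  pairDet []          []       = 0ℚ
  pairDet (true  ∷ J) (v ∷ vs) = det v (pick J vs)
  pairDet (false ∷ J) (v ∷ vs) = pairDet J vs

  column : ∀ {n} → (Fin 2 → Fin n → ℚ) → Fin n → Plane
  column A j = A zero j , A (suc zero) j

  minor-2 : ∀ {n} (A : Fin 2 → Fin n → ℚ) i j → minor 2 A (i List.∷ j List.∷ List.[]) ≡ det (column A i) (column A j)
  minor-2 A i j = solve 4 (λ a b c d →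
      con 1ℚ :* (a :* (con 1ℚ :* (d :* con 1ℚ) :+ con 0ℚ)) :+ (con (- 1ℚ) :* (c :* (con 1ℚ :* (b :* con 1ℚ) :+ con 0ℚ)) :+ con 0ℚ)
      := a :* d :- b :* c) refl (A zero i) (A (suc zero) i) (A zero j) (A (suc zero) j)

  elems-none : ∀ {n} (J : Subset n) → ∣ J ∣ ≡ 0 → elems J ≡ List.[]
  elems-none [] e = refl
  elems-none (false ∷ J) e = cong (List.map suc) (elems-none J e)

  elems-one : ∀ {n} (f : Fin n → Plane) (J : Subset n) → ∣ J ∣ ≡ 1 → ∃ λ j → elems J ≡ j List.∷ List.[] × f j ≡ pick J (tabulate f)
  elems-one f (true ∷ J) e = zero , cong (λ l → zero List.∷ List.map suc l) (elems-none J (ℕₚ.suc-injective e)) , refl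
  elems-one f (false ∷ J) e with elems-one (λ j → f (suc j)) J e
  ... | j , p , q = suc j , cong (List.map suc) p , q

  plücker-2 : ∀ {n} (A : Fin 2 → Fin n → ℚ) J → ∣ J ∣ ≡ 2 → plücker A J ≡ pairDet J (tabulate (column A))
  plücker-2 A (true ∷ J) e with elems-one (λ j → column A (suc j)) J (ℕₚ.suc-injective e)
  ... | j , p , q = trans (cong (λ l → minor 2 A (zero List.∷ List.map suc l)) p)
    (trans (minor-2 A zero (suc j)) (cong (det (column A zero)) q))
  plücker-2 A (false ∷ J) e = trans (minor-map 2 A suc (elems J)) (plücker-2 (λ i j → A i (suc j)) J e)

  letter : Plane → Plane → Letter
  letter u v with 𝟎? v | det u v ℚₚ.≟ 0ℚ
  ... | yes _ | _     = ○
  ... | no _  | yes _ = ●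
  ... | no _  | no _  = ◆

  next : Plane → Plane → Plane
  next u v with 𝟎? v
  ... | yes _ = u
  ... | no _  = v

  data Step (u v : Plane) : Letter → Plane → Set where
    zeroˢ : v ≡ 𝟎 → Step u v ○ u
    parˢ  : v ≢ 𝟎 → Par u v → Step u v ● v
    barˢ  : v ≢ 𝟎 → ¬ Par u v → Step u v ◆ v

  step : ∀ u v → Step u v (letter u v) (next u v)
  step u v with 𝟎? v | det u v ℚₚ.≟ 0ℚ
  ... | yes z | _     = zeroˢ z
  ... | no z  | yes p = parˢ z p
  ... | no z  | no p  = barˢ z p

  wordOf : ∀ {n} → Plane → Vec Plane n → Word n
  wordOf u []       = []
  wordOf u (v ∷ vs) = letter u v ∷ wordOf (next u v) vs

  final : ∀ {n} → Plane → Vec Plane n → Plane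
  final u []       = u
  final u (v ∷ vs) = final (next u v) vs

  Chain : ∀ {n} → Plane → Subset n → Vec Plane n → Set
  Chain u []          []       = ⊤
  Chain u (true  ∷ J) (v ∷ vs) = ¬ Par u v × Chain v J vs
  Chain u (false ∷ J) (v ∷ vs) = Chain u J vs

  -- `u` is the last chosen vector and `c` the last nonzero one. While the flag is `false` no ◆ has
  -- occurred since `u`, so `c` is still parallel to `u`, and a chosen vector read as ● would be
  -- parallel to `u` as well.
  chain-run : ∀ {n} f u c (J : Subset n) vs → c ≢ 𝟎 → (f ≡ false → Par u c) → Chain u J vs →
    Succ f (word J) (wordOf c vs)
  chain-run f u c [] [] nz p ch = f , refl
  chain-run f u c (true ∷ J) (v ∷ vs) nz p (np , ch) with letter c v | next c v | step c v
  ... | _ | _ | zeroˢ refl  = ⊥-elim (np (det-𝟎 u))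
  ... | _ | _ | barˢ nz′ q  = chain-run false v v J vs nz′ (λ _ → det-self v) ch
  chain-run false u c (true ∷ J) (v ∷ vs) nz p (np , ch) | _ | _ | parˢ nz′ q = ⊥-elim (np (Par-trans u c v nz (p refl) q))
  chain-run true u c (true ∷ J) (v ∷ vs) nz p (np , ch)  | _ | _ | parˢ nz′ q =
    chain-run false v v J vs nz′ (λ _ → det-self v) ch
  chain-run f u c (false ∷ J) (v ∷ vs) nz p ch with letter c v | next c v | step c v
  ... | _ | _ | zeroˢ _    = chain-run f u c J vs nz p ch
  ... | _ | _ | parˢ nz′ q = chain-run f u v J vs nz′ (λ e → Par-trans u c v nz (p e) q) ch
  ... | _ | _ | barˢ nz′ q = chain-run true u v J vs nz′ (λ ()) ch

  Chain₀ : ∀ {n} → Subset n → Vec Plane n → Set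
  Chain₀ []          []       = ⊤
  Chain₀ (true  ∷ J) (v ∷ vs) = v ≢ 𝟎 × Chain v J vs
  Chain₀ (false ∷ J) (v ∷ vs) = Chain₀ J vs

  chain₀-run : ∀ {n} c (J : Subset n) vs → Chain₀ J vs → Lin (wordOf c vs) J
  chain₀-run c [] [] ch = true , refl
  chain₀-run c (true ∷ J) (v ∷ vs) (nz , ch) with letter c v | next c v | step c v
  ... | _ | _ | zeroˢ z   = ⊥-elim (nz z)
  ... | _ | _ | parˢ _ _  = chain-run false v v J vs nz (λ _ → det-self v) ch
  ... | _ | _ | barˢ _ _  = chain-run false v v J vs nz (λ _ → det-self v) ch
  chain₀-run c (false ∷ J) (v ∷ vs) ch with chain₀-run (next c v) J vs ch
  ... | f , r = f , trans (lin-out (word J) (wordOf (next c v) vs) (letter c v)) r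

  UpTo : ∀ {n} → (Plane → Set) → Subset n → Vec Plane n → Set
  UpTo p []          []       = ⊤
  UpTo p (true  ∷ J) (v ∷ vs) = p v
  UpTo p (false ∷ J) (v ∷ vs) = p v × UpTo p J vs

  After₁ : ∀ {n} → Subset n → Vec Plane n → Set
  After₁ []          []       = ⊤
  After₁ (true  ∷ J) (v ∷ vs) = All (Par v) vs
  After₁ (false ∷ J) (v ∷ vs) = After₁ J vs

  After₂ : ∀ {n} → Subset n → Vec Plane n → Set
  After₂ []          []       = ⊤
  After₂ (true  ∷ J) (v ∷ vs) = After₁ J vs
  After₂ (false ∷ J) (v ∷ vs) = After₂ J vs

  upto-fails : ∀ {n} c (J : Subset n) vs → c ≢ 𝟎 → 1 ≤ ∣ J ∣ → UpTo (Par c) J vs →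
    run false (word J) (wordOf c vs) ≡ nothing
  upto-fails c (true ∷ J) (v ∷ vs) nz le p with letter c v | next c v | step c v
  ... | _ | _ | zeroˢ _  = refl
  ... | _ | _ | parˢ _ _ = refl
  ... | _ | _ | barˢ _ q = ⊥-elim (q p)
  upto-fails c (false ∷ J) (v ∷ vs) nz le (p , ps) with letter c v | next c v | step c v
  ... | _ | _ | zeroˢ _    = upto-fails c J vs nz le ps
  ... | _ | _ | parˢ nz′ q = upto-fails v J vs nz′ le (transport J vs ps)
    where
    transport : ∀ {n} (J : Subset n) vs → UpTo (Par c) J vs → UpTo (Par v) J vs
    transport [] [] p = tt
    transport (true ∷ J) (w ∷ vs) p = Par-trans v c w nz (Par-sym c v q) p
    transport (false ∷ J) (w ∷ vs) (p , ps) = Par-trans v c w nz (Par-sym c v q) p , transport J vs ps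
  ... | _ | _ | barˢ _ q = ⊥-elim (q p)

  -- Once nothing more is chosen, the final flag is `false` only if no direction changes any more.
  -- This translates the condition on the wrapping gap into parallelism, as recorded by `After₁` and
  -- `After₂`.
  run-post : ∀ {n f f′} c (J : Subset n) vs → ∣ J ∣ ≡ 0 → c ≢ 𝟎 → run f (word J) (wordOf c vs) ≡ just f′ →
    f′ ≡ false → f ≡ false × All (Par c) vs
  run-post c [] [] e nz refl z = z , []
  run-post c (false ∷ J) (v ∷ vs) e nz r z with letter c v | next c v | step c v
  ... | _ | _ | zeroˢ refl = case run-post c J vs e nz r z of λ (a , b) → a , det-𝟎 c ∷ b
  ... | _ | _ | parˢ nz′ q = case run-post v J vs e nz′ r z of λ (a , b) →
    a , q ∷ All.map (λ {w} → Par-trans c v w nz′ q) b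
  ... | _ | _ | barˢ nz′ q = case run-post v J vs e nz′ r z of λ ()

  run-post⁻ : ∀ {n f f′} c (J : Subset n) vs → ∣ J ∣ ≡ 0 → c ≢ 𝟎 → All (Par c) vs →
    run f (word J) (wordOf c vs) ≡ just f′ → f′ ≡ f
  run-post⁻ c [] [] e nz [] refl = refl
  run-post⁻ c (false ∷ J) (v ∷ vs) e nz (p ∷ ps) r with letter c v | next c v | step c v
  ... | _ | _ | zeroˢ refl = run-post⁻ c J vs e nz ps r
  ... | _ | _ | parˢ nz′ q = run-post⁻ v J vs e nz′ (All.map (λ {w} → Par-trans v c w nz (Par-sym c v q)) ps) r
  ... | _ | _ | barˢ nz′ q = ⊥-elim (q p)

  run-after₁ : ∀ {n f} c (J : Subset n) vs → ∣ J ∣ ≡ 1 → run f (word J) (wordOf c vs) ≡ just false → After₁ J vs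
  run-after₁ c (false ∷ J) (v ∷ vs) e r with letter c v | next c v | step c v
  ... | _ | _ | zeroˢ _  = run-after₁ c J vs e r
  ... | _ | _ | parˢ _ _ = run-after₁ v J vs e r
  ... | _ | _ | barˢ _ _ = run-after₁ v J vs e r
  run-after₁ {f = f} c (true ∷ J) (v ∷ vs) e r with letter c v | next c v | step c v
  run-after₁ {f = true} c (true ∷ J) (v ∷ vs) e r | _ | _ | parˢ nz _ = proj₂ (run-post v J vs (ℕₚ.suc-injective e) nz r refl)
  ... | _ | _ | barˢ nz _ = proj₂ (run-post v J vs (ℕₚ.suc-injective e) nz r refl)

  run-after₂ : ∀ {n f} c (J : Subset n) vs → ∣ J ∣ ≡ 2 → run f (word J) (wordOf c vs) ≡ just false → After₂ J vs
  run-after₂ c (false ∷ J) (v ∷ vs) e r with letter c v | next c v | step c v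
  ... | _ | _ | zeroˢ _  = run-after₂ c J vs e r
  ... | _ | _ | parˢ _ _ = run-after₂ v J vs e r
  ... | _ | _ | barˢ _ _ = run-after₂ v J vs e r
  run-after₂ {f = f} c (true ∷ J) (v ∷ vs) e r with letter c v | next c v | step c v
  run-after₂ {f = true} c (true ∷ J) (v ∷ vs) e r | _ | _ | parˢ _ _ = run-after₁ v J vs (ℕₚ.suc-injective e) r
  ... | _ | _ | barˢ _ _ = run-after₁ v J vs (ℕₚ.suc-injective e) r

  run-after₁⁻ : ∀ {n f f′} c (J : Subset n) vs → ∣ J ∣ ≡ 1 → After₁ J vs →
    run f (word J) (wordOf c vs) ≡ just f′ → f′ ≡ false
  run-after₁⁻ c (false ∷ J) (v ∷ vs) e p r with letter c v | next c v | step c v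
  ... | _ | _ | zeroˢ _  = run-after₁⁻ c J vs e p r
  ... | _ | _ | parˢ _ _ = run-after₁⁻ v J vs e p r
  ... | _ | _ | barˢ _ _ = run-after₁⁻ v J vs e p r
  run-after₁⁻ {f = f} c (true ∷ J) (v ∷ vs) e p r with letter c v | next c v | step c v
  run-after₁⁻ {f = true} c (true ∷ J) (v ∷ vs) e p r | _ | _ | parˢ nz _ = run-post⁻ v J vs (ℕₚ.suc-injective e) nz p r
  ... | _ | _ | barˢ nz _ = run-post⁻ v J vs (ℕₚ.suc-injective e) nz p r

  run-after₂⁻ : ∀ {n f f′} c (J : Subset n) vs → ∣ J ∣ ≡ 2 → After₂ J vs →
    run f (word J) (wordOf c vs) ≡ just f′ → f′ ≡ false
  run-after₂⁻ c (false ∷ J) (v ∷ vs) e p r with letter c v | next c v | step c v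
  ... | _ | _ | zeroˢ _  = run-after₂⁻ c J vs e p r
  ... | _ | _ | parˢ _ _ = run-after₂⁻ v J vs e p r
  ... | _ | _ | barˢ _ _ = run-after₂⁻ v J vs e p r
  run-after₂⁻ {f = f} c (true ∷ J) (v ∷ vs) e p r with letter c v | next c v | step c v
  run-after₂⁻ {f = true} c (true ∷ J) (v ∷ vs) e p r | _ | _ | parˢ _ _ = run-after₁⁻ v J vs (ℕₚ.suc-injective e) p r
  ... | _ | _ | barˢ _ _ = run-after₁⁻ v J vs (ℕₚ.suc-injective e) p r

  final-par : ∀ {n} u c (vs : Vec Plane n) → c ≢ 𝟎 → Par u c → All (Par u) vs → final c vs ≢ 𝟎 × Par u (final c vs)
  final-par u c [] nz p [] = nz , p
  final-par u c (v ∷ vs) nz p (q ∷ qs) with letter c v | next c v | step c v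
  ... | _ | _ | zeroˢ _   = final-par u c vs nz p qs
  ... | _ | _ | parˢ nz′ _ = final-par u v vs nz′ q qs
  ... | _ | _ | barˢ nz′ _ = final-par u v vs nz′ q qs

  final-after₁ : ∀ {n} c (J : Subset n) vs → ∣ J ∣ ≡ 1 → pick J vs ≢ 𝟎 → After₁ J vs →
    final c vs ≢ 𝟎 × Par (pick J vs) (final c vs)
  final-after₁ c (false ∷ J) (v ∷ vs) e nz p = final-after₁ (next c v) J vs e nz p
  final-after₁ c (true ∷ J) (v ∷ vs) e nz p with letter c v | next c v | step c v
  ... | _ | _ | zeroˢ z  = ⊥-elim (nz z)
  ... | _ | _ | parˢ _ _ = final-par v v vs nz (det-self v) p
  ... | _ | _ | barˢ _ _ = final-par v v vs nz (det-self v) p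

  pick₂ : ∀ {n} → Subset n → Vec Plane n → Plane
  pick₂ []          []       = 𝟎
  pick₂ (true  ∷ J) (v ∷ vs) = pick J vs
  pick₂ (false ∷ J) (v ∷ vs) = pick₂ J vs

  pairDet-pick : ∀ {n} (J : Subset n) vs → pairDet J vs ≡ det (pick J vs) (pick₂ J vs)
  pairDet-pick []          []       = refl
  pairDet-pick (true  ∷ J) (v ∷ vs) = refl
  pairDet-pick (false ∷ J) (v ∷ vs) = pairDet-pick J vs

  final-after₂ : ∀ {n} c (J : Subset n) vs → ∣ J ∣ ≡ 2 → pick₂ J vs ≢ 𝟎 → After₂ J vs →
    final c vs ≢ 𝟎 × Par (pick₂ J vs) (final c vs)
  final-after₂ c (false ∷ J) (v ∷ vs) e nz p = final-after₂ (next c v) J vs e nz p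
  final-after₂ c (true  ∷ J) (v ∷ vs) e nz p = final-after₁ (next c v) J vs (ℕₚ.suc-injective e) nz p

  chain-none : ∀ {n} u (J : Subset n) vs → ∣ J ∣ ≡ 0 → Chain u J vs
  chain-none u [] [] e = tt
  chain-none u (false ∷ J) (v ∷ vs) e = chain-none u J vs e

  chain-one : ∀ {n} u (J : Subset n) vs → ∣ J ∣ ≡ 1 → ¬ Par u (pick J vs) → Chain u J vs
  chain-one u (true  ∷ J) (v ∷ vs) e np = np , chain-none v J vs (ℕₚ.suc-injective e)
  chain-one u (false ∷ J) (v ∷ vs) e np = chain-one u J vs e np

  chain-two : ∀ {n} u (J : Subset n) vs → ∣ J ∣ ≡ 2 → ¬ Par u (pick J vs) → ¬ Par (pick J vs) (pick₂ J vs) → Chain u J vs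
  chain-two u (true  ∷ J) (v ∷ vs) e np nq = np , chain-one v J vs (ℕₚ.suc-injective e) nq
  chain-two u (false ∷ J) (v ∷ vs) e np nq = chain-two u J vs e np nq

  chain₀-two : ∀ {n} (J : Subset n) vs → ∣ J ∣ ≡ 2 → pick J vs ≢ 𝟎 → ¬ Par (pick J vs) (pick₂ J vs) → Chain₀ J vs
  chain₀-two (true  ∷ J) (v ∷ vs) e nz nq = nz , chain-one v J vs (ℕₚ.suc-injective e) nq
  chain₀-two (false ∷ J) (v ∷ vs) e nz nq = chain₀-two J vs e nz nq

  -- Starting from the last nonzero vector compares the first nonzero vector with its cyclic
  -- predecessor.
  cyclicWord : ∀ {n} → Vec Plane n → Word n
  cyclicWord vs = wordOf (final 𝟎 vs) vs

  -- A run from `true` succeeds. If it ends with `false`, all vectors after the second chosen one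
  -- are parallel to it, hence the starting vector `u` is not parallel to the first chosen one, and
  -- a run from `false` succeeds too.
  independent⇒Cyc : ∀ {n} (J : Subset n) vs → ∣ J ∣ ≡ 2 → pairDet J vs ≢ 0ℚ → Cyc (word J) (cyclicWord vs)
  independent⇒Cyc J vs e d = main (chain₀-run u J vs (chain₀-two J vs e nz nq))
    where
    nq : ¬ Par (pick J vs) (pick₂ J vs)
    nq p = d (trans (pairDet-pick J vs) p)
    nz₂ : pick₂ J vs ≢ 𝟎
    nz₂ z = nq (trans (cong (det (pick J vs)) z) (det-𝟎 (pick J vs)))
    nz : pick J vs ≢ 𝟎
    nz z = nq (Par-sym (pick₂ J vs) (pick J vs) (trans (cong (det (pick₂ J vs)) z) (det-𝟎 (pick₂ J vs))))
    u = final 𝟎 vs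
    late : final 𝟎 vs ≢ 𝟎 × Par (pick₂ J vs) (final 𝟎 vs) → Succ false (word J) (cyclicWord vs)
    late (nzu , pu) = chain-run false u u J vs nzu (λ _ → det-self u) (chain-two u J vs e
      (λ q → nq (Par-sym (pick₂ J vs) (pick J vs) (Par-trans (pick₂ J vs) u (pick J vs) nzu pu q))) nq)
    main : Succ true (word J) (cyclicWord vs) → Cyc (word J) (cyclicWord vs)
    main (true  , r) = true , true , r , b≤b
    main (false , r) = case late (final-after₂ 𝟎 J vs e nz₂ (run-after₂ u J vs e r)) of λ (f′ , r′) → false , f′ , r′ , false≤ f′

  -- Nonnegative minors: parallel vectors never pass the cyclic test.

  TNN : ∀ {n} → Vec Plane n → Set
  TNN []       = ⊤
  TNN (v ∷ vs) = All (λ w → 0ℚ ≤ℚ det v w) vs × TNN vs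

  All-pick : ∀ {n} {P : Plane → Set} (J : Subset n) {vs} → 1 ≤ ∣ J ∣ → All P vs → P (pick J vs)
  All-pick (true  ∷ J) le (p ∷ ps) = p
  All-pick (false ∷ J) le (p ∷ ps) = All-pick J le ps

  All-pick₂ : ∀ {n} {P : Plane → Set} (J : Subset n) {vs} → ∣ J ∣ ≡ 2 → All P vs → P (pick₂ J vs)
  All-pick₂ (true  ∷ J) e (p ∷ ps) = All-pick J (ℕₚ.≤-reflexive (sym (ℕₚ.suc-injective e))) ps
  All-pick₂ (false ∷ J) e (p ∷ ps) = All-pick₂ J e ps

  -- A vector `v` between `u` and `c · u` satisfies `0 ≤ det u v` and, preceding `c · u`, also
  -- `0 ≤ - c * det u v`.
  between-par : ∀ {n} u c (J : Subset n) vs → 0ℚ < c → All (λ w → 0ℚ ≤ℚ det u w) vs → TNN vs → ∣ J ∣ ≡ 1 →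
    pick J vs ≡ c · u → UpTo (Par u) J vs
  between-par u c (true ∷ J) (v ∷ vs) 0<c (p ∷ ps) (q , qs) e z =
    trans (cong (det u) z) (trans (det-·ʳ c u u) (trans (cong (c *_) (det-self u)) (ℚₚ.*-zeroʳ c)))
  between-par u c (false ∷ J) (v ∷ vs) 0<c (p ∷ ps) (q , qs) e z =
    squeeze⁺ c 0<c p (subst (0ℚ ≤ℚ_) eq (All-pick J (ℕₚ.≤-reflexive (sym e)) q)) , between-par u c J vs 0<c ps qs e z
    where
    eq : det v (pick J vs) ≡ (- c) * det u v
    eq = trans (cong (det v) z) (trans (det-·ʳ c v u) (trans (cong (c *_) (det-sym v u))
      (solve 2 (λ c x → c :* (:- x) := (:- c) :* x) refl c (det u v))))

  same-direction-fails : ∀ {n} f u c (J : Subset n) vs → 0ℚ < c → TNN vs → ∣ J ∣ ≡ 2 → pick J vs ≢ 𝟎 →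
    pick₂ J vs ≡ c · pick J vs → run f (word J) (wordOf u vs) ≡ nothing
  same-direction-fails f u c (false ∷ J) (v ∷ vs) 0<c (q , qs) e nz z with letter u v | next u v
  ... | ○ | u′ = same-direction-fails f u′ c J vs 0<c qs e nz z
  ... | ● | u′ = same-direction-fails f u′ c J vs 0<c qs e nz z
  ... | ◆ | u′ = same-direction-fails true u′ c J vs 0<c qs e nz z
  same-direction-fails f u c (true ∷ J) (v ∷ vs) 0<c (q , qs) e nz z = go f
    where
    fails : run false (word J) (wordOf v vs) ≡ nothing
    fails = upto-fails v J vs nz (ℕₚ.≤-reflexive (sym (ℕₚ.suc-injective e))) (between-par v c J vs 0<c q qs (ℕₚ.suc-injective e) z)
    go : ∀ f → run f (◆ ∷ word J) (letter u v ∷ wordOf (next u v) vs) ≡ nothing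
    go f with letter u v | next u v | step u v
    go f | _ | _ | zeroˢ _ = refl
    go true | _ | _ | parˢ _ _ = fails
    go false | _ | _ | parˢ _ _ = refl
    go f | _ | _ | barˢ _ _ = fails

  -- A later vector `w` has nonnegative determinant with both `u` and its negative multiple `c · u`,
  -- so both vanish.
  after-par₁ : ∀ {n} u c (J : Subset n) vs → c < 0ℚ → All (λ w → 0ℚ ≤ℚ det u w) vs → TNN vs → ∣ J ∣ ≡ 1 →
    pick J vs ≡ c · u → After₁ J vs
  after-par₁ u c (false ∷ J) (v ∷ vs) c<0 (p ∷ ps) (q , qs) e z = after-par₁ u c J vs c<0 ps qs e z
  after-par₁ u c (true ∷ J) (v ∷ vs) c<0 (p ∷ ps) (q , qs) e refl = go ps q
    where
    go : ∀ {m} {ws : Vec Plane m} → All (λ w → 0ℚ ≤ℚ det u w) ws → All (λ w → 0ℚ ≤ℚ det (c · u) w) ws → All (Par (c · u)) ws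
    go [] [] = []
    go (_∷_ {x = w} p ps) (q ∷ qs) = trans (det-·ˡ c u w)
      (trans (cong (c *_) (squeeze⁻ c c<0 p (subst (0ℚ ≤ℚ_) (det-·ˡ c u w) q))) (ℚₚ.*-zeroʳ c)) ∷ go ps qs

  after-par : ∀ {n} c (J : Subset n) vs → c < 0ℚ → TNN vs → ∣ J ∣ ≡ 2 → pick₂ J vs ≡ c · pick J vs → After₂ J vs
  after-par c (false ∷ J) (v ∷ vs) c<0 (q , qs) e z = after-par c J vs c<0 qs e z
  after-par c (true  ∷ J) (v ∷ vs) c<0 (q , qs) e z = after-par₁ v c J vs c<0 q qs (ℕₚ.suc-injective e) z

  before-par : ∀ {n} c (J : Subset n) vs → c < 0ℚ → TNN vs → ∣ J ∣ ≡ 2 → pick₂ J vs ≡ c · pick J vs →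
    UpTo (λ w → Par w (pick J vs)) J vs
  before-par c (true  ∷ J) (v ∷ vs) c<0 (q , qs) e z = det-self v
  before-par c (false ∷ J) (v ∷ vs) c<0 (q , qs) e z =
    squeeze⁻ c c<0 (All-pick J (ℕₚ.≤-trans (s≤s z≤n) (ℕₚ.≤-reflexive (sym e))) q)
      (subst (0ℚ ≤ℚ_) (trans (cong (det v) z) (det-·ʳ c v (pick J vs))) (All-pick₂ J e q)) ,
    before-par c J vs c<0 qs e z

  UpTo-map : ∀ {n} {P Q : Plane → Set} (J : Subset n) vs → (∀ w → P w → Q w) → UpTo P J vs → UpTo Q J vs
  UpTo-map [] [] f p = tt
  UpTo-map (true  ∷ J) (v ∷ vs) f p = f v p
  UpTo-map (false ∷ J) (v ∷ vs) f (p , ps) = f v p , UpTo-map J vs f ps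

  run-pick : ∀ {n f f′} c (J : Subset n) vs → 1 ≤ ∣ J ∣ → run f (word J) (wordOf c vs) ≡ just f′ → pick J vs ≢ 𝟎
  run-pick c (false ∷ J) (v ∷ vs) le r with letter c v | next c v | step c v
  ... | _ | _ | zeroˢ _  = run-pick c J vs le r
  ... | _ | _ | parˢ _ _ = run-pick v J vs le r
  ... | _ | _ | barˢ _ _ = run-pick v J vs le r
  run-pick c (true ∷ J) (v ∷ vs) le r with letter c v | next c v | step c v
  ... | _ | _ | parˢ nz _ = nz
  ... | _ | _ | barˢ nz _ = nz

  run-pick₂ : ∀ {n f f′} c (J : Subset n) vs → ∣ J ∣ ≡ 2 → run f (word J) (wordOf c vs) ≡ just f′ → pick₂ J vs ≢ 𝟎
  run-pick₂ c (false ∷ J) (v ∷ vs) e r with letter c v | next c v | step c v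
  ... | _ | _ | zeroˢ _  = run-pick₂ c J vs e r
  ... | _ | _ | parˢ _ _ = run-pick₂ v J vs e r
  ... | _ | _ | barˢ _ _ = run-pick₂ v J vs e r
  run-pick₂ c (true ∷ J) (v ∷ vs) e r with run-∷ (word J) (wordOf (next c v) vs) ◆ (letter c v) r
  ... | g , _ , r′ = run-pick (next c v) J vs (ℕₚ.≤-reflexive (sym (ℕₚ.suc-injective e))) r′

  -- Two antiparallel vectors force all vectors outside the arc between them to be
  -- parallel to them, two vectors of the same direction all vectors inside it.
  opposite-direction : ∀ {n} c (J : Subset n) vs → c < 0ℚ → TNN vs → ∣ J ∣ ≡ 2 →
    pick₂ J vs ≡ c · pick J vs → Par (pick J vs) (pick₂ J vs) → ¬ Cyc (word J) (cyclicWord vs)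
  opposite-direction c J vs c<0 tnn e z p (f , f′ , r , le) = contra f′ f (run-after₂⁻ u J vs e par-after r) le r
    where
    u = final 𝟎 vs
    par-after : After₂ J vs
    par-after = after-par c J vs c<0 tnn e z
    1≤J : 1 ≤ ∣ J ∣
    1≤J = ℕₚ.≤-trans (s≤s z≤n) (ℕₚ.≤-reflexive (sym e))
    nz : pick J vs ≢ 𝟎
    nz = run-pick u J vs 1≤J r
    nz₂ : pick₂ J vs ≢ 𝟎
    nz₂ = run-pick₂ u J vs e r
    nzu : u ≢ 𝟎 × Par (pick₂ J vs) u
    nzu = final-after₂ 𝟎 J vs e nz₂ par-after
    par-u : Par (pick J vs) u
    par-u = Par-trans (pick J vs) (pick₂ J vs) u nz₂ p (proj₂ nzu)
    upto : UpTo (Par u) J vs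
    upto = UpTo-map J vs (λ w q → Par-sym w u (Par-trans w (pick J vs) u nz q par-u)) (before-par c J vs c<0 tnn e z)
    contra : ∀ f′ f → f′ ≡ false → f ≤ᵇ f′ → ¬ run f (word J) (cyclicWord vs) ≡ just f′
    contra false false refl b≤b r = case trans (sym r) (upto-fails u J vs (proj₁ nzu) 1≤J upto) of λ ()

  same-direction : ∀ {n} c (J : Subset n) vs → 0ℚ < c → TNN vs → ∣ J ∣ ≡ 2 →
    pick₂ J vs ≡ c · pick J vs → ¬ Cyc (word J) (cyclicWord vs)
  same-direction c J vs 0<c tnn e z (f , f′ , r , le) =
    case trans (sym r) (same-direction-fails f u c J vs 0<c tnn e (run-pick u J vs (ℕₚ.≤-trans (s≤s z≤n) (ℕₚ.≤-reflexive (sym e))) r) z) of λ ()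
    where u = final 𝟎 vs

  Cyc⇒independent : ∀ {n} (J : Subset n) vs → TNN vs → ∣ J ∣ ≡ 2 → Cyc (word J) (cyclicWord vs) → pairDet J vs ≢ 0ℚ
  Cyc⇒independent J vs tnn e cyc@(f , f′ , r , le) d = cases (proportional (pick J vs) (pick₂ J vs) nz p)
    where
    nz : pick J vs ≢ 𝟎
    nz = run-pick (final 𝟎 vs) J vs (ℕₚ.≤-trans (s≤s z≤n) (ℕₚ.≤-reflexive (sym e))) r
    p : Par (pick J vs) (pick₂ J vs)
    p = trans (sym (pairDet-pick J vs)) d
    zero· : ∀ v → 0ℚ · v ≡ 𝟎
    zero· (a , b) = cong₂ _,_ (ℚₚ.*-zeroˡ a) (ℚₚ.*-zeroˡ b)
    cases : ¬ (∃ λ c → pick₂ J vs ≡ c · pick J vs)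
    cases (c , z) = [ (λ 0<c → same-direction c J vs 0<c tnn e z cyc) ,
      [ (λ 0≡c → run-pick₂ (final 𝟎 vs) J vs e r (trans z (trans (cong (_· pick J vs) (sym 0≡c)) (zero· (pick J vs))))) ,
        (λ c<0 → opposite-direction c J vs c<0 tnn e z p cyc) ]′ ]′ (sign c)
      where
      sign : ∀ c → 0ℚ < c ⊎ 0ℚ ≡ c ⊎ c < 0ℚ
      sign c with ℚₚ.<-cmp 0ℚ c
      ... | tri< q _ _ = inj₁ q
      ... | tri≈ _ q _ = inj₂ (inj₁ q)
      ... | tri> _ _ q = inj₂ (inj₂ q)

  TNN⁺ : ∀ {n} (vs : Vec Plane n) → (∀ J → ∣ J ∣ ≡ 2 → 0ℚ ≤ℚ pairDet J vs) → TNN vs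
  TNN⁺ [] h = tt
  TNN⁺ (v ∷ vs) h = one vs (λ J e → h (true ∷ J) (cong suc e)) , TNN⁺ vs (λ J e → h (false ∷ J) e)
    where
    one : ∀ {n} (vs : Vec Plane n) → (∀ J → ∣ J ∣ ≡ 1 → 0ℚ ≤ℚ det v (pick J vs)) → All (λ w → 0ℚ ≤ℚ det v w) vs
    one [] h = []
    one {suc n} (w ∷ vs) h = h (true ∷ ⊥) (cong suc (∣⊥∣≡0 n)) ∷ one vs (λ J e → h (false ∷ J) e)

  TNN⁻ : ∀ {n} (vs : Vec Plane n) → TNN vs → ∀ J → ∣ J ∣ ≡ 2 → 0ℚ ≤ℚ pairDet J vs
  TNN⁻ (v ∷ vs) (p , ps) (true  ∷ J) e = All-pick J (ℕₚ.≤-reflexive (sym (ℕₚ.suc-injective e))) p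
  TNN⁻ (v ∷ vs) (p , ps) (false ∷ J) e = TNN⁻ vs ps J e

  positroid⇒word : ∀ {n} {x : Fam n} → IsPositroid 2 x → ∃ λ w → 2 ≤ bars w × x ≡ fam w
  positroid⇒word {x = x} (A , nn , sup , sup⁻ , J₀ , m₀) = w , two , ⊆F-antisym into onto
    where
    vs = tabulate (column A)
    w = cyclicWord vs
    tnn : TNN vs
    tnn = TNN⁺ vs λ J e → subst (0ℚ ≤ℚ_) (plücker-2 A J e) (nn J e)
    ind : ∀ J → J ∈F x → Cyc (word J) w
    ind J m = independent⇒Cyc J vs (proj₁ (sup J m)) λ d → proj₂ (sup J m) (trans (plücker-2 A J (proj₁ (sup J m))) d)
    into : x ⊆F fam w
    into J m = fam⁺ w (proj₁ (sup J m) , ind J m)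
    onto : fam w ⊆F x
    onto J m = case fam⁻ w m of λ (e , c) → sup⁻ J e λ d → Cyc⇒independent J vs tnn e c (trans (sym (plücker-2 A J e)) d)
    two : 2 ≤ bars w
    two = subst (_≤ bars w) (trans (bars-word J₀) (proj₁ (sup J₀ m₀))) (Cyc-bars (word J₀) w (ind J₀ m₀))

  -- Explicit plane vectors for a word.

  slope : ℚ → Plane
  slope τ = 1ℚ , τ

  west : Plane
  west = - 1ℚ , 0ℚ

  directions-after : ∀ {n} → Word n → Vec Plane n
  directions-after []      = []
  directions-after (○ ∷ w) = 𝟎 ∷ directions-after w
  directions-after (● ∷ w) = west ∷ directions-after w
  directions-after (◆ ∷ w) = west ∷ directions-after w

  -- The t-th class points in direction (1, t), the last one in direction (-1, 0)
  -- so that it wraps around to t = 0.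
  mutual
    directions : ∀ {n} → ℚ → Word n → Vec Plane n
    directions τ []      = []
    directions τ (○ ∷ w) = 𝟎 ∷ directions τ w
    directions τ (● ∷ w) = slope τ ∷ directions τ w
    directions τ (◆ ∷ w) = directions-◆ (bars w) τ w

    directions-◆ : ∀ {n} → ℕ → ℚ → Word n → Vec Plane (suc n)
    directions-◆ zero    τ w = west ∷ directions-after w
    directions-◆ (suc _) τ w = slope (τ + 1ℚ) ∷ directions (τ + 1ℚ) w

  det-slope : ∀ σ τ → det (slope σ) (slope τ) ≡ τ - σ
  det-slope σ τ = solve 2 (λ σ τ → con 1ℚ :* τ :- σ :* con 1ℚ := τ :- σ) refl σ τ

  det-west : ∀ σ → det (slope σ) west ≡ σ
  det-west σ = solve 1 (λ σ → con 1ℚ :* con 0ℚ :- σ :* con (- 1ℚ) := σ) refl σ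

  det-𝟎ˡ : ∀ u → det 𝟎 u ≡ 0ℚ
  det-𝟎ˡ u = Par-sym u 𝟎 (det-𝟎 u)

  0≤0 : ∀ {p} → p ≡ 0ℚ → 0ℚ ≤ℚ p
  0≤0 e = ℚₚ.≤-reflexive (sym e)

  <+1 : ∀ τ → τ < τ + 1ℚ
  <+1 τ = subst (_< τ + 1ℚ) (ℚₚ.+-identityʳ τ) (ℚₚ.+-monoʳ-< τ (ℚₚ.positive⁻¹ 1ℚ))

  0≤+1 : ∀ {τ} → 0ℚ ≤ℚ τ → 0ℚ ≤ℚ τ + 1ℚ
  0≤+1 p = ℚₚ.≤-trans p (ℚₚ.<⇒≤ (<+1 _))

  zero-column : ∀ {n} {vs : Vec Plane n} → All (λ w → 0ℚ ≤ℚ det 𝟎 w) vs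
  zero-column = All.universal (λ w → 0≤0 (det-𝟎ˡ w)) _

  west-after : ∀ {n} (w : Word n) → All (λ v → 0ℚ ≤ℚ det west v) (directions-after w)
  west-after []      = []
  west-after (○ ∷ w) = 0≤0 (det-𝟎 west) ∷ west-after w
  west-after (● ∷ w) = 0≤0 (det-self west) ∷ west-after w
  west-after (◆ ∷ w) = 0≤0 (det-self west) ∷ west-after w

  slope-after : ∀ {n σ} (w : Word n) → 0ℚ ≤ℚ σ → All (λ v → 0ℚ ≤ℚ det (slope σ) v) (directions-after w)
  slope-after []      p = []
  slope-after {σ = σ} (○ ∷ w) p = 0≤0 (det-𝟎 (slope σ)) ∷ slope-after w p
  slope-after {σ = σ} (● ∷ w) p = subst (0ℚ ≤ℚ_) (sym (det-west σ)) p ∷ slope-after w p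
  slope-after {σ = σ} (◆ ∷ w) p = subst (0ℚ ≤ℚ_) (sym (det-west σ)) p ∷ slope-after w p

  slope-directions : ∀ {n σ τ} (w : Word n) → 0ℚ ≤ℚ σ → σ ≤ℚ τ → All (λ v → 0ℚ ≤ℚ det (slope σ) v) (directions τ w)
  slope-directions-◆ : ∀ {n σ τ} b (w : Word n) → 0ℚ ≤ℚ σ → σ ≤ℚ τ → All (λ v → 0ℚ ≤ℚ det (slope σ) v) (directions-◆ b τ w)
  slope-slope : ∀ {σ τ} → σ ≤ℚ τ → 0ℚ ≤ℚ det (slope σ) (slope τ)
  slope-slope {σ} {τ} q = subst (0ℚ ≤ℚ_) (sym (det-slope σ τ)) (subst (_≤ℚ τ - σ) (ℚₚ.+-inverseʳ σ) (ℚₚ.+-monoˡ-≤ (- σ) q))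
  slope-directions [] p q = []
  slope-directions {σ = σ} (○ ∷ w) p q = 0≤0 (det-𝟎 (slope σ)) ∷ slope-directions w p q
  slope-directions {σ = σ} {τ} (● ∷ w) p q = slope-slope q ∷ slope-directions w p q
  slope-directions (◆ ∷ w) p q = slope-directions-◆ (bars w) w p q
  slope-directions-◆ {σ = σ} zero w p q = subst (0ℚ ≤ℚ_) (sym (det-west σ)) p ∷ slope-after w p
  slope-directions-◆ (suc _) w p q = slope-slope q′ ∷ slope-directions w p q′
    where q′ = ℚₚ.≤-trans q (ℚₚ.<⇒≤ (<+1 _))

  TNN-after : ∀ {n} (w : Word n) → TNN (directions-after w)
  TNN-after []      = tt
  TNN-after (○ ∷ w) = zero-column , TNN-after w
  TNN-after (● ∷ w) = west-after w , TNN-after w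
  TNN-after (◆ ∷ w) = west-after w , TNN-after w

  TNN-directions : ∀ {n τ} (w : Word n) → 0ℚ ≤ℚ τ → TNN (directions τ w)
  TNN-directions-◆ : ∀ {n τ} b (w : Word n) → 0ℚ ≤ℚ τ → TNN (directions-◆ b τ w)
  TNN-directions []      p = tt
  TNN-directions (○ ∷ w) p = zero-column , TNN-directions w p
  TNN-directions (● ∷ w) p = slope-directions w p ℚₚ.≤-refl , TNN-directions w p
  TNN-directions (◆ ∷ w) p = TNN-directions-◆ (bars w) w p
  TNN-directions-◆ zero    w p = west-after w , TNN-after w
  TNN-directions-◆ (suc _) w p = slope-directions w (0≤+1 p) ℚₚ.≤-refl , TNN-directions w (0≤+1 p)

  slope≢𝟎 : ∀ τ → slope τ ≢ 𝟎
  slope≢𝟎 τ e = ℚₚ.1≢0 (cong proj₁ e)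

  west≢𝟎 : west ≢ 𝟎
  west≢𝟎 ()

  final-after : ∀ {n} (w : Word n) → final west (directions-after w) ≡ west
  final-after []      = refl
  final-after (○ ∷ w) = final-after w
  final-after (● ∷ w) = final-after w
  final-after (◆ ∷ w) = final-after w

  next-nonzero : ∀ u {v} → v ≢ 𝟎 → next u v ≡ v
  next-nonzero u {v} h with 𝟎? v
  ... | yes z = ⊥-elim (h z)
  ... | no _  = refl

  final-directions : ∀ {n} c τ (w : Word n) → 1 ≤ bars w → final c (directions τ w) ≡ west
  final-directions-◆ : ∀ {n} b c τ (w : Word n) → b ≡ bars w → final c (directions-◆ b τ w) ≡ west
  final-directions c τ (○ ∷ w) p = final-directions c τ w p
  final-directions c τ (● ∷ w) p = final-directions _ τ w p
  final-directions c τ (◆ ∷ w) p = final-directions-◆ (bars w) c τ w refl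
  final-directions-◆ zero    c τ w e = final-after w
  final-directions-◆ (suc b) c τ w e = final-directions _ (τ + 1ℚ) w (ℕₚ.≤-trans (s≤s z≤n) (ℕₚ.≤-reflexive e))

  letter-● : ∀ u v → v ≢ 𝟎 → Par u v → letter u v ≡ ●
  letter-● u v h p with letter u v | next u v | step u v
  ... | _ | _ | zeroˢ z  = ⊥-elim (h z)
  ... | _ | _ | parˢ _ _ = refl
  ... | _ | _ | barˢ _ q = ⊥-elim (q p)

  letter-◆ : ∀ u v → ¬ Par u v → letter u v ≡ ◆
  letter-◆ u v np with letter u v | next u v | step u v
  ... | _ | _ | zeroˢ refl = ⊥-elim (np (det-𝟎 u))
  ... | _ | _ | parˢ _ q   = ⊥-elim (np q)
  ... | _ | _ | barˢ _ _   = refl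

  wordOf-after : ∀ {n} (w : Word n) → bars w ≡ 0 → wordOf west (directions-after w) ≡ w
  wordOf-after []      e = refl
  wordOf-after (○ ∷ w) e = cong (○ ∷_) (wordOf-after w e)
  wordOf-after (● ∷ w) e = cong (● ∷_) (wordOf-after w e)

  wordOf-∷ : ∀ {n} c v (vs : Vec Plane n) {a w} → v ≢ 𝟎 → letter c v ≡ a → wordOf v vs ≡ w → wordOf c (v ∷ vs) ≡ a ∷ w
  wordOf-∷ c v vs nz p q = cong₂ _∷_ p (trans (cong (λ u → wordOf u vs) (next-nonzero c nz)) q)

  -- The last ◆ turns from slope `τ` to `west`, which is a change of direction only for `τ ≢ 0ℚ`.
  -- The disjunction guarantees this: either `τ` has left zero, or an earlier ◆ will still raise it.
  wordOf-directions : ∀ {n} c τ (w : Word n) → c ≢ 𝟎 → Par c (slope τ) → 1 ≤ bars w → 0ℚ ≤ℚ τ → τ ≢ 0ℚ ⊎ 2 ≤ bars w →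
    wordOf c (directions τ w) ≡ w
  wordOf-directions-◆ : ∀ {n} b c τ (w : Word n) → b ≡ bars w → c ≢ 𝟎 → Par c (slope τ) → 0ℚ ≤ℚ τ → τ ≢ 0ℚ ⊎ 2 ≤ suc b →
    wordOf c (directions-◆ b τ w) ≡ ◆ ∷ w
  wordOf-directions c τ (○ ∷ w) nz p 1≤b 0≤τ h = cong (○ ∷_) (wordOf-directions c τ w nz p 1≤b 0≤τ h)
  wordOf-directions c τ (● ∷ w) nz p 1≤b 0≤τ h =
    wordOf-∷ c (slope τ) (directions τ w) (slope≢𝟎 τ) (letter-● c (slope τ) (slope≢𝟎 τ) p)
      (wordOf-directions (slope τ) τ w (slope≢𝟎 τ) (det-self (slope τ)) 1≤b 0≤τ h)
  wordOf-directions c τ (◆ ∷ w) nz p 1≤b 0≤τ h = wordOf-directions-◆ (bars w) c τ w refl nz p 0≤τ h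
  wordOf-directions-◆ zero c τ w e nz p 0≤τ (inj₂ (s≤s ()))
  wordOf-directions-◆ zero c τ w e nz p 0≤τ (inj₁ τ≢0) =
    wordOf-∷ c west (directions-after w) west≢𝟎 (letter-◆ c west λ q → τ≢0 (trans (sym (det-west τ))
      (Par-trans (slope τ) c west nz (Par-sym c (slope τ) p) q))) (wordOf-after w (sym e))
  wordOf-directions-◆ (suc b) c τ w e nz p 0≤τ h =
    wordOf-∷ c (slope τ′) (directions τ′ w) (slope≢𝟎 τ′) (letter-◆ c (slope τ′) λ q → ℚₚ.1≢0
      (trans (solve 1 (λ τ → con 1ℚ := τ :+ con 1ℚ :- τ) refl τ) (trans (sym (det-slope τ τ′))
        (Par-trans (slope τ) c (slope τ′) nz (Par-sym c (slope τ) p) q))))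
      (wordOf-directions (slope τ′) τ′ w (slope≢𝟎 τ′) (det-self (slope τ′)) (ℕₚ.≤-trans (s≤s z≤n) (ℕₚ.≤-reflexive e)) (0≤+1 0≤τ)
        (inj₁ λ z → ℚₚ.<-irrefl (sym z) (ℚₚ.≤-<-trans 0≤τ (<+1 τ))))
    where τ′ = τ + 1ℚ

  two-bars : ∀ {n} (w : Word n) → 2 ≤ bars w → ∃ λ J → ∣ J ∣ ≡ 2 × Succ false (word J) w
  two-bars (○ ∷ w) p = case two-bars w p of λ (J , e , S) → false ∷ J , e , S
  two-bars (● ∷ w) p = case two-bars w p of λ (J , e , S) → false ∷ J , e , S
  two-bars (◆ ∷ w) (s≤s p) = true ∷ first◆ w , cong suc (∣first◆∣ w p) , Succ-first◆ false w p

  word⇒positroid : ∀ {n} (w : Word n) → 2 ≤ bars w → IsPositroid 2 (fam w)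
  word⇒positroid {n} w two = A , nonneg , (λ J m → sup J (fam⁻ w m)) , (λ J e d → fam⁺ w (e , sup⁻ J e d)) , nonempty
    where
    vs = directions 0ℚ w
    A : Fin 2 → Fin n → ℚ
    A zero    j = proj₁ (lookup vs j)
    A (suc _) j = proj₂ (lookup vs j)
    tnn : TNN vs
    tnn = TNN-directions w ℚₚ.≤-refl
    pl : ∀ J → ∣ J ∣ ≡ 2 → plücker A J ≡ pairDet J vs
    pl J e = trans (plücker-2 A J e) (cong (pairDet J) (tabulate∘lookup vs))
    is-w : cyclicWord vs ≡ w
    is-w = trans (cong (λ u → wordOf u vs) (final-directions 𝟎 0ℚ w (ℕₚ.≤-trans (s≤s z≤n) two)))
      (wordOf-directions west 0ℚ w west≢𝟎 refl (ℕₚ.≤-trans (s≤s z≤n) two) ℚₚ.≤-refl (inj₂ two))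
    nonneg : ∀ J → ∣ J ∣ ≡ 2 → 0ℚ ≤ℚ plücker A J
    nonneg J e = subst (0ℚ ≤ℚ_) (sym (pl J e)) (TNN⁻ vs tnn J e)
    sup : ∀ J → Basis w J → ∣ J ∣ ≡ 2 × plücker A J ≢ 0ℚ
    sup J (e , c) = e , λ d → Cyc⇒independent J vs tnn e (subst (Cyc (word J)) (sym is-w) c) (trans (sym (pl J e)) d)
    sup⁻ : ∀ J → ∣ J ∣ ≡ 2 → plücker A J ≢ 0ℚ → Cyc (word J) w
    sup⁻ J e d = subst (Cyc (word J)) is-w (independent⇒Cyc J vs e λ z → d (trans (pl J e) z))
    nonempty : ∃ λ J → J ∈F fam w
    nonempty = case two-bars w two of λ (J , e , f′ , r) → J , fam⁺ w (e , false , f′ , r , false≤ f′)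

open RankTwo

-- The elements of P_{n,k} are the words with at least n - k letters ◆.

module Positroids where

  open import Data.Nat using (_≟_)
  open import Data.Rational using (0ℚ) renaming (_≤_ to _≤ℚ_)
  open import Data.Rational.Properties as ℚₚ using ()

  ∁-involutive : ∀ {n} (J : Subset n) → ∁ (∁ J) ≡ J
  ∁-involutive []          = refl
  ∁-involutive (true  ∷ J) = cong (true ∷_) (∁-involutive J)
  ∁-involutive (false ∷ J) = cong (false ∷_) (∁-involutive J)

  ≼⇒⊆ : ∀ {n} {I K : Subset n} → I ≼ K → I ⊆ K
  ≼⇒⊆ []             = λ x → x
  ≼⇒⊆ (keep true p)  = s⊆s (≼⇒⊆ p)
  ≼⇒⊆ (keep false p) = s⊆s (≼⇒⊆ p)
  ≼⇒⊆ (skip p)       = out⊆ (≼⇒⊆ p)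

  ⊆⇒≼ : ∀ {n} (I K : Subset n) → I ⊆ K → I ≼ K
  ⊆⇒≼ [] [] p = []
  ⊆⇒≼ (true  ∷ I) (true  ∷ K) p = keep true (⊆⇒≼ I K (drop-∷-⊆ p))
  ⊆⇒≼ (false ∷ I) (false ∷ K) p = keep false (⊆⇒≼ I K (drop-∷-⊆ p))
  ⊆⇒≼ (false ∷ I) (true  ∷ K) p = skip (⊆⇒≼ I K (drop-∷-⊆ p))
  ⊆⇒≼ (true  ∷ I) (false ∷ K) p = case p here of λ ()

  run⇒≼ : ∀ {n} f {f′} (I K : Subset n) → run f (word I) (word K) ≡ just f′ → I ≼ K
  run⇒≼ f [] [] r = []
  run⇒≼ f (true  ∷ I) (true  ∷ K) r = keep true (run⇒≼ false I K r)
  run⇒≼ f (false ∷ I) (false ∷ K) r = keep false (run⇒≼ f I K r)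
  run⇒≼ f (false ∷ I) (true  ∷ K) r = skip (run⇒≼ true I K r)

  ≼⇒Cyc : ∀ {n} {I K : Subset n} → I ≼ K → Cyc (word I) (word K)
  ≼⇒Cyc p = case ≼-run false p of λ (f′ , r) → false , f′ , r , false≤ f′

  -- Sealed because with-abstractions over its value would normalise the
  -- determinant identities it rests on.
  abstract
    InP⇒word : ∀ {n k x} → 2 ≤ n ∸ k → InP n k x → ∃ λ w → n ∸ k ≤ bars w × x ≡ fam w
    InP⇒word {n} {k} {x} two (𝓜 , (A , _ , sup , _ , J₀ , m₀) , pos , D⊆x , _) = go (positroid⇒word pos)
      where
      K : Subset n
      K = ∁ J₀
      size : bars (word K) ≡ n ∸ k
      size = trans (bars-word K) (trans (∣∁p∣≡n∸∣p∣ J₀) (cong (n ∸_) (proj₁ (sup J₀ m₀))))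
      go : (∃ λ w → 2 ≤ bars w × x ≡ fam w) → ∃ λ w → n ∸ k ≤ bars w × x ≡ fam w
      go (w , _ , e) = w , subst (_≤ bars w) size (Cyc-bars (word K) w (BasesIn⇒Cyc (word K) w (subst (2 ≤_) (sym size) two) bases)) , e
        where
        bases : BasesIn (word K) w
        bases I (two′ , f , f′ , r , _) = proj₂ (fam⁻ w (subst (I ∈F_) e
          (D⊆x I (two′ , K , subst (_∈F 𝓜) (sym (∁-involutive J₀)) m₀ , ≼⇒⊆ (run⇒≼ f I K r)))))

  -- For the positroid dual to the realisation, `Down2` consists of exactly the bases coded by `w`.
  -- It is thus already a positroid and equals its own envelope.
  word⇒InP : ∀ {n k} (w : Word n) → k ≤ n → 2 ≤ n ∸ k → n ∸ k ≤ bars w → InP n k (fam w)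
  word⇒InP {n} {k} w k≤n two le = realise (dual-exists (n ∸ k) two w le)
    where
    realise : (∃ λ k′ → k′ +ⁿ (n ∸ k) ≡ n × Dual k′ (Wrap w)) → InP n k (fam w)
    realise (k′ , e , D′) = 𝓜 , pos , word⇒positroid w (ℕₚ.≤-trans two le) , into , λ 𝓝 _ D⊆𝓝 I m → D⊆𝓝 I (onto I (fam⁻ w m))
      where
      k′≡k : k′ ≡ k
      k′≡k = ℕₚ.+-cancelʳ-≡ (n ∸ k) k′ k (trans e (sym (ℕₚ.m+[n∸m]≡n k≤n)))
      D : Dual k (Wrap w)
      D = subst (λ k → Dual k (Wrap w)) k′≡k D′
      open Dual D renaming (matrix to A; nonneg to nn)

      In : Subset n → Set
      In J = ∣ J ∣ ≡ k × plücker A J ≢ 0ℚ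
      In? : ∀ J → Dec (In J)
      In? J = (∣ J ∣ ≟ k) ×-dec ¬? (plücker A J ℚₚ.≟ 0ℚ)
      𝓜 : Fam n
      𝓜 = tabulateF (λ J → does (In? J))
      in⁺ : ∀ {J} → In J → J ∈F 𝓜
      in⁺ {J} p = trans (memb-tabulateF _ J) (dec-true (In? J) p)
      in⁻ : ∀ {J} → J ∈F 𝓜 → In J
      in⁻ {J} m = does-true (In? J) (trans (sym (memb-tabulateF _ J)) m)

      pos : IsPositroid k 𝓜
      pos = A , (λ J e → subst (λ J → 0ℚ ≤ℚ plücker A J) (∁-involutive J) (nn (∁ J) (trans (cong ∣_∣ (∁-involutive J)) e)))
          , (λ J m → in⁻ m) , (λ J e d → in⁺ (e , d))
          , (case cover ⊥ (ℕₚ.≤-trans (ℕₚ.≤-reflexive (∣⊥∣≡0 n)) z≤n) wrap-⊥ of λ (K , e , d , _) → ∁ K , in⁺ (e , d))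
        where
        wrap-⊥ : Wrap w ⊥
        wrap-⊥ = case Succ-⊥ false w of λ (f′ , r) → false , f′ , r , false≤ f′

      into : ∀ I → Down2 𝓜 I → I ∈F fam w
      into I (e , J , m , I⊆J) = fam⁺ w (e , Cyc-trans (word I) (word J) w (≼⇒Cyc (⊆⇒≼ I J I⊆J)) (sound J (proj₁ (in⁻ m)) (proj₂ (in⁻ m))))

      onto : ∀ I → Basis w I → Down2 𝓜 I
      onto I (e , c) = go (cover I (ℕₚ.≤-reflexive e) c)
        where
        go : (∃ λ K → ∣ ∁ K ∣ ≡ k × coplücker A K ≢ 0ℚ × I ≼ K) → Down2 𝓜 I
        go (K , s , d , p) = e , K , in⁺ (s , d) , ≼⇒⊆ p

open Positroids

-- Signed counts of intervals by transfer matrices.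

module SignedSums where

  open import Data.Integer using (ℤ; 0ℤ; 1ℤ; -_; _+_)
  open import Data.Integer.Properties as ℤₚ using ()
  open import Data.Integer.Solver using (module +-*-Solver)

  sumW : ∀ {n} → (Word n → ℤ) → ℤ
  sumW {zero}  F = F []
  sumW {suc n} F = sumW (λ z → F (○ ∷ z)) + (sumW (λ z → F (● ∷ z)) + sumW (λ z → F (◆ ∷ z)))

  sumW-cong : ∀ {n} {F G : Word n → ℤ} → (∀ z → F z ≡ G z) → sumW F ≡ sumW G
  sumW-cong {zero}  h = h []
  sumW-cong {suc n} h = cong₂ _+_ (sumW-cong λ z → h (○ ∷ z)) (cong₂ _+_ (sumW-cong λ z → h (● ∷ z)) (sumW-cong λ z → h (◆ ∷ z)))

  sumW-zero : ∀ {n} {F : Word n → ℤ} → (∀ z → F z ≡ 0ℤ) → sumW F ≡ 0ℤ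
  sumW-zero {zero}  h = h []
  sumW-zero {suc n} h = cong₂ _+_ (sumW-zero λ z → h (○ ∷ z)) (cong₂ _+_ (sumW-zero λ z → h (● ∷ z)) (sumW-zero λ z → h (◆ ∷ z)))

  open +-*-Solver

  sumW-neg : ∀ {n} (F : Word n → ℤ) → sumW (λ z → - F z) ≡ - sumW F
  sumW-neg {zero}  F = refl
  sumW-neg {suc n} F = trans (cong₂ _+_ (sumW-neg λ z → F (○ ∷ z)) (cong₂ _+_ (sumW-neg λ z → F (● ∷ z)) (sumW-neg λ z → F (◆ ∷ z))))
    (solve 3 (λ a b c → :- a :+ (:- b :+ :- c) := :- (a :+ (b :+ c))) refl (sumW λ z → F (○ ∷ z)) (sumW λ z → F (● ∷ z)) (sumW λ z → F (◆ ∷ z)))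

  sumW-∷ʳ : ∀ {n} (F : Word (suc n) → ℤ) →
    sumW (λ z → F (z ∷ʳ ○)) + (sumW (λ z → F (z ∷ʳ ●)) + sumW (λ z → F (z ∷ʳ ◆))) ≡ sumW F
  sumW-∷ʳ {zero}  F = refl
  sumW-∷ʳ {suc n} F = trans
    (solve 9 (λ a b c d e f g h i → (a :+ (b :+ c)) :+ ((d :+ (e :+ f)) :+ (g :+ (h :+ i))) :=
        (a :+ (d :+ g)) :+ ((b :+ (e :+ h)) :+ (c :+ (f :+ i)))) refl
      (s ○ ○) (s ● ○) (s ◆ ○) (s ○ ●) (s ● ●) (s ◆ ●) (s ○ ◆) (s ● ◆) (s ◆ ◆))
    (cong₂ _+_ (sumW-∷ʳ λ z → F (○ ∷ z)) (cong₂ _+_ (sumW-∷ʳ λ z → F (● ∷ z)) (sumW-∷ʳ λ z → F (◆ ∷ z))))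
    where
    s : Letter → Letter → ℤ
    s a c = sumW (λ z → F (a ∷ (z ∷ʳ c)))

  sumW-rot : ∀ {n} (F : Word n → ℤ) → sumW (λ z → F (rot z)) ≡ sumW F
  sumW-rot {zero}  F = refl
  sumW-rot {suc n} F = sumW-∷ʳ F

  sign : ∀ {n} → Word n → ℤ
  sign []      = 1ℤ
  sign (○ ∷ z) = sign z
  sign (● ∷ z) = - sign z
  sign (◆ ∷ z) = sign z

  sign-∷ʳ : ∀ {n} (z : Word n) a → sign (z ∷ʳ a) ≡ sign (a ∷ z)
  sign-∷ʳ []      a = refl
  sign-∷ʳ (○ ∷ z) ○ = sign-∷ʳ z ○
  sign-∷ʳ (○ ∷ z) ● = sign-∷ʳ z ●
  sign-∷ʳ (○ ∷ z) ◆ = sign-∷ʳ z ◆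
  sign-∷ʳ (● ∷ z) ○ = cong -_ (sign-∷ʳ z ○)
  sign-∷ʳ (● ∷ z) ● = cong -_ (sign-∷ʳ z ●)
  sign-∷ʳ (● ∷ z) ◆ = cong -_ (sign-∷ʳ z ◆)
  sign-∷ʳ (◆ ∷ z) ○ = sign-∷ʳ z ○
  sign-∷ʳ (◆ ∷ z) ● = sign-∷ʳ z ●
  sign-∷ʳ (◆ ∷ z) ◆ = sign-∷ʳ z ◆

  sign-rot : ∀ {n} (z : Word n) → sign (rot z) ≡ sign z
  sign-rot []      = refl
  sign-rot (a ∷ z) = sign-∷ʳ z a

  val : Bool → Bool → ℤ → ℤ
  val p q s = if p ∧ q then s else 0ℤ

  val-falseʳ : ∀ p s → val p false s ≡ 0ℤ
  val-falseʳ false s = refl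
  val-falseʳ true  s = refl

  val-neg : ∀ p q s → val p q (- s) ≡ - val p q s
  val-neg true  true  s = refl
  val-neg true  false s = refl
  val-neg false q     s = refl

  term : ∀ {n} → Bool → Bool → Word n → Word n → Word n → ℤ
  term f g x y z = val (is-just (run f x z)) (is-just (run g z y)) (sign z)

  -- The flags `f` and `g` form the state of the product automaton. Only success is recorded, not
  -- the final flags; after rotation these carry no further condition.
  T : ∀ {n} → Bool → Bool → Word n → Word n → ℤ
  T f g x y = sumW (term f g x y)

  neg-T : ∀ {n} f g (x y : Word n) → sumW (λ z → val (is-just (run f x z)) (is-just (run g z y)) (- sign z)) ≡ - T f g x y
  neg-T f g x y = trans (sumW-cong λ z → val-neg (is-just (run f x z)) (is-just (run g z y)) (sign z)) (sumW-neg (term f g x y))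

  vanish : ∀ {n} (p : Word n → Bool) (s : Word n → ℤ) → sumW (λ z → val (p z) false (s z)) ≡ 0ℤ
  vanish p s = sumW-zero λ z → val-falseʳ (p z) (s z)

  sumW-0 : ∀ {n} → sumW {n} (λ _ → 0ℤ) ≡ 0ℤ
  sumW-0 {n} = sumW-zero {n} λ _ → refl

  -- The transfer rules split by the first letter of `z`. Where a sum vanishes outright, either no
  -- letter fits, or the letters that fit cancel: opposite signs, same resulting flags.
  T-○○ : ∀ {n} f g (x y : Word n) → T f g (○ ∷ x) (○ ∷ y) ≡ T f g x y
  T-○○ f g x y = trans (cong (_+_ (T f g x y)) (cong₂ _+_ (vanish (λ z → is-just (run f x z)) (λ z → - sign z)) (vanish (λ z → is-just (run true x z)) sign)))
    (ℤₚ.+-identityʳ _)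

  T-○●-false : ∀ {n} f (x y : Word n) → T f false (○ ∷ x) (● ∷ y) ≡ 0ℤ
  T-○●-false f x y = trans (cong (_+_ (T f false x y)) (cong₂ _+_ (neg-T f false x y) (vanish (λ z → is-just (run true x z)) sign)))
    (solve 1 (λ a → a :+ (:- a :+ con 0ℤ) := con 0ℤ) refl (T f false x y))

  T-○●-true : ∀ {n} f (x y : Word n) → T f true (○ ∷ x) (● ∷ y) ≡ T f true x y + (- T f false x y + T true false x y)
  T-○●-true f x y = cong (_+_ (T f true x y)) (cong (_+ T true false x y) (neg-T f false x y))

  T-○◆ : ∀ {n} f g (x y : Word n) → T f g (○ ∷ x) (◆ ∷ y) ≡ T f true x y + (- T f false x y + T true false x y)
  T-○◆ f g x y = cong (_+_ (T f true x y)) (cong (_+ T true false x y) (neg-T f false x y))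

  T-●○ : ∀ {n} f g (x y : Word n) → T f g (● ∷ x) (○ ∷ y) ≡ 0ℤ
  T-●○ {n} f g x y = cong₂ _+_ (sumW-0 {n}) (cong₂ _+_ (vanish (λ z → is-just (run false x z)) (λ z → - sign z)) (vanish (λ z → is-just (run false x z)) sign))

  T-●●-false : ∀ {n} f (x y : Word n) → T f false (● ∷ x) (● ∷ y) ≡ - T false false x y
  T-●●-false {n} f x y = trans (cong₂ _+_ (sumW-0 {n}) (cong₂ _+_ (neg-T false false x y) (vanish (λ z → is-just (run false x z)) sign)))
    (solve 1 (λ a → con 0ℤ :+ (:- a :+ con 0ℤ) := :- a) refl (T false false x y))

  T-●●-true : ∀ {n} f (x y : Word n) → T f true (● ∷ x) (● ∷ y) ≡ 0ℤ
  T-●●-true {n} f x y = trans (cong₂ _+_ (sumW-0 {n}) (cong (_+ T false false x y) (neg-T false false x y)))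
    (solve 1 (λ a → con 0ℤ :+ (:- a :+ a) := con 0ℤ) refl (T false false x y))

  T-●◆ : ∀ {n} f g (x y : Word n) → T f g (● ∷ x) (◆ ∷ y) ≡ 0ℤ
  T-●◆ {n} f g x y = trans (cong₂ _+_ (sumW-0 {n}) (cong (_+ T false false x y) (neg-T false false x y)))
    (solve 1 (λ a → con 0ℤ :+ (:- a :+ a) := con 0ℤ) refl (T false false x y))

  T-◆○ : ∀ {n} f g (x y : Word n) → T f g (◆ ∷ x) (○ ∷ y) ≡ 0ℤ
  T-◆○ {n} f g x y = cong₂ _+_ (sumW-0 {n}) (cong₂ _+_ (vanish (λ z → is-just (run f (◆ ∷ x) (● ∷ z))) (λ z → - sign z)) (vanish (λ z → is-just (run false x z)) sign))

  T-◆● : ∀ {n} f g (x y : Word n) → T f g (◆ ∷ x) (● ∷ y) ≡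
    (if f then - T false false x y else 0ℤ) + (if g then T false false x y else 0ℤ)
  T-◆● {n} f g x y = trans (cong₂ _+_ (sumW-0 {n}) (cong₂ _+_ (one f) (two g))) (ℤₚ.+-identityˡ _)
    where
    one : ∀ f → sumW (λ z → val (is-just (run f (◆ ∷ x) (● ∷ z))) (is-just (run false z y)) (- sign z)) ≡ (if f then - T false false x y else 0ℤ)
    one true  = neg-T false false x y
    one false = sumW-0 {n}
    two : ∀ g → sumW (λ z → val (is-just (run false x z)) (is-just (run g (◆ ∷ z) (● ∷ y))) (sign z)) ≡ (if g then T false false x y else 0ℤ)
    two true  = refl
    two false = vanish (λ z → is-just (run false x z)) sign

  T-◆◆ : ∀ {n} f g (x y : Word n) → T f g (◆ ∷ x) (◆ ∷ y) ≡ (if f then - T false false x y else 0ℤ) + T false false x y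
  T-◆◆ {n} f g x y = trans (cong₂ _+_ (sumW-0 {n}) (cong (_+ T false false x y) (one f))) (ℤₚ.+-identityˡ _)
    where
    one : ∀ f → sumW (λ z → val (is-just (run f (◆ ∷ x) (● ∷ z))) (is-just (run false z y)) (- sign z)) ≡ (if f then - T false false x y else 0ℤ)
    one true  = neg-T false false x y
    one false = sumW-0 {n}

  endsNL : ∀ {n} → Bool → Word n → Bool
  endsNL e []      = e
  endsNL e (○ ∷ x) = endsNL false x
  endsNL e (● ∷ x) = endsNL true x
  endsNL e (◆ ∷ x) = endsNL true x

  endsNL-∷ʳ◆ : ∀ {n} e (x : Word n) → endsNL e (x ∷ʳ ◆) ≡ true
  endsNL-∷ʳ◆ e []      = refl
  endsNL-∷ʳ◆ e (○ ∷ x) = endsNL-∷ʳ◆ false x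
  endsNL-∷ʳ◆ e (● ∷ x) = endsNL-∷ʳ◆ true x
  endsNL-∷ʳ◆ e (◆ ∷ x) = endsNL-∷ʳ◆ true x

  endsNL-weaken : ∀ {n} (x : Word n) → endsNL false x ≡ true → endsNL true x ≡ true
  endsNL-weaken (○ ∷ x) e = e
  endsNL-weaken (● ∷ x) e = e
  endsNL-weaken (◆ ∷ x) e = e

  -- This combination is the sum over the three letters that z may have at a
  -- non-loop of y inserted in a gap of x; its vanishing is reproduced by every
  -- further letter.
  T-balance : ∀ {n} f (x y : Word n) → endsNL false x ≡ true → T f true x y + (- T f false x y + T true false x y) ≡ 0ℤ
  T-balance f (○ ∷ x) (○ ∷ y) e = trans (cong₂ _+_ (T-○○ f true x y) (cong₂ (λ u v → - u + v) (T-○○ f false x y) (T-○○ true false x y))) (T-balance f x y e)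
  T-balance f (○ ∷ x) (● ∷ y) e = cong₂ _+_ (trans (T-○●-true f x y) (T-balance f x y e)) (cong₂ (λ u v → - u + v) (T-○●-false f x y) (T-○●-false true x y))
  T-balance f (○ ∷ x) (◆ ∷ y) e = cong₂ _+_ (trans (T-○◆ f true x y) (T-balance f x y e))
    (cong₂ (λ u v → - u + v) (trans (T-○◆ f false x y) (T-balance f x y e)) (trans (T-○◆ true false x y) (T-balance true x y e)))
  T-balance f (● ∷ x) (○ ∷ y) e = cong₂ _+_ (T-●○ f true x y) (cong₂ (λ u v → - u + v) (T-●○ f false x y) (T-●○ true false x y))
  T-balance f (● ∷ x) (● ∷ y) e = trans (cong₂ _+_ (T-●●-true f x y) (cong₂ (λ u v → - u + v) (T-●●-false f x y) (T-●●-false true x y)))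
    (solve 1 (λ a → con 0ℤ :+ (:- (:- a) :+ :- a) := con 0ℤ) refl (T false false x y))
  T-balance f (● ∷ x) (◆ ∷ y) e = cong₂ _+_ (T-●◆ f true x y) (cong₂ (λ u v → - u + v) (T-●◆ f false x y) (T-●◆ true false x y))
  T-balance f (◆ ∷ x) (○ ∷ y) e = cong₂ _+_ (T-◆○ f true x y) (cong₂ (λ u v → - u + v) (T-◆○ f false x y) (T-◆○ true false x y))
  T-balance true (◆ ∷ x) (● ∷ y) e = trans (cong₂ _+_ (T-◆● true true x y) (cong₂ (λ u v → - u + v) (T-◆● true false x y) (T-◆● true false x y)))
    (solve 1 (λ a → (:- a :+ a) :+ (:- (:- a :+ con 0ℤ) :+ (:- a :+ con 0ℤ)) := con 0ℤ) refl (T false false x y))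
  T-balance false (◆ ∷ x) (● ∷ y) e = trans (cong₂ _+_ (T-◆● false true x y) (cong₂ (λ u v → - u + v) (T-◆● false false x y) (T-◆● true false x y)))
    (solve 1 (λ a → (con 0ℤ :+ a) :+ (con 0ℤ :+ (:- a :+ con 0ℤ)) := con 0ℤ) refl (T false false x y))
  T-balance true (◆ ∷ x) (◆ ∷ y) e = trans (cong₂ _+_ (T-◆◆ true true x y) (cong₂ (λ u v → - u + v) (T-◆◆ true false x y) (T-◆◆ true false x y)))
    (solve 1 (λ a → (:- a :+ a) :+ (:- (:- a :+ a) :+ (:- a :+ a)) := con 0ℤ) refl (T false false x y))
  T-balance false (◆ ∷ x) (◆ ∷ y) e = trans (cong₂ _+_ (T-◆◆ false true x y) (cong₂ (λ u v → - u + v) (T-◆◆ false false x y) (T-◆◆ true false x y)))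
    (solve 1 (λ a → (con 0ℤ :+ a) :+ (:- (con 0ℤ :+ a) :+ (:- a :+ a)) := con 0ℤ) refl (T false false x y))

  -- In state `false`, `false` equal letters keep the state up to sign. At the first difference
  -- every rule gives zero, except ○ against ◆, which produces the combination of `T-balance`.
  T-zero : ∀ {n} (x y : Word n) → endsNL true x ≡ true → x ≢ y → T false false x y ≡ 0ℤ
  T-zero [] [] e ne = ⊥-elim (ne refl)
  T-zero (○ ∷ x) (○ ∷ y) e ne = trans (T-○○ false false x y) (T-zero x y (endsNL-weaken x e) λ q → ne (cong (○ ∷_) q))
  T-zero (○ ∷ x) (● ∷ y) e ne = T-○●-false false x y
  T-zero (○ ∷ x) (◆ ∷ y) e ne = trans (T-○◆ false false x y) (T-balance false x y e)
  T-zero (● ∷ x) (○ ∷ y) e ne = T-●○ false false x y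
  T-zero (● ∷ x) (● ∷ y) e ne = trans (T-●●-false false x y) (cong -_ (T-zero x y e λ q → ne (cong (● ∷_) q)))
  T-zero (● ∷ x) (◆ ∷ y) e ne = T-●◆ false false x y
  T-zero (◆ ∷ x) (○ ∷ y) e ne = T-◆○ false false x y
  T-zero (◆ ∷ x) (● ∷ y) e ne = T-◆● false false x y
  T-zero (◆ ∷ x) (◆ ∷ y) e ne = trans (T-◆◆ false false x y) (trans (ℤₚ.+-identityˡ _) (T-zero x y e λ q → ne (cong (◆ ∷_) q)))

  _≤?ᵇ_ : ℕ → ℕ → Bool
  zero  ≤?ᵇ m     = true
  suc r ≤?ᵇ zero  = false
  suc r ≤?ᵇ suc m = r ≤?ᵇ m

  ≤?ᵇ-suc : ∀ r m → (r ≤?ᵇ suc m) ≡ (pred r ≤?ᵇ m)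
  ≤?ᵇ-suc zero    m = refl
  ≤?ᵇ-suc (suc r) m = refl

  ≤?ᵇ⁺ : ∀ {r m} → r ≤ m → (r ≤?ᵇ m) ≡ true
  ≤?ᵇ⁺ z≤n     = refl
  ≤?ᵇ⁺ (s≤s p) = ≤?ᵇ⁺ p

  ≤?ᵇ⁻ : ∀ r m → (r ≤?ᵇ m) ≡ true → r ≤ m
  ≤?ᵇ⁻ zero    m       e = z≤n
  ≤?ᵇ⁻ (suc r) (suc m) e = s≤s (≤?ᵇ⁻ r m e)

  lterm : ∀ {n} → ℕ → Bool → Word n → Word n → ℤ
  lterm r g y z = val (r ≤?ᵇ bars z) (is-just (run g z y)) (sign z)

  -- The analogue of `T` for a lower interval: the condition from `x` is replaced by a lower bound
  -- `r` on the letters ◆, which drops by one when `z` reads a ◆.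
  V : ∀ {n} → ℕ → Bool → Word n → ℤ
  V r g y = sumW (lterm r g y)

  neg-V : ∀ {n} r g (y : Word n) → sumW (λ z → val (r ≤?ᵇ bars z) (is-just (run g z y)) (- sign z)) ≡ - V r g y
  neg-V r g y = trans (sumW-cong λ z → val-neg (r ≤?ᵇ bars z) (is-just (run g z y)) (sign z)) (sumW-neg (lterm r g y))

  pred-V : ∀ {n} r g (y : Word n) → sumW (λ z → val (r ≤?ᵇ suc (bars z)) (is-just (run g z y)) (sign z)) ≡ V (pred r) g y
  pred-V r g y = sumW-cong λ z → cong (λ p → val p (is-just (run g z y)) (sign z)) (≤?ᵇ-suc r (bars z))

  V-○ : ∀ {n} r g (y : Word n) → V r g (○ ∷ y) ≡ V r g y
  V-○ {n} r g y = trans (cong (_+_ (V r g y)) (cong₂ _+_ (vanish {n} (λ z → r ≤?ᵇ bars z) (λ z → - sign z)) (vanish {n} (λ z → r ≤?ᵇ suc (bars z)) sign)))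
    (ℤₚ.+-identityʳ _)

  V-●-false : ∀ {n} r (y : Word n) → V r false (● ∷ y) ≡ 0ℤ
  V-●-false {n} r y = trans (cong (_+_ (V r false y)) (cong₂ _+_ (neg-V r false y) (vanish {n} (λ z → r ≤?ᵇ suc (bars z)) sign)))
    (solve 1 (λ a → a :+ (:- a :+ con 0ℤ) := con 0ℤ) refl (V r false y))

  V-●-true : ∀ {n} r (y : Word n) → V r true (● ∷ y) ≡ V r true y + (- V r false y + V (pred r) false y)
  V-●-true r y = cong (_+_ (V r true y)) (cong₂ _+_ (neg-V r false y) (pred-V r false y))

  V-◆ : ∀ {n} r g (y : Word n) → V r g (◆ ∷ y) ≡ V r true y + (- V r false y + V (pred r) false y)
  V-◆ r g y = cong (_+_ (V r true y)) (cong₂ _+_ (neg-V r false y) (pred-V r false y))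

  indicator : Bool → ℤ
  indicator true  = 1ℤ
  indicator false = 0ℤ

  -- The combination met after a ◆ of `y`. A ○ or ● preserves it; at a ◆ the first two terms cancel
  -- and `r` is replaced by `pred r`, while `bars y` drops by one as well.
  V-balance : ∀ {n} r (y : Word n) → V r true y + (- V r false y + V (pred r) false y) ≡ indicator (r ≤?ᵇ suc (bars y))
  V-balance zero          [] = refl
  V-balance (suc zero)    [] = refl
  V-balance (suc (suc r)) [] = refl
  V-balance r (○ ∷ y) = trans (cong₂ _+_ (V-○ r true y) (cong₂ (λ u v → - u + v) (V-○ r false y) (V-○ (pred r) false y))) (V-balance r y)
  V-balance r (● ∷ y) = trans (cong₂ _+_ (trans (V-●-true r y) (V-balance r y)) (cong₂ (λ u v → - u + v) (V-●-false r y) (V-●-false (pred r) y)))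
    (ℤₚ.+-identityʳ _)
  V-balance r (◆ ∷ y) = trans
    (cong₂ _+_ (trans (V-◆ r true y) (V-balance r y)) (cong₂ (λ u v → - u + v) (trans (V-◆ r false y) (V-balance r y)) (trans (V-◆ (pred r) false y) (V-balance (pred r) y))))
    (trans (solve 2 (λ a b → a :+ (:- a :+ b) := b) refl (indicator (r ≤?ᵇ suc (bars y))) (indicator (pred r ≤?ᵇ suc (bars y))))
      (cong indicator (sym (≤?ᵇ-suc r (suc (bars y))))))

  V-one : ∀ {n} r (y : Word n) → r ≤ bars (◆ ∷ y) → V r false (◆ ∷ y) ≡ 1ℤ
  V-one r y p = trans (V-◆ r false y) (trans (V-balance r y) (cong indicator (≤?ᵇ⁺ p)))

  interval : ∀ {n} → Word n → Word n → Word n → ℤ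
  interval x y z = val (does (Cyc? x z)) (does (Cyc? z y)) (sign z)

  below : ∀ {n} → ℕ → Word n → Word n → ℤ
  below r y z = val (r ≤?ᵇ bars z) (does (Cyc? z y)) (sign z)

  does-⇔ : ∀ {P Q : Set} (p : Dec P) (q : Dec Q) → (P → Q) → (Q → P) → does p ≡ does q
  does-⇔ (yes p) (yes q) f g = refl
  does-⇔ (no ¬p) (no ¬q) f g = refl
  does-⇔ (yes p) (no ¬q) f g = ⊥-elim (¬q (f p))
  does-⇔ (no ¬p) (yes q) f g = ⊥-elim (¬p (g q))

  does-is-just : ∀ {P : Set} (p : Dec P) (m : Maybe Bool) → (P → ∃ λ f → m ≡ just f) → ((∃ λ f → m ≡ just f) → P) → does p ≡ is-just m
  does-is-just (yes p) m f g with m | f p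
  ... | just _ | _ = refl
  does-is-just (no ¬p) nothing f g = refl
  does-is-just (no ¬p) (just b) f g = ⊥-elim (¬p (g (b , refl)))

  Cyc-rot-does : ∀ {n} (x z : Word n) → does (Cyc? (rot x) (rot z)) ≡ does (Cyc? x z)
  Cyc-rot-does x z = does-⇔ (Cyc? (rot x) (rot z)) (Cyc? x z) (Cyc-rot⁻ x z) (Cyc-rot x z)

  interval-rot : ∀ {n} (x y : Word n) → sumW (interval (rot x) (rot y)) ≡ sumW (interval x y)
  interval-rot x y = trans (sym (sumW-rot (interval (rot x) (rot y)))) (sumW-cong λ z →
    trans (cong₂ (λ p q → val p q (sign (rot z))) (Cyc-rot-does x z) (Cyc-rot-does z y)) (cong (val (does (Cyc? x z)) (does (Cyc? z y))) (sign-rot z)))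

  below-rot : ∀ {n} r (y : Word n) → sumW (below r (rot y)) ≡ sumW (below r y)
  below-rot r y = trans (sym (sumW-rot (below r (rot y)))) (sumW-cong λ z →
    trans (cong₂ (λ p q → val p q (sign (rot z))) (cong (r ≤?ᵇ_) (bars-rot z)) (Cyc-rot-does z y)) (cong (val (r ≤?ᵇ bars z) (does (Cyc? z y))) (sign-rot z)))

  Succ⇒Cyc : ∀ {n} (x z : Word n) → Succ false x z → Cyc x z
  Succ⇒Cyc x z (f , r) = false , f , r , false≤ f

  -- Reading a final non-loop of `x` leaves the flag `false`, so the initial flag was `false` too
  -- and the cyclic condition is a linear one. The final letter of `z` is again a non-loop, so the
  -- same applies to `z` against `y`.
  Cyc-ends : ∀ {n} (x z : Word n) {a} c → NonLoop a → Cyc (x ∷ʳ a) (z ∷ʳ c) → Succ false (x ∷ʳ a) (z ∷ʳ c) × NonLoop c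
  Cyc-ends x z {a} c na (f , f′ , r , le) with run-∷ʳ⁻ x z a c r
  ... | g , _ , r′ with run-nonloop {c = c} na r′
  Cyc-ends x z {a} c na (false , _ , r , b≤b) | g , _ , r′ | refl = (false , r) , Succ-nonloop na (false , r′)

  val-cong : ∀ p {p′ q q′} s → p ≡ p′ → (p ≡ true → q ≡ q′) → val p q s ≡ val p′ q′ s
  val-cong true  s refl h = cong (λ q → val true q s) (h refl)
  val-cong false s refl h = refl

  interval-term : ∀ {n} (x : Word n) (y z : Word (suc n)) → interval (x ∷ʳ ◆) y z ≡ term false false (x ∷ʳ ◆) y z
  interval-term x y z with initLast z | initLast y
  ... | z′ , c , refl | y′ , d , refl = val-cong _ (sign z)
    (does-is-just (Cyc? (x ∷ʳ ◆) z) _ (λ C → proj₁ (Cyc-ends x z′ c ◆′ C)) (Succ⇒Cyc (x ∷ʳ ◆) z))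
    λ e → does-is-just (Cyc? z y) _
      (λ C → proj₁ (Cyc-ends z′ y′ d (proj₂ (Cyc-ends x z′ c ◆′ (does-true (Cyc? (x ∷ʳ ◆) z) e))) C)) (Succ⇒Cyc z y)

  interval-sum : ∀ {n} (x y : Word n) → 1 ≤ bars x → x ≢ y → sumW (interval x y) ≡ 0ℤ
  interval-sum {zero} [] y () ne
  interval-sum {suc n} x y p = rot-to-last-bar P rotate base x p y
    where
    P : Word (suc n) → Set
    P x = ∀ y → x ≢ y → sumW (interval x y) ≡ 0ℤ
    rotate : ∀ w → P (rot w) → P w
    rotate w h y ne = trans (sym (interval-rot w y)) (h (rot y) λ e → ne (rot-injective w y e))
    base : ∀ w → P (w ∷ʳ ◆)
    base w y ne = trans (sumW-cong (interval-term w y)) (T-zero (w ∷ʳ ◆) y (endsNL-∷ʳ◆ true w) ne)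

  run-◆ : ∀ {n} f (z y : Word n) a → run f (a ∷ z) (◆ ∷ y) ≡ run false (a ∷ z) (◆ ∷ y)
  run-◆ f z y ○ = refl
  run-◆ f z y ● = refl
  run-◆ f z y ◆ = refl

  -- An initial ◆ of `y` admits every letter of `z` and makes the initial flag irrelevant.
  below-term : ∀ {n} r (y : Word n) (z : Word (suc n)) → below r (◆ ∷ y) z ≡ lterm r false (◆ ∷ y) z
  below-term r y (a ∷ z) = cong (λ q → val (r ≤?ᵇ bars (a ∷ z)) q (sign (a ∷ z)))
    (does-is-just (Cyc? (a ∷ z) (◆ ∷ y)) _ (λ (f , f′ , e , _) → f′ , trans (sym (run-◆ f z y a)) e) (Succ⇒Cyc (a ∷ z) (◆ ∷ y)))

  below-sum : ∀ {n} r (y : Word n) → 1 ≤ bars y → r ≤ bars y → sumW (below r y) ≡ 1ℤ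
  below-sum {zero} r [] () q
  below-sum {suc n} r y = rot-to-bar P rotate base y
    where
    P : Word (suc n) → Set
    P y = r ≤ bars y → sumW (below r y) ≡ 1ℤ
    rotate : ∀ w → P (rot w) → P w
    rotate w h q = trans (sym (below-rot r w)) (h (subst (r ≤_) (sym (bars-rot w)) q))
    base : ∀ w → P (◆ ∷ w)
    base w q = trans (sumW-cong (below-term r w)) (V-one r w q)

open SignedSums

-- Steps of weight one, minimal and maximal words, parity.

module Covers where

  open import Data.Bool as Bool using ()
  open import Data.Integer as ℤ using (ℤ; +_; 0ℤ; 1ℤ)
  open import Data.Integer.Properties as ℤₚ using ()
  open import Data.Integer.Solver using (module +-*-Solver)
  open import Data.List as List using (List; []; _∷_; _++_; length; filter)
  open import Data.List.Membership.Propositional using (_∈_)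
  open import Data.List.Membership.Propositional.Properties using (∈-++⁺ˡ; ∈-++⁺ʳ; ∈-++⁻; ∈-map⁺; ∈-map⁻)
  open import Data.List.Relation.Unary.AllPairs using ([]; _∷_)
  open import Data.List.Relation.Unary.All using ([]; _∷_)
  open import Data.List.Relation.Unary.Any using (here)
  open import Data.List.Relation.Unary.Unique.Propositional using (Unique)
  import Data.List.Relation.Unary.Unique.Propositional.Properties as Uniqueₚ
  open import Data.Nat using (_+_)

  weight : ∀ {n} → Word n → ℕ
  weight []      = 0
  weight (○ ∷ w) = weight w
  weight (● ∷ w) = suc (weight w)
  weight (◆ ∷ w) = suc (suc (weight w))

  Succ-refl : ∀ {n} f (y : Word n) → Succ f y y
  Succ-refl f []      = f , refl
  Succ-refl f (○ ∷ y) = Succ-refl f y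
  Succ-refl f (● ∷ y) = Succ-refl false y
  Succ-refl f (◆ ∷ y) = Succ-refl false y

  Lower : ∀ {n} → Word n → Word n → Set
  Lower x y = ∃ λ z → Succ false x z × Succ false z y × suc (weight z) ≡ weight y

  -- Used when a ◆ of `y` is to be removed. If `x` relied on it, the class is opened at the next
  -- non-loop of `y` instead, whose ● becomes ◆; removing 2 and adding 1 lowers the weight by one.
  move-bar : ∀ {n} (x y : Word n) → endsNL false x ≡ true → Succ true x y →
    Succ false x y ⊎ ∃ λ y⁺ → Succ false x y⁺ × Succ true y⁺ y × weight y⁺ ≡ suc (weight y)
  move-bar (○ ∷ x) (○ ∷ y) e S with move-bar x y e S
  ... | inj₁ S′                = inj₁ S′
  ... | inj₂ (y⁺ , S₁ , S₂ , w) = inj₂ (○ ∷ y⁺ , S₁ , S₂ , w)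
  move-bar (○ ∷ x) (● ∷ y) e S = inj₂ (◆ ∷ y , S , Succ-refl false y , refl)
  move-bar (○ ∷ x) (◆ ∷ y) e S = inj₁ S
  move-bar (● ∷ x) (● ∷ y) e S = inj₁ S
  move-bar (● ∷ x) (◆ ∷ y) e S = inj₁ S
  move-bar (◆ ∷ x) (● ∷ y) e S = inj₂ (◆ ∷ y , S , Succ-refl false y , refl)
  move-bar (◆ ∷ x) (◆ ∷ y) e S = inj₁ S
  move-bar (● ∷ x) (○ ∷ y) e (_ , ())
  move-bar (◆ ∷ x) (○ ∷ y) e (_ , ())

  -- The first letter in which `x` and `y` differ is the one to lower in `y`. Only ○ against ◆ can
  -- disturb later letters, and `move-bar` repairs that.
  lower-run : ∀ {n} (x y : Word n) → endsNL true x ≡ true → x ≢ y → Succ false x y → Lower x y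
  lower-run [] [] e ne S = ⊥-elim (ne refl)
  lower-run (○ ∷ x) (○ ∷ y) e ne S with lower-run x y (endsNL-weaken x e) (λ q → ne (cong (○ ∷_) q)) S
  ... | z , S₁ , S₂ , w = ○ ∷ z , S₁ , S₂ , w
  lower-run (○ ∷ x) (● ∷ y) e ne S = ○ ∷ y , S , Succ-refl false y , refl
  lower-run (○ ∷ x) (◆ ∷ y) e ne S with move-bar x y e S
  ... | inj₁ S′                = ● ∷ y , S′ , Succ-refl false y , refl
  ... | inj₂ (y⁺ , S₁ , S₂ , w) = ○ ∷ y⁺ , S₁ , S₂ , cong suc w
  lower-run (● ∷ x) (● ∷ y) e ne S with lower-run x y e (λ q → ne (cong (● ∷_) q)) S
  ... | z , S₁ , S₂ , w = ● ∷ z , S₁ , S₂ , cong suc w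
  lower-run (● ∷ x) (◆ ∷ y) e ne S = ● ∷ y , S , Succ-refl false y , refl
  lower-run (◆ ∷ x) (◆ ∷ y) e ne S with lower-run x y e (λ q → ne (cong (◆ ∷_) q)) S
  ... | z , S₁ , S₂ , w = ◆ ∷ z , S₁ , S₂ , cong (λ m → suc (suc m)) w
  lower-run (● ∷ x) (○ ∷ y) e ne (_ , ())
  lower-run (◆ ∷ x) (○ ∷ y) e ne (_ , ())
  lower-run (◆ ∷ x) (● ∷ y) e ne (_ , ())

  weight-∷ʳ : ∀ {n} (w : Word n) a → weight (w ∷ʳ a) ≡ weight (a ∷ w)
  weight-∷ʳ [] a = refl
  weight-∷ʳ (○ ∷ w) ○ = weight-∷ʳ w ○
  weight-∷ʳ (○ ∷ w) ● = weight-∷ʳ w ●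
  weight-∷ʳ (○ ∷ w) ◆ = weight-∷ʳ w ◆
  weight-∷ʳ (● ∷ w) ○ = cong suc (weight-∷ʳ w ○)
  weight-∷ʳ (● ∷ w) ● = cong suc (weight-∷ʳ w ●)
  weight-∷ʳ (● ∷ w) ◆ = cong suc (weight-∷ʳ w ◆)
  weight-∷ʳ (◆ ∷ w) ○ = cong (λ m → suc (suc m)) (weight-∷ʳ w ○)
  weight-∷ʳ (◆ ∷ w) ● = cong (λ m → suc (suc m)) (weight-∷ʳ w ●)
  weight-∷ʳ (◆ ∷ w) ◆ = cong (λ m → suc (suc m)) (weight-∷ʳ w ◆)

  weight-rot : ∀ {n} (w : Word n) → weight (rot w) ≡ weight w
  weight-rot []      = refl
  weight-rot (a ∷ w) = weight-∷ʳ w a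

  unrot : ∀ {n} (z : Word n) → ∃ λ z′ → rot z′ ≡ z
  unrot [] = [] , refl
  unrot z@(_ ∷ _) with initLast z
  ... | z′ , c , e = c ∷ z′ , sym e

  lower : ∀ {n} (x y : Word n) → 1 ≤ bars x → x ≢ y → Cyc x y →
    ∃ λ z → Cyc x z × Cyc z y × suc (weight z) ≡ weight y
  lower {zero} [] y () ne c
  lower {suc n} x y p = rot-to-last-bar P rotate base x p y
    where
    P : Word (suc n) → Set
    P x = ∀ y → x ≢ y → Cyc x y → ∃ λ z → Cyc x z × Cyc z y × suc (weight z) ≡ weight y
    rotate : ∀ w → P (rot w) → P w
    rotate w h y ne c with h (rot y) (λ e → ne (rot-injective w y e)) (Cyc-rot w y c)
    ... | z , c₁ , c₂ , e with unrot z
    ... | z′ , refl = z′ , Cyc-rot⁻ w z′ c₁ , Cyc-rot⁻ z′ y c₂ ,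
      trans (cong suc (sym (weight-rot z′))) (trans e (weight-rot y))
    base : ∀ w → P (w ∷ʳ ◆)
    base w y ne c with initLast y
    ... | y′ , d , refl with lower-run (w ∷ʳ ◆) y (endsNL-∷ʳ◆ true w) ne (proj₁ (Cyc-ends w y′ d ◆′ c))
    ... | z , S₁ , S₂ , e = z , Succ⇒Cyc (w ∷ʳ ◆) z S₁ , Succ⇒Cyc z y S₂ , e

  data _⊴_ : ∀ {n} → Word n → Word n → Set where
    []   : [] ⊴ []
    keep : ∀ {n} {z y : Word n} a → z ⊴ y → (a ∷ z) ⊴ (a ∷ y)
    ○⊴   : ∀ {n} {z y : Word n} a → z ⊴ y → (○ ∷ z) ⊴ (a ∷ y)
    ●⊴◆  : ∀ {n} {z y : Word n} → z ⊴ y → (● ∷ z) ⊴ (◆ ∷ y)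

  ⊴-run : ∀ {n} f {z y : Word n} → z ⊴ y → Succ f z y
  ⊴-run f []         = f , refl
  ⊴-run f (keep ○ p) = ⊴-run f p
  ⊴-run f (keep ● p) = ⊴-run false p
  ⊴-run f (keep ◆ p) = ⊴-run false p
  ⊴-run f (○⊴ ○ p)   = ⊴-run f p
  ⊴-run f (○⊴ ● p)   = ⊴-run f p
  ⊴-run f (○⊴ ◆ p)   = ⊴-run true p
  ⊴-run f (●⊴◆ p)    = ⊴-run false p

  ⊴-refl : ∀ {n} (y : Word n) → y ⊴ y
  ⊴-refl []      = []
  ⊴-refl (a ∷ y) = keep a (⊴-refl y)

  drop-● : ∀ {n} (y : Word n) → (∃ λ z → z ⊴ y × bars z ≡ bars y × suc (weight z) ≡ weight y) ⊎ weight y ≡ bars y + bars y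
  drop-● []      = inj₂ refl
  drop-● (● ∷ y) = inj₁ (○ ∷ y , ○⊴ ● (⊴-refl y) , refl , refl)
  drop-● (○ ∷ y) with drop-● y
  ... | inj₁ (z , p , b , w) = inj₁ (○ ∷ z , keep ○ p , b , w)
  ... | inj₂ e               = inj₂ e
  drop-● (◆ ∷ y) with drop-● y
  ... | inj₁ (z , p , b , w) = inj₁ (◆ ∷ z , keep ◆ p , cong suc b , cong (λ m → suc (suc m)) w)
  ... | inj₂ e               = inj₂ (cong suc (trans (cong suc e) (sym (ℕₚ.+-suc (bars y) (bars y)))))

  drop-◆ : ∀ {n} (y : Word n) → 1 ≤ bars y → ∃ λ z → z ⊴ y × suc (bars z) ≡ bars y × suc (weight z) ≡ weight y
  drop-◆ (○ ∷ y) q with drop-◆ y q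
  ... | z , p , b , w = ○ ∷ z , keep ○ p , b , w
  drop-◆ (● ∷ y) q with drop-◆ y q
  ... | z , p , b , w = ● ∷ z , keep ● p , b , cong suc w
  drop-◆ (◆ ∷ y) q = ● ∷ y , ●⊴◆ (⊴-refl y) , refl , refl

  2bars≤weight : ∀ {n} (y : Word n) → bars y + bars y ≤ weight y
  2bars≤weight []      = z≤n
  2bars≤weight (○ ∷ y) = 2bars≤weight y
  2bars≤weight (● ∷ y) = ℕₚ.≤-trans (2bars≤weight y) (ℕₚ.n≤1+n _)
  2bars≤weight (◆ ∷ y) = s≤s (ℕₚ.≤-trans (ℕₚ.≤-reflexive (ℕₚ.+-suc (bars y) (bars y))) (s≤s (2bars≤weight y)))

  -- If `y` has a ●, it can become ○ without losing a ◆. Otherwise the weight is twice the number of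
  -- letters ◆, which then exceeds `r`, so one ◆ can become ●.
  lower-minimal : ∀ {n} r (y : Word n) → r ≤ bars y → weight y ≢ r + r → ∃ λ z → Cyc z y × r ≤ bars z × suc (weight z) ≡ weight y
  lower-minimal r y p ne with drop-● y
  ... | inj₁ (z , q , b , w) = z , Succ⇒Cyc z y (⊴-run false q) , subst (r ≤_) (sym b) p , w
  ... | inj₂ e = case drop-◆ y (ℕₚ.≤-trans (s≤s z≤n) r<b) of λ (z , q , b , w) →
        z , Succ⇒Cyc z y (⊴-run false q) , s≤s⁻¹ (subst (suc r ≤_) (sym b) r<b) , w
    where
    r<b : suc r ≤ bars y
    r<b = ℕₚ.≤∧≢⇒< p λ q → ne (trans e (cong₂ _+_ (sym q) (sym q)))

  full : ∀ n → Word n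
  full n = replicate n ◆

  bars-full : ∀ n → bars (full n) ≡ n
  bars-full zero    = refl
  bars-full (suc n) = cong suc (bars-full n)

  ⊴-full : ∀ {n} (w : Word n) → w ⊴ full n
  ⊴-full []      = []
  ⊴-full (○ ∷ w) = ○⊴ ◆ (⊴-full w)
  ⊴-full (● ∷ w) = ●⊴◆ (⊴-full w)
  ⊴-full (◆ ∷ w) = keep ◆ (⊴-full w)

  odd : ℕ → Bool
  odd zero    = false
  odd (suc n) = not (odd n)

  %2≡odd : ∀ m → m % 2 ≡ toℕᵇ (odd m)
  %2≡odd zero          = refl
  %2≡odd (suc zero)    = refl
  %2≡odd (suc (suc m)) = trans (%2≡odd m) (cong toℕᵇ (sym (not-involutive (odd m))))

  signOf : Bool → ℤ
  signOf false = 1ℤ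
  signOf true  = ℤ.- 1ℤ

  signOf-not : ∀ b → ℤ.- signOf b ≡ signOf (not b)
  signOf-not false = refl
  signOf-not true  = refl

  sign-odd : ∀ {n} (z : Word n) → sign z ≡ signOf (odd (weight z))
  sign-odd []      = refl
  sign-odd (○ ∷ z) = sign-odd z
  sign-odd (● ∷ z) = trans (cong ℤ.-_ (sign-odd z)) (signOf-not (odd (weight z)))
  sign-odd (◆ ∷ z) = trans (sign-odd z) (cong signOf (sym (not-involutive (odd (weight z)))))

  words : ∀ n → List (Word n)
  words zero    = [] ∷ []
  words (suc n) = List.map (○ ∷_) (words n) ++ (List.map (● ∷_) (words n) ++ List.map (◆ ∷_) (words n))

  ∈-words : ∀ {n} (w : Word n) → w ∈ words n
  ∈-words []      = here refl
  ∈-words (○ ∷ w) = ∈-++⁺ˡ (∈-map⁺ (○ ∷_) (∈-words w))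
  ∈-words {suc n} (● ∷ w) = ∈-++⁺ʳ (List.map (○ ∷_) (words n)) (∈-++⁺ˡ (∈-map⁺ (● ∷_) (∈-words w)))
  ∈-words {suc n} (◆ ∷ w) = ∈-++⁺ʳ (List.map (○ ∷_) (words n)) (∈-++⁺ʳ (List.map (● ∷_) (words n)) (∈-map⁺ (◆ ∷_) (∈-words w)))

  words-unique : ∀ n → Unique (words n)
  words-unique zero    = [] ∷ []
  words-unique (suc n) = Uniqueₚ.++⁺ (prefixed ○) (Uniqueₚ.++⁺ (prefixed ●) (prefixed ◆) (disjoint λ ())) λ (i , j) →
    case ∈-++⁻ (List.map (● ∷_) (words n)) j of λ where
      (inj₁ k) → disjoint (λ ()) (i , k)
      (inj₂ k) → disjoint (λ ()) (i , k)
    where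
    prefixed : ∀ a → Unique (List.map (a ∷_) (words n))
    prefixed a = Uniqueₚ.map⁺ ∷-injectiveʳ (words-unique n)
    disjoint : ∀ {a c} → a ≢ c → ∀ {v} → ¬ (v ∈ List.map (a ∷_) (words n) × v ∈ List.map (c ∷_) (words n))
    disjoint ne (i , j) with ∈-map⁻ _ i | ∈-map⁻ _ j
    ... | _ , _ , refl | _ , _ , refl = ne refl

  sumL : ∀ {A : Set} → (A → ℤ) → List A → ℤ
  sumL F []       = 0ℤ
  sumL F (w ∷ ws) = F w ℤ.+ sumL F ws

  sumL-++ : ∀ {A : Set} (F : A → ℤ) xs ys → sumL F (xs ++ ys) ≡ sumL F xs ℤ.+ sumL F ys
  sumL-++ F []       ys = sym (ℤₚ.+-identityˡ _)
  sumL-++ F (x ∷ xs) ys = trans (cong (ℤ._+_ (F x)) (sumL-++ F xs ys)) (sym (ℤₚ.+-assoc (F x) _ _))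

  sumL-map : ∀ {A B : Set} (F : B → ℤ) (g : A → B) xs → sumL F (List.map g xs) ≡ sumL (λ x → F (g x)) xs
  sumL-map F g []       = refl
  sumL-map F g (x ∷ xs) = cong (ℤ._+_ (F (g x))) (sumL-map F g xs)

  sumW≡sumL : ∀ {n} (F : Word n → ℤ) → sumW F ≡ sumL F (words n)
  sumW≡sumL {zero}  F = sym (ℤₚ.+-identityʳ _)
  sumW≡sumL {suc n} F = sym (trans (sumL-++ F (List.map (○ ∷_) (words n)) _) (cong₂ ℤ._+_ (part ○)
    (trans (sumL-++ F (List.map (● ∷_) (words n)) _) (cong₂ ℤ._+_ (part ●) (part ◆)))))
    where
    part : ∀ a → sumL F (List.map (a ∷_) (words n)) ≡ sumW (λ z → F (a ∷ z))
    part a = trans (sumL-map F (a ∷_) (words n)) (sym (sumW≡sumL λ z → F (a ∷ z)))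

  module _ {n} {P : Word n → Set} (P? : ∀ z → Dec (P z)) where

    ofParity? : ∀ b z → Dec (P z × odd (weight z) ≡ b)
    ofParity? b z = P? z ×-dec (odd (weight z) Bool.≟ b)

    ofParity : Bool → List (Word n)
    ofParity b = filter (ofParity? b) (words n)

    signed : Word n → ℤ
    signed z = if does (P? z) then sign z else 0ℤ

    signed-count : sumW signed ≡ + length (ofParity false) ℤ.- + length (ofParity true)
    signed-count = trans (sumW≡sumL signed) (go (words n))
      where
      open +-*-Solver
      count : Bool → List (Word n) → ℤ
      count b ws = + length (filter (ofParity? b) ws)
      go : ∀ ws → sumL signed ws ≡ count false ws ℤ.- count true ws
      go [] = refl
      go (w ∷ ws) rewrite sign-odd w with does (P? w) | odd (weight w)
      ... | false | _     = trans (ℤₚ.+-identityˡ _) (go ws)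
      ... | true  | false = trans (cong (ℤ._+_ 1ℤ) (go ws)) (solve 2 (λ a b → con 1ℤ :+ (a :- b) := (con 1ℤ :+ a) :- b) refl (count false ws) (count true ws))
      ... | true  | true  = trans (cong (ℤ._+_ (ℤ.- 1ℤ)) (go ws)) (solve 2 (λ a b → con (ℤ.- 1ℤ) :+ (a :- b) := a :- (con 1ℤ :+ b)) refl (count false ws) (count true ws))

open Covers

-- The rank function and the Eulerian property.

module Eulerian where

  open import Data.Bool as Bool using (T?)
  open import Data.Integer as ℤ using ()
  open import Data.Integer.Properties as ℤₚ using ()
  open import Data.Integer.Solver using (module +-*-Solver)
  open import Data.List as List using (List; []; _∷_; length)
  open import Data.List.Properties using (length-map)
  open import Data.List.Membership.Propositional using (_∈_; find; lose)
  open import Data.List.Membership.Propositional.Properties using (∈-map⁺; ∈-map⁻; ∈-filter⁺; ∈-filter⁻)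
  open import Data.List.Relation.Unary.All as All using (All; []; _∷_)
  open import Data.List.Relation.Unary.AllPairs using ([]; _∷_)
  open import Data.List.Relation.Unary.Any using (Any; here; there; any?)
  open import Data.List.Relation.Unary.Unique.Propositional using (Unique)
  import Data.List.Relation.Unary.Unique.Propositional.Properties as Uniqueₚ
  open import Data.Nat using (_+_; _≤?_; _≟_)
  open import Data.Product.Properties using () renaming (≡-dec to ×-≡-dec)
  open import Data.Vec.Properties using () renaming (≡-dec to Vec-≡-dec)

  _≟ᴸ_ : (a c : Letter) → Dec (a ≡ c)
  ○ ≟ᴸ ○ = yes refl
  ○ ≟ᴸ ● = no λ ()
  ○ ≟ᴸ ◆ = no λ ()
  ● ≟ᴸ ○ = no λ ()
  ● ≟ᴸ ● = yes refl
  ● ≟ᴸ ◆ = no λ ()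
  ◆ ≟ᴸ ○ = no λ ()
  ◆ ≟ᴸ ● = no λ ()
  ◆ ≟ᴸ ◆ = yes refl

  _≟ᵂ_ : ∀ {n} (w z : Word n) → Dec (w ≡ z)
  _≟ᵂ_ = Vec-≡-dec _≟ᴸ_

  _≟F_ : ∀ {n} (x y : Fam n) → Dec (x ≡ y)
  _≟F_ {zero}  = Bool._≟_
  _≟F_ {suc n} = ×-≡-dec _≟F_ _≟F_

  unique-map : ∀ {A B : Set} {P : A → Set} (f : A → B) → (∀ {a c} → P a → P c → f a ≡ f c → a ≡ c) →
    ∀ {xs} → All P xs → Unique xs → Unique (List.map f xs)
  unique-map f inj [] [] = []
  unique-map {P = P} f inj (p ∷ ps) (u ∷ us) = apart ps u ∷ unique-map f inj ps us
    where
    apart : ∀ {xs} → All P xs → All (_ ≢_) xs → All (f _ ≢_) (List.map f xs)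
    apart [] [] = []
    apart (q ∷ qs) (v ∷ vs) = (λ e → v (inj p q e)) ∷ apart qs vs

  module Poset {n k} (k≤n : k ≤ n) (2≤n-k : 2 ≤ n ∸ k) where

    r : ℕ
    r = n ∸ k

    1≤r : 1 ≤ r
    1≤r = ℕₚ.≤-trans (s≤s z≤n) 2≤n-k

    injective : ∀ {w z : Word n} → r ≤ bars w → r ≤ bars z → fam w ≡ fam z → w ≡ z
    injective p q = fam-injective _ _ (ℕₚ.≤-trans 2≤n-k p) (ℕₚ.≤-trans 2≤n-k q)

    ⊆⇒Cyc : ∀ (w z : Word n) → r ≤ bars w → fam w ⊆F fam z → Cyc w z
    ⊆⇒Cyc w z p = ⊆F⇒Cyc w z (ℕₚ.≤-trans 2≤n-k p)

    inP : (w : Word n) → r ≤ bars w → InP n k (fam w)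
    inP w = word⇒InP w k≤n 2≤n-k

    Codes : Fam n → Word n → Set
    Codes x w = r ≤ bars w × fam w ≡ x

    code? : ∀ x → Dec (Any (Codes x) (words n))
    code? x = any? (λ w → (r ≤? bars w) ×-dec (fam w ≟F x)) (words n)

    -- The subtraction is exact for words with at least `r` letters ◆. The `suc` leaves rank zero to
    -- the adjoined minimum.
    rank : Word n → ℕ
    rank w = suc (weight w ∸ (r + r))

    ρ : Maybe (Fam n) → ℕ
    ρ nothing  = 0
    ρ (just x) with code? x
    ... | yes c = rank (proj₁ (find c))
    -- A family without a code is not in the poset; the value is a mere default.
    ... | no _  = 0

    ρ-fam : ∀ w → r ≤ bars w → ρ (just (fam w)) ≡ rank w
    ρ-fam w p with code? (fam w)
    ... | yes c = let (z , _ , q , e) = find c in cong rank (injective q p e)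
    ... | no ¬c = ⊥-elim (¬c (lose (∈-words w) (p , refl)))

    2r≤weight : ∀ (w : Word n) → r ≤ bars w → r + r ≤ weight w
    2r≤weight w p = ℕₚ.≤-trans (ℕₚ.+-mono-≤ p p) (2bars≤weight w)

    rank-suc : ∀ (z w : Word n) → r ≤ bars z → suc (weight z) ≡ weight w → rank w ≡ suc (rank z)
    rank-suc z w p e = cong suc (trans (cong (_∸ (r + r)) (sym e)) (ℕₚ.+-∸-assoc 1 (2r≤weight z p)))

    odd-double : ∀ m t → odd (m + (t + t)) ≡ odd m
    odd-double m zero    = cong odd (ℕₚ.+-identityʳ m)
    odd-double m (suc t) = trans (cong odd (trans (ℕₚ.+-suc m (t + suc t)) (cong suc (trans (cong (m +_) (ℕₚ.+-suc t t)) (ℕₚ.+-suc m (t + t))))))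
      (trans (not-involutive _) (odd-double m t))

    odd-rank : ∀ w → r ≤ bars w → odd (rank w) ≡ not (odd (weight w))
    odd-rank w p = cong not (trans (sym (odd-double (weight w ∸ (r + r)) r)) (cong odd (ℕₚ.m∸n+n≡m (2r≤weight w p))))

    ρ-parity : ∀ w → r ≤ bars w → ρ (just (fam w)) % 2 ≡ toℕᵇ (not (odd (weight w)))
    ρ-parity w p = trans (%2≡odd (ρ (just (fam w)))) (cong toℕᵇ (trans (cong odd (ρ-fam w p)) (odd-rank w p)))

    toℕᵇ-injective : ∀ {b c} → toℕᵇ b ≡ toℕᵇ c → b ≡ c
    toℕᵇ-injective {false} {false} e = refl
    toℕᵇ-injective {true}  {true}  e = refl

    Coded : (Word n → Set) → Bool → Maybe (Fam n) → Set
    Coded P e z = ∃ λ w → z ≡ just (fam w) × P w × ρ z % 2 ≡ toℕᵇ e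

    -- Rank and weight differ by the odd number 1 - 2r, so rank parity `e` means weight parity
    -- `not e`.
    card-coded : ∀ {P : Word n → Set} (P? : ∀ z → Dec (P z)) → (∀ z → P z → r ≤ bars z) → ∀ e →
      HasCard (Coded P e) (length (ofParity P? (not e)))
    card-coded {P} P? big e =
      List.map code ws , unique-map code (λ p q e → injective p q (just-injective e)) sizes (Uniqueₚ.filter⁺ (ofParity? P? (not e)) (words-unique n)) ,
      length-map code ws , complete , sound
      where
      ws = ofParity P? (not e)
      code : Word n → Maybe (Fam n)
      code w = just (fam w)
      sizes : All (λ w → r ≤ bars w) ws
      sizes = All.tabulate λ {w} i → big w (proj₁ (proj₂ (∈-filter⁻ (ofParity? P? (not e)) {xs = words n} i)))
      complete : ∀ a → Coded P e a → a ∈ List.map code ws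
      complete a (w , refl , p , q) = ∈-map⁺ code (∈-filter⁺ (ofParity? P? (not e)) (∈-words w)
        (p , trans (sym (not-involutive (odd (weight w)))) (cong not (toℕᵇ-injective (trans (sym (ρ-parity w (big w p))) q)))))
      sound : ∀ a → a ∈ List.map code ws → Coded P e a
      sound a i with ∈-map⁻ code i
      ... | w , j , refl with ∈-filter⁻ (ofParity? P? (not e)) {xs = words n} j
      ... | _ , p , q = w , refl , p , trans (ρ-parity w (big w p)) (cong toℕᵇ (trans (cong not q) (not-involutive e)))

    HasCard-map : ∀ {A : Set} {P Q : A → Set} {m} → (∀ a → P a → Q a) → (∀ a → Q a → P a) → HasCard P m → HasCard Q m
    HasCard-map f g (xs , u , l , c , s) = xs , u , l , (λ a q → c a (g a q)) , λ a i → f a (s a i)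

    equal-lengths : ∀ {a b d : ℕ} → ℤ.+ a ℤ.- ℤ.+ b ≡ ℤ.+ d → a ≡ d + b
    equal-lengths {a} {b} {d} e = ℤₚ.+-injective (trans
      (solve 2 (λ a b → a := (a :- b) :+ b) refl (ℤ.+ a) (ℤ.+ b)) (trans (cong (ℤ._+ (ℤ.+ b)) e) (sym (ℤₚ.pos-+ d b))))
      where open +-*-Solver

    Upper : Word n → Word n → Word n → Set
    Upper wx wy z = Cyc wx z × Cyc z wy

    Upper? : ∀ wx wy z → Dec (Upper wx wy z)
    Upper? wx wy z = Cyc? wx z ×-dec Cyc? z wy

    Below : Word n → Word n → Set
    Below wy z = r ≤ bars z × Cyc z wy

    Below? : ∀ wy z → Dec (Below wy z)
    Below? wy z = map′ (λ t → ≤?ᵇ⁻ r (bars z) (Equivalence.to T-≡ t)) (λ p → Equivalence.from T-≡ (≤?ᵇ⁺ p)) (T? (r ≤?ᵇ bars z)) ×-dec Cyc? z wy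

    Between : Maybe (Fam n) → Maybe (Fam n) → Bool → Maybe (Fam n) → Set
    Between x y e z = InPh n k z × x ≤h z × z ≤h y × ρ z % 2 ≡ toℕᵇ e

    card-upper : ∀ wx wy → r ≤ bars wx → ∀ e → HasCard (Between (just (fam wx)) (just (fam wy)) e) (length (ofParity (Upper? wx wy) (not e)))
    card-upper wx wy p e = HasCard-map to from (card-coded (Upper? wx wy) big e)
      where
      big : ∀ z → Upper wx wy z → r ≤ bars z
      big z (c , _) = ℕₚ.≤-trans p (Cyc-bars wx z c)
      to : ∀ a → Coded (Upper wx wy) e a → Between (just (fam wx)) (just (fam wy)) e a
      to a (w , refl , (c , d) , q) = inP w (big w (c , d)) , Cyc⇒⊆F wx w c , Cyc⇒⊆F w wy d , q
      from : ∀ a → Between (just (fam wx)) (just (fam wy)) e a → Coded (Upper wx wy) e a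
      from (just a) (i , l , u , q) with InP⇒word 2≤n-k i
      ... | w , b , refl = w , refl , (⊆⇒Cyc wx w p l , ⊆⇒Cyc w wy b u) , q

    card-below-odd : ∀ wy → HasCard (Between nothing (just (fam wy)) true) (length (ofParity (Below? wy) false))
    card-below-odd wy = HasCard-map to from (card-coded (Below? wy) (λ _ → proj₁) true)
      where
      to : ∀ a → Coded (Below wy) true a → Between nothing (just (fam wy)) true a
      to a (w , refl , (b , d) , q) = inP w b , tt , Cyc⇒⊆F w wy d , q
      from : ∀ a → Between nothing (just (fam wy)) true a → Coded (Below wy) true a
      from (just a) (i , l , u , q) with InP⇒word 2≤n-k i
      ... | w , b , refl = w , refl , (b , ⊆⇒Cyc w wy b u) , q

    card-below-even : ∀ wy → HasCard (Between nothing (just (fam wy)) false) (suc (length (ofParity (Below? wy) true)))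
    card-below-even wy with card-coded (Below? wy) (λ _ → proj₁) false
    ... | xs , u , l , c , s = nothing ∷ xs , All.tabulate (λ i e → fresh (subst (_∈ xs) (sym e) i)) ∷ u , cong suc l , complete , sound
      where
      fresh : ¬ (nothing ∈ xs)
      fresh i with s nothing i
      ... | _ , () , _
      complete : ∀ a → Between nothing (just (fam wy)) false a → a ∈ nothing ∷ xs
      complete nothing  _ = here refl
      complete (just a) (i , _ , v , q) with InP⇒word 2≤n-k i
      ... | w , b , refl = there (c (just (fam w)) (w , refl , (b , ⊆⇒Cyc w wy b v) , q))
      sound : ∀ a → a ∈ nothing ∷ xs → Between nothing (just (fam wy)) false a
      sound _ (here refl) = tt , tt , tt , refl
      sound a (there i) with s a i
      ... | w , refl , (b , d) , q = inP w b , tt , Cyc⇒⊆F w wy d , q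

    euler : EulerCond n k ρ
    euler nothing nothing _ _ _ ()
    euler nothing (just y) _ Py _ _ with InP⇒word 2≤n-k Py
    -- Below `y` the words of even weight, which have odd rank, outnumber the others by one. The
    -- adjoined minimum, of even rank, restores equality.
    ... | w , b , refl = suc (length (ofParity (Below? w) true)) , card-below-even w ,
      subst (HasCard _) (equal-lengths (trans (sym (signed-count (Below? w))) (below-sum r w (ℕₚ.≤-trans 1≤r b) b))) (card-below-odd w)
    euler (just x) (just y) Px Py x≤y gap with InP⇒word 2≤n-k Px | InP⇒word 2≤n-k Py
    ... | wx , bx , refl | wy , _ , refl = length (ofParity (Upper? wx wy) true) , card-upper wx wy bx false ,
      subst (HasCard _) (equal-lengths (trans (sym (signed-count (Upper? wx wy))) (interval-sum wx wy (ℕₚ.≤-trans 1≤r bx) ne))) (card-upper wx wy bx true)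
      where
      ne : wx ≢ wy
      ne refl = ℕₚ.<⇒≱ (ℕₚ.n<1+n _) (ℕₚ.≤-trans (ℕₚ.n≤1+n _) gap)

    covers : ∀ x y → Covers n k x y → ρ y ≡ suc (ρ x)
    covers nothing nothing (_ , _ , (_ , ne) , _) = ⊥-elim (ne refl)
    covers (just x) nothing (_ , _ , (() , _) , _)
    covers nothing (just y) (_ , Py , _ , none) with InP⇒word 2≤n-k Py
    ... | w , b , refl with weight w ≟ r + r
    ... | yes e = trans (ρ-fam w b) (cong suc (trans (cong (_∸ (r + r)) e) (ℕₚ.n∸n≡0 (r + r))))
    ... | no ne with lower-minimal r w b ne
    -- A word of weight above 2r has another element strictly between it and the minimum, so it does
    -- not cover the minimum.
    ... | z , c , b′ , e = ⊥-elim (none (just (fam z)) (inP z b′) ((tt , λ ()) , Cyc⇒⊆F z w c ,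
      λ q → ℕₚ.1+n≢n (trans e (cong weight (sym (injective b′ b (just-injective q)))))))
    covers (just x) (just y) (Px , Py , (x≤y , ne) , none) with InP⇒word 2≤n-k Px | InP⇒word 2≤n-k Py
    ... | wx , bx , refl | wy , by , refl with lower wx wy (ℕₚ.≤-trans 1≤r bx) (λ e → ne (cong (λ w → just (fam w)) e)) (⊆⇒Cyc wx wy bx x≤y)
    -- `z` lies in the interval with weight one less than `wy`. Since nothing lies strictly between,
    -- it must be `wx`.
    ... | z , c₁ , c₂ , e with z ≟ᵂ wx
    ... | yes refl = trans (ρ-fam wy by) (trans (rank-suc wx wy bx e) (cong suc (sym (ρ-fam wx bx))))
    ... | no z≢wx = ⊥-elim (none (just (fam z)) (inP z bz) ((Cyc⇒⊆F wx z c₁ , λ q → z≢wx (sym (injective bx bz (just-injective q)))) ,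
        Cyc⇒⊆F z wy c₂ , λ q → ℕₚ.1+n≢n (trans e (cong weight (sym (injective bz by (just-injective q)))))))
      where
      bz : r ≤ bars z
      bz = ℕₚ.≤-trans bx (Cyc-bars wx z c₁)

    top : Maybe (Fam n)
    top = just (fam (full n))

    top-InPh : InPh n k top
    top-InPh = inP (full n) (subst (r ≤_) (sym (bars-full n)) (ℕₚ.m∸n≤m n k))

    ≤top : ∀ x → InPh n k x → x ≤h top
    ≤top nothing _ = tt
    ≤top (just x) Px with InP⇒word 2≤n-k Px
    ... | w , _ , refl = Cyc⇒⊆F w (full n) (Succ⇒Cyc w (full n) (⊴-run false (⊴-full w)))

    maximal : ∀ x y → Maximal n k x → Maximal n k y → ρ x ≡ ρ y
    maximal x y (Px , mx) (Py , my) = cong ρ (trans (sym (mx top top-InPh (≤top x Px))) (my top top-InPh (≤top y Py)))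

    eulerian : EulerianPh n k
    eulerian = ρ , (refl , covers , maximal) , euler

open Eulerian

theorem5p5 : (n k : ℕ) → 1 ≤ k → 2 ≤ n ∸ k → EulerianPh n k
-- Subtraction is truncated, so a nonzero `n ∸ k` forces `k < n`.
theorem5p5 n k _ p = Poset.eulerian (ℕₚ.<⇒≤ (ℕₚ.m∸n≢0⇒n<m λ e → case subst (2 ≤_) e p of λ ())) p
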